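{- Let $n\ge 6$. The sequence $\mathrm{RCL}(\mathcal{T}_n)$ is an orientable sequence of order $n$ of length $L_n$, and it has successor rule $g$, i.e. for each length-$n$ cyclic window $\alpha$ of $\mathrm{RCL}(\mathcal{T}_n)$, the bit following $\alpha$ is $g(\alpha)$.
   Context: Binary strings are compared lexicographically with $0<1$ (a proper prefix is smaller). For $\alpha=a_1\cdots a_n$, $\alpha^R=a_n\cdots a_1$. $[\alpha]$ is the set of rotations; $\alpha$ is a necklace if lexicographically smallest in $[\alpha]$; a bracelet if lexicographically smallest in $[\alpha]\cup[\alpha^R]$; a necklace is symmetric if $\alpha^R\in[\alpha]$, else asymmetric. $\mathbf{A}(n)$: length-$n$ asymmetric bracelets. $\alpha$ is periodic if $\alpha=\gamma^j$ with $j>1$; $\mathrm{ap}(\alpha)$ is the shortest $\gamma$ with $\alpha=\gamma^t$, $t\ge1$; $L_n=\sum_{\alpha\in\mathbf{A}(n)}|\mathrm{ap}(\alpha)|$. For $\alpha=a_1\cdots a_n$: $\mathrm{FirstOne}(\alpha)$ flips the first $1$ to $0$; $\mathrm{LastOne}(\alpha)$ is the necklace of $a_1\cdots a_{n-1}0$; $\mathrm{LastZero}(\alpha)$ flips the last $0$ to $1$. With $r_n=0^{n-4}1011$, $\mathrm{par}(\alpha)$ for $\alpha\in\mathbf{A}(n)\setminus\{r_n\}$ is $\mathrm{FirstOne}(\alpha)$ if this lies in $\mathbf{A}(n)$, else $\mathrm{LastOne}(\alpha)$ if this lies in $\mathbf{A}(n)$, else $\mathrm{LastZero}(\alpha)$.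 The concatenation tree $\mathcal{T}_n$ is the rooted tree defined recursively: the root has label $r_n$ and change index $n$; a node with label $\alpha$ and change index $c$ has no children if $\alpha$ is periodic; otherwise, with $\beta$ the necklace of $[\alpha]$ and $\alpha_k$ the string $\alpha$ with bit $k$ complemented, its children are the nodes labeled $\alpha_k$ with change index $k$, for each $k\in\{1,\dots,n\}$ such that the necklace of $[\alpha_k]$ lies in $\mathbf{A}(n)$ and has $\mathrm{par}$ equal to $\beta$; the children with $k>c$ are the right-children and those with $k<c$ the left-children, each list ordered by increasing $k$. A right-current-left (RCL) traversal visits, recursively, the right-children first to last, then the current node, then the left-children first to last; $\mathrm{RCL}(\mathcal{T}_n)$ is the concatenation of $\mathrm{ap}(\alpha)$ over nodes $\alpha$ in RCL order starting at the root, viewed as a cyclic sequence. $g$ is the function on $\mathbf{S}(n)=\bigcup_{\alpha\in\mathbf{A}(n)}[\alpha]$ defined by: for $\alpha=a_1\cdots a_n$, let $\beta_1=0^{n-i}1a_2\cdots a_i$ ($i$ the largest index with $a_i=1$), $\beta_2=a_2\cdots a_n1$, $\beta_3=a_j\cdots a_n0\,1^{j-2}$ ($j>1$ the smallest index $>1$ with $a_j=0$); $g(\alpha)=\overline{a_1}$ if ($\beta_1,\mathrm{FirstOne}(\beta_1)\in\mathbf{A}(n)$) or ($\beta_2,\mathrm{LastOne}(\beta_2)\in\mathbf{A}(n)$ and $\mathrm{FirstOne}(\beta_2)\notin\mathbf{A}(n)$) or ($\beta_3,\mathrm{LastZero}(\beta_3)\in\mathbf{A}(n)$ and $\mathrm{FirstOne}(\beta_3),\mathrm{LastOne}(\beta_3)\notin\mathbf{A}(n)$),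 and $g(\alpha)=a_1$ otherwise. An orientable sequence of order $n$ is a cyclic binary sequence $s_1\cdots s_m$ such that the $m$ cyclic length-$n$ windows of $s_1\cdots s_m$ together with the $m$ cyclic length-$n$ windows of $s_m\cdots s_1$ are $2m$ pairwise distinct strings; its length is $m$. -}

module Defs where

open import Data.Bool using (Bool; true; false; not; _∧_; _∨_; if_then_else_; T)
open import Data.Nat using (ℕ; zero; suc; _+_; _∸_; _<ᵇ_; _≡ᵇ_; _≤_)
open import Data.List using (List; []; _∷_; _++_; length; reverse; take; drop; map; concat; replicate; upTo; filterᵇ; foldr)
open import Data.Bool.ListAction using (any; all)
open import Data.Nat.ListAction using (sum)
open import Data.Maybe using (Maybe; just; nothing)
open import Data.Product using (_×_; _,_; Σ; proj₂)
open import Data.List.Relation.Unary.Unique.Propositional using (Unique)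
open import Relation.Binary.PropositionalEquality using (_≡_)

-- Binary strings: false = 0, true = 1.
Str : Set
Str = List Bool

eqB : Bool → Bool → Bool
eqB true  true  = true
eqB false false = true
eqB _     _     = false

eqS : Str → Str → Bool
eqS []       []       = true
eqS (a ∷ x)  (b ∷ y)  = eqB a b ∧ eqS x y
eqS _        _        = false

leq : Str → Str → Bool
leq []          _           = true
leq (_ ∷ _)     []          = false
leq (false ∷ x) (true ∷ y)  = true
leq (true ∷ x)  (false ∷ y) = false
leq (false ∷ x) (false ∷ y) = leq x y
leq (true ∷ x)  (true ∷ y)  = leq x y

oneTo : ℕ → List ℕ
oneTo n = map suc (upTo n)

allStrs : ℕ → List Str
allStrs zero    = [] ∷ []
allStrs (suc n) = map (false ∷_) (allStrs n) ++ map (true ∷_) (allStrs n)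

rot : ℕ → Str → Str
rot k α = drop k α ++ take k α

rotations : Str → List Str
rotations α = map (λ k → rot k α) (upTo (length α))

minS : Str → List Str → Str
minS d []       = d
minS d (x ∷ xs) = let m = minS x xs in if leq x m then x else m

neck : Str → Str
neck α = minS α (rotations α)

isNecklace : Str → Bool
isNecklace α = all (leq α) (rotations α)

isBracelet : Str → Bool
isBracelet α = all (leq α) (rotations α ++ rotations (reverse α))

isSymmetric : Str → Bool
isSymmetric α = any (eqS (reverse α)) (rotations α)

-- α ∈ A(n): length-n asymmetric bracelet (a bracelet is a necklace)
inA : ℕ → Str → Bool
inA n α = (length α ≡ᵇ n) ∧ isBracelet α ∧ isNecklace α ∧ not (isSymmetric α)

Alist : ℕ → List Str
Alist n = filterᵇ (inA n) (allStrs n)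

inS : ℕ → Str → Bool
inS n α = any (λ γ → any (eqS α) (rotations γ)) (Alist n)

pow : Str → ℕ → Str
pow γ t = concat (replicate t γ)

isPeriodic : Str → Bool
isPeriodic α =
  any (λ p → any (λ j → eqS (pow (take p α) (suc (suc j))) α) (upTo (length α)))
      (oneTo (length α))

-- ap(α): shortest γ with α = γ^t, t ≥ 1 (candidates γ = prefixes by increasing length)
isPowerOf : Str → Str → Bool
isPowerOf γ α = any (λ t → eqS (pow γ t) α) (oneTo (length α))

firstS : Str → List Str → Str
firstS d []      = d
firstS d (x ∷ _) = x

ap : Str → Str
ap α = firstS α (filterᵇ (λ γ → isPowerOf γ α) (map (λ p → take p α) (oneTo (length α))))

L : ℕ → ℕ
L n = sum (map (λ α → length (ap α)) (Alist n))

firstOne : Str → Str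
firstOne []          = []
firstOne (true ∷ x)  = false ∷ x
firstOne (false ∷ x) = false ∷ firstOne x

firstZero : Str → Str
firstZero []          = []
firstZero (false ∷ x) = true ∷ x
firstZero (true ∷ x)  = true ∷ firstZero x

lastZero : Str → Str
lastZero α = reverse (firstZero (reverse α))

dropLast : Str → Str
dropLast α = reverse (Data.List.drop 1 (reverse α))

lastOne : Str → Str
lastOne α = neck (dropLast α ++ false ∷ [])

root : ℕ → Str
root n = replicate (n ∸ 4) false ++ true ∷ false ∷ true ∷ true ∷ []

par : ℕ → Str → Str
par n α = if inA n (firstOne α) then firstOne α
          else if inA n (lastOne α) then lastOne α
          else lastZero α

-- complement bit k (1-indexed)
flipAt : ℕ → Str → Str
flipAt _             []      = []
flipAt zero          x       = x
flipAt (suc zero)    (b ∷ x) = not b ∷ x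
flipAt (suc (suc k)) (b ∷ x) = b ∷ flipAt (suc k) x

-- child condition for complementing bit k of node label α (necklace β = neck α):
-- the necklace of [α_k] lies in A(n), is not the root (par is undefined there),
-- and its parent is β
childOK : ℕ → Str → ℕ → Bool
childOK n α k =
  let γ = neck (flipAt k α) in
  inA n γ ∧ not (eqS γ (root n)) ∧ eqS (par n γ) (neck α)

children : ℕ → Str → List (ℕ × Str)
children n α = map (λ k → k , flipAt k α) (filterᵇ (childOK n α) (oneTo n))

rightChildren : ℕ → ℕ → Str → List (ℕ × Str)
rightChildren n c α = filterᵇ (λ p → c <ᵇ Data.Product.proj₁ p) (children n α)

leftChildren : ℕ → ℕ → Str → List (ℕ × Str)
leftChildren n c α = filterᵇ (λ p → Data.Product.proj₁ p <ᵇ c) (children n α)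

-- RCLnode n c α s : the subtree of T_n at the node with label α and change index c
-- is finite and its RCL traversal concatenates (ap of labels) to s.
mutual
  data RCLnode (n : ℕ) : ℕ → Str → Str → Set where
    leaf  : ∀ {c α} → isPeriodic α ≡ true → RCLnode n c α (ap α)
    inner : ∀ {c α sR sL} → isPeriodic α ≡ false →
            RCLlist n (rightChildren n c α) sR →
            RCLlist n (leftChildren n c α) sL →
            RCLnode n c α (sR ++ ap α ++ sL)

  data RCLlist (n : ℕ) : List (ℕ × Str) → Str → Set where
    nil  : RCLlist n [] []
    cons : ∀ {k α s ks t} → RCLnode n k α s → RCLlist n ks t →
           RCLlist n ((k , α) ∷ ks) (s ++ t)

RCLTree : ℕ → Str → Set
RCLTree n s = RCLnode n n (root n) s

-- cyclic windows: window i (0-indexed) of cyclic s = s_{i+1} ⋯ s_{i+n} (indices mod |s|)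
window : ℕ → Str → ℕ → Str
window n s i = take n (drop i (pow s (suc (suc n))))

windows : ℕ → Str → List Str
windows n s = map (window n s) (upTo (length s))

headM : Str → Maybe Bool
headM []      = nothing
headM (b ∷ _) = just b

nextBit : ℕ → Str → ℕ → Maybe Bool
nextBit n s i = headM (drop (i + n) (pow s (suc (suc n))))

Orientable : ℕ → Str → Set
Orientable n s = Unique (windows n s ++ windows n (reverse s))

largestOneIdx : Str → ℕ   -- largest i with a_i = 1 (0 if none)
largestOneIdx []          = 0
largestOneIdx (b ∷ x) with largestOneIdx x
... | zero  = if b then 1 else 0
... | suc i = suc (suc i)

leadingOnes : Str → ℕ
leadingOnes []          = 0
leadingOnes (true ∷ x)  = suc (leadingOnes x)
leadingOnes (false ∷ _) = 0

g : ℕ → Str → Bool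
g n []      = false
g n (a ∷ x) =
  let α  = a ∷ x
      i  = largestOneIdx α
      β₁ = replicate (n ∸ i) false ++ true ∷ take (i ∸ 1) x
      β₂ = x ++ true ∷ []
      j  = suc (suc (leadingOnes x))         -- smallest index j > 1 with a_j = 0
      β₃ = drop (j ∸ 1) α ++ false ∷ replicate (j ∸ 2) true
      c₁ = inA n β₁ ∧ inA n (firstOne β₁)
      c₂ = inA n β₂ ∧ inA n (lastOne β₂) ∧ not (inA n (firstOne β₂))
      c₃ = inA n β₃ ∧ inA n (lastZero β₃) ∧ not (inA n (firstOne β₃)) ∧ not (inA n (lastOne β₃))
  in if c₁ ∨ c₂ ∨ c₃ then not a else a

SuccessorRule : ℕ → Str → Set
SuccessorRule n s = ∀ i → i Data.Nat.< length s →
  inS n (window n s i) ≡ true × nextBit n s i ≡ just (g n (window n s i))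

{-# OPTIONS --safe #-}
module Submission where

-- A string in A(n) has the form 0ⁱ w with w = 1⋯1 and no longer run of zeros
-- in any rotation. FirstOne and LastOne create a unique longest run of zeros,
-- so they stay in A(n) exactly when the remaining core is smaller than its
-- reversal. LastZero always preserves bracelets, and when the other two fail
-- it yields a symmetric string only for r_n; hence par is a map into A(n). It
-- raises (length of the initial run of zeros, number of ones)
-- lexicographically, so A(n) is a tree under par with root r_n.
--
-- The key fact about par is that the conjugate pair {0x, 1x} joining γ to its
-- parent is unique: otherwise a letter of γ could be moved across a run of the
-- opposite letter with a rotation of γ as result, and this forces γ to be
-- symmetric. Thus g complements the first bit of a window exactly at the pairs
-- {0x, 1x} that are edges of the tree.
--
-- Reading a node label α with change index c from bit c + 1 cyclically to bit
-- c − 1 under g makes a detour through the subtree of α_k just before bit k is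
-- read again, so the emitted string is the RCL traversal of the subtree, up to
-- the prefix of α before c that is read once more at the end. At the root this
-- is a closed walk of g through all of S(n). It visits the window just before
-- closing only once, so by determinism all windows are distinct, and as A(n)
-- contains no string together with a rotation of its reversal, the reversed
-- windows are new.

open import Defs
open import Data.Bool using (Bool; T; T?; true; false; not; _∧_; _∨_; if_then_else_)
open import Data.Bool.ListAction using (any; all)
open import Data.Bool.Properties using (not-¬; not-involutive; T-≡)
open import Data.Empty using (⊥; ⊥-elim)
open import Data.List using (List; []; _∷_; _++_; length; reverse; take; drop; map; concat; replicate; upTo; filterᵇ; applyUpTo; applyDownFrom)
open import Data.List.Membership.Propositional using (_∈_)
open import Data.List.Membership.Propositional.Properties using (∈-map⁺; ∈-map⁻; ∈-upTo⁺; ∈-upTo⁻; ∈-applyUpTo⁺; ∈-applyUpTo⁻; ∈-++⁺ˡ; ∈-++⁺ʳ; ∈-++⁻; ∈-filter⁺; ∈-filter⁻; ∈-concat⁺′; ∈-concat⁻′)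
open import Data.List.Membership.Propositional.Properties.WithK using (unique∧set⇒bag)
open import Data.List.Properties using (++-assoc; ++-identityʳ; length-++; length-replicate; length-reverse; length-take; length-applyUpTo; reverse-++; unfold-reverse; reverse-involutive; reverse-applyUpTo; ++-cancelˡ; take++drop≡id; ∷-injectiveˡ; ∷-injectiveʳ; map-applyUpTo; map-upTo)
open import Data.List.Relation.Binary.BagAndSetEquality using (∼bag⇒↭)
open import Data.List.Relation.Binary.Disjoint.Propositional using (Disjoint)
open import Data.List.Relation.Binary.Permutation.Propositional.Properties using (↭-length)
open import Data.List.Relation.Unary.All as All using (All)
open import Data.List.Relation.Unary.All.Properties using () renaming (++⁺ to All-++⁺; applyUpTo⁺₁ to All-applyUpTo⁺; applyUpTo⁻ to All-applyUpTo⁻)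
open import Data.List.Relation.Unary.AllPairs as AllPairs using ()
open import Data.List.Relation.Unary.Any using (here; there)
open import Data.List.Relation.Unary.Unique.Propositional using (Unique)
open import Data.List.Relation.Unary.Unique.Propositional.Properties using () renaming (map⁺ to Unique-map⁺; ++⁺ to Unique-++⁺; filter⁺ to Unique-filter⁺; applyUpTo⁺₁ to Unique-applyUpTo⁺)
open import Data.Maybe using (just)
open import Data.Nat using (ℕ; zero; suc; _+_; _*_; _∸_; _≤_; _<_; z≤n; s≤s; _≤?_; _≟_; _<ᵇ_; _≡ᵇ_)
open import Data.Nat.DivMod using (_%_; _/_; m≡m%n+[m/n]*n; [m+kn]%n≡m%n; m%n<n; m<n⇒m%n≡m)
open import Data.Nat.Induction using (<-rec)
open import Data.Nat.ListAction using (sum)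
open import Data.Nat.Properties hiding (_≟_; _≤?_)
open import Data.Nat.Tactic.RingSolver using (solve-∀)
open import Data.Product using (Σ; _×_; _,_; proj₁; proj₂)
open import Data.Sum using (_⊎_; inj₁; inj₂; [_,_]′)
open import Function using (mk⇔; Equivalence; _∘_)
open import Relation.Binary using (tri<; tri≈; tri>)
open import Relation.Binary.PropositionalEquality using (_≡_; _≢_; refl; sym; trans; cong; cong₂; subst; subst₂; module ≡-Reasoning)
open import Relation.Nullary using (¬_; yes; no)

-- Lexicographic order

-- Uniqueness of the pair is what lets the walk follow the tree: if a label had two positions whose
-- complements gave the same child necklace, `g` would enter that subtree twice. With uniqueness, an
-- aperiodic label meets each edge at one position only, and a periodic label meets the edge to its
-- parent once per period. Every parent is primitive, so ending the tree at periodic labels cuts off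
-- no descendant, and a visit to such a label emits just one period. LastZero is the hard case of
-- the parent map. FirstOne and LastOne are decided by comparing a core with its reversal; for
-- LastZero, asymmetry has to be extracted from the failure of these two comparisons, which takes a
-- letter-by-letter analysis of both ends of the core. Symmetry is handled through bit functions on
-- ℕ that are periodic modulo the length: a string is symmetric as soon as its bit function is
-- invariant under some reflection.

infix 4 _≺_ _≼_

-- Strings are compared at their first difference only, so a proper prefix is unrelated to its
-- extension. On strings of equal length this is the lexicographic order. As `now` leaves the tails
-- arbitrary, most comparisons need no bookkeeping of lengths.
data _≺_ : Str → Str → Set where
  now   : ∀ {x y} → false ∷ x ≺ true ∷ y
  later : ∀ {b x y} → x ≺ y → b ∷ x ≺ b ∷ y

_≼_ : Str → Str → Set
x ≼ y = x ≺ y ⊎ x ≡ y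

≺-irrefl : ∀ {x} → ¬ x ≺ x
≺-irrefl (later p) = ≺-irrefl p

≺-trans : ∀ {x y z} → x ≺ y → y ≺ z → x ≺ z
≺-trans now       (later q) = now
≺-trans (later p) now       = now
≺-trans (later p) (later q) = later (≺-trans p q)

≺-asym : ∀ {x y} → x ≺ y → ¬ y ≺ x
≺-asym p q = ≺-irrefl (≺-trans p q)

≺-cmp : ∀ x y → length x ≡ length y → x ≺ y ⊎ x ≡ y ⊎ y ≺ x
≺-cmp []          []          _ = inj₂ (inj₁ refl)
≺-cmp (false ∷ x) (true ∷ y)  _ = inj₁ now
≺-cmp (true ∷ x)  (false ∷ y) _ = inj₂ (inj₂ now)
≺-cmp (false ∷ x) (false ∷ y) e with ≺-cmp x y (suc-injective e)
... | inj₁ p        = inj₁ (later p)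
... | inj₂ (inj₁ p) = inj₂ (inj₁ (cong (false ∷_) p))
... | inj₂ (inj₂ p) = inj₂ (inj₂ (later p))
≺-cmp (true ∷ x)  (true ∷ y)  e with ≺-cmp x y (suc-injective e)
... | inj₁ p        = inj₁ (later p)
... | inj₂ (inj₁ p) = inj₂ (inj₁ (cong (true ∷_) p))
... | inj₂ (inj₂ p) = inj₂ (inj₂ (later p))

⊀⇒≽ : ∀ x y → length x ≡ length y → ¬ x ≺ y → y ≼ x
⊀⇒≽ x y e ¬p with ≺-cmp x y e
... | inj₁ p        = ⊥-elim (¬p p)
... | inj₂ (inj₁ p) = inj₂ (sym p)
... | inj₂ (inj₂ p) = inj₁ p

≺-prepend : ∀ p {x y} → x ≺ y → p ++ x ≺ p ++ y
≺-prepend []      q = q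
≺-prepend (_ ∷ p) q = later (≺-prepend p q)

≺-cancel : ∀ p {x y} → p ++ x ≺ p ++ y → x ≺ y
≺-cancel []      q         = q
≺-cancel (_ ∷ p) (later q) = ≺-cancel p q

≺⇒leq : ∀ {x y} → x ≺ y → leq x y ≡ true
≺⇒leq now                   = refl
≺⇒leq (later {false} p)     = ≺⇒leq p
≺⇒leq (later {true} p)      = ≺⇒leq p

leq-refl : ∀ x → leq x x ≡ true
leq-refl []          = refl
leq-refl (false ∷ x) = leq-refl x
leq-refl (true ∷ x)  = leq-refl x

leq⇒⊁ : ∀ {x y} → leq x y ≡ true → ¬ y ≺ x
leq⇒⊁ e (later {false} p) = leq⇒⊁ e p
leq⇒⊁ e (later {true} p)  = leq⇒⊁ e p

⊁⇒leq : ∀ x y → length x ≡ length y → ¬ y ≺ x → leq x y ≡ true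
⊁⇒leq x y e ¬p with ≺-cmp x y e
... | inj₁ p           = ≺⇒leq p
... | inj₂ (inj₁ refl) = leq-refl x
... | inj₂ (inj₂ p)    = ⊥-elim (¬p p)

eqS⇒≡ : ∀ x y → eqS x y ≡ true → x ≡ y
eqS⇒≡ []          []          _ = refl
eqS⇒≡ (false ∷ x) (false ∷ y) e = cong (false ∷_) (eqS⇒≡ x y e)
eqS⇒≡ (true ∷ x)  (true ∷ y)  e = cong (true ∷_) (eqS⇒≡ x y e)

eqS-refl : ∀ x → eqS x x ≡ true
eqS-refl []          = refl
eqS-refl (false ∷ x) = eqS-refl x
eqS-refl (true ∷ x)  = eqS-refl x

≡⇒eqS : ∀ {x y} → x ≡ y → eqS x y ≡ true
≡⇒eqS {x} refl = eqS-refl x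

-- Booleans and factorizations of lists

bool-cases : ∀ b → b ≡ true ⊎ b ≡ false
bool-cases true  = inj₁ refl
bool-cases false = inj₂ refl

true≢false : ∀ {b} → b ≡ true → b ≡ false → ⊥
true≢false refl ()

∧-true⁻ : ∀ {a b} → a ∧ b ≡ true → a ≡ true × b ≡ true
∧-true⁻ {true} e = refl , e

∧-true⁺ : ∀ {a b} → a ≡ true → b ≡ true → a ∧ b ≡ true
∧-true⁺ refl e = e

not-true⁻ : ∀ {a} → not a ≡ true → a ≡ false
not-true⁻ {false} _ = refl

≢true⇒false : ∀ {a} → a ≢ true → a ≡ false
≢true⇒false {true}  p = ⊥-elim (p refl)
≢true⇒false {false} p = refl

any⁻ : ∀ {A : Set} (p : A → Bool) xs → any p xs ≡ true → Σ A λ x → x ∈ xs × p x ≡ true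
any⁻ p (x ∷ xs) e with p x in eq
... | true  = x , here refl , eq
... | false with any⁻ p xs e
...   | y , m , q = y , there m , q

any⁺ : ∀ {A : Set} (p : A → Bool) {x} {xs} → x ∈ xs → p x ≡ true → any p xs ≡ true
any⁺ p (here refl) e rewrite e = refl
any⁺ p {xs = y ∷ _} (there m) e with p y
... | true  = refl
... | false = any⁺ p m e

all⁻ : ∀ {A : Set} (p : A → Bool) {x} {xs} → all p xs ≡ true → x ∈ xs → p x ≡ true
all⁻ p e (here refl) = proj₁ (∧-true⁻ e)
all⁻ p {xs = y ∷ _} e (there m) = all⁻ p (proj₂ (∧-true⁻ {p y} e)) m

all⁺ : ∀ {A : Set} (p : A → Bool) xs → (∀ {x} → x ∈ xs → p x ≡ true) → all p xs ≡ true
all⁺ p []       f = refl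
all⁺ p (x ∷ xs) f = ∧-true⁺ (f (here refl)) (all⁺ p xs (λ m → f (there m)))

-- Two factorizations of one list are compared by which cut comes first; equal cuts fall under the
-- first alternative, with `e` empty.
++-split : ∀ {A : Set} (a : List A) {b} c {d} → a ++ b ≡ c ++ d →
  (Σ (List A) λ e → c ≡ a ++ e × b ≡ e ++ d) ⊎
  (Σ A λ x → Σ (List A) λ e → a ≡ c ++ x ∷ e × d ≡ x ∷ e ++ b)
++-split []      c        p = inj₁ (c , refl , p)
++-split (x ∷ a) []       p = inj₂ (x , a , refl , sym p)
++-split (x ∷ a) (y ∷ c) p with ∷-injectiveˡ p | ++-split a c (∷-injectiveʳ p)
... | refl | inj₁ (e , q , r)     = inj₁ (e , cong (x ∷_) q , r)
... | refl | inj₂ (z , e , q , r) = inj₂ (z , e , cong (x ∷_) q , r)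

++-length-split : ∀ {A : Set} (a : List A) {b} c {d} → length a ≡ length c → a ++ b ≡ c ++ d → a ≡ c × b ≡ d
++-length-split []      []      _ p = refl , p
++-length-split (x ∷ a) (y ∷ c) e p with ∷-injectiveˡ p | ++-length-split a c (suc-injective e) (∷-injectiveʳ p)
... | refl | q , r = cong (x ∷_) q , r

++-length-splitʳ : ∀ {A : Set} (a : List A) {b} c {d} → length b ≡ length d → a ++ b ≡ c ++ d → a ≡ c × b ≡ d
++-length-splitʳ a {b} c {d} e p = ++-length-split a c
  (+-cancelʳ-≡ (length d) (length a) (length c)
    (trans (cong (length a +_) (sym e)) (trans (sym (length-++ a)) (trans (cong length p) (length-++ c))))) p

replicate-++ : ∀ {A : Set} m n {x : A} → replicate (m + n) x ≡ replicate m x ++ replicate n x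
replicate-++ zero    n     = refl
replicate-++ (suc m) n {x} = cong (x ∷_) (replicate-++ m n)

replicate-∷ʳ : ∀ {A : Set} m {x : A} (z : List A) → replicate m x ++ x ∷ z ≡ x ∷ replicate m x ++ z
replicate-∷ʳ zero    z     = refl
replicate-∷ʳ (suc m) {x} z = cong (x ∷_) (replicate-∷ʳ m z)

reverse-replicate : ∀ {A : Set} m {x : A} → reverse (replicate m x) ≡ replicate m x
reverse-replicate zero    = refl
reverse-replicate (suc m) {x} = trans (unfold-reverse x (replicate m x))
  (trans (cong (_++ x ∷ []) (reverse-replicate m)) (trans (replicate-∷ʳ m []) (cong (x ∷_) (++-identityʳ _))))

unsnoc : ∀ {A : Set} (x : A) (xs : List A) → Σ (List A) λ ys → Σ A λ y → x ∷ xs ≡ ys ++ y ∷ []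
unsnoc x []       = [] , x , refl
unsnoc x (y ∷ xs) with unsnoc y xs
... | ys , z , e = x ∷ ys , z , cong (x ∷_) e

reverse-∷ʳ : ∀ {A : Set} (xs : List A) x → reverse (xs ++ x ∷ []) ≡ x ∷ reverse xs
reverse-∷ʳ xs x = reverse-++ xs (x ∷ [])

-- Rotations

rotate₁ : Str → Str
rotate₁ []      = []
rotate₁ (a ∷ x) = x ++ a ∷ []

rotate : ℕ → Str → Str
rotate zero    α = α
rotate (suc k) α = rotate k (rotate₁ α)

infix 4 _~_

_~_ : Str → Str → Set
α ~ β = Σ ℕ λ k → rotate k α ≡ β

rotate-+ : ∀ j k α → rotate (j + k) α ≡ rotate k (rotate j α)
rotate-+ zero    k α = refl
rotate-+ (suc j) k α = rotate-+ j k (rotate₁ α)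

rotate-[] : ∀ k → rotate k [] ≡ []
rotate-[] zero    = refl
rotate-[] (suc k) = rotate-[] k

rotate-++ : ∀ u v → rotate (length u) (u ++ v) ≡ v ++ u
rotate-++ []      v = sym (++-identityʳ v)
rotate-++ (a ∷ u) v = trans (cong (rotate (length u)) (++-assoc u v (a ∷ [])))
  (trans (rotate-++ u (v ++ a ∷ [])) (++-assoc v (a ∷ []) u))

~-swap : ∀ u v → u ++ v ~ v ++ u
~-swap u v = length u , rotate-++ u v

rotate-length : ∀ α → rotate (length α) α ≡ α
rotate-length α = trans (cong (rotate (length α)) (sym (++-identityʳ α))) (rotate-++ α [])

length-rotate₁ : ∀ α → length (rotate₁ α) ≡ length α
length-rotate₁ []      = refl
length-rotate₁ (a ∷ x) = trans (length-++ x) (+-comm (length x) 1)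

length-rotate : ∀ k α → length (rotate k α) ≡ length α
length-rotate zero    α = refl
length-rotate (suc k) α = trans (length-rotate k (rotate₁ α)) (length-rotate₁ α)

rotate-*length : ∀ k α → rotate (k * length α) α ≡ α
rotate-*length zero    α = refl
rotate-*length (suc k) α = trans (rotate-+ (length α) (k * length α) α)
  (trans (cong (rotate (k * length α)) (rotate-length α)) (rotate-*length k α))

~-refl : ∀ {α} → α ~ α
~-refl = 0 , refl

~-reflexive : ∀ {α β} → α ≡ β → α ~ β
~-reflexive refl = ~-refl

~-trans : ∀ {α β γ} → α ~ β → β ~ γ → α ~ γ
~-trans (j , refl) (k , refl) = j + k , rotate-+ j k _

~-length : ∀ {α β} → α ~ β → length α ≡ length β
~-length {α} (k , refl) = sym (length-rotate k α)

rotate-suc : ∀ k α → rotate (suc k) α ≡ rotate₁ (rotate k α)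
rotate-suc zero    α = refl
rotate-suc (suc k) α = rotate-suc k (rotate₁ α)

rotate-split : ∀ k α → Σ Str λ u → Σ Str λ v → α ≡ u ++ v × rotate k α ≡ v ++ u
rotate-split zero    α = [] , α , refl , sym (++-identityʳ α)
rotate-split (suc k) α with rotate-split k α
... | u , c ∷ v , e , f = u ++ c ∷ [] , v , trans e (sym (++-assoc u (c ∷ []) v)) ,
      trans (rotate-suc k α) (trans (cong rotate₁ f) (++-assoc v u (c ∷ [])))
... | [] , [] , e , f = [] , [] , e , trans (rotate-suc k α) (cong rotate₁ f)
-- The suffix is used up, so the rotation starts over with a single letter.
... | c ∷ u , [] , e , f = c ∷ [] , u , trans e (cong (c ∷_) (++-identityʳ u)) ,
      trans (rotate-suc k α) (cong rotate₁ f)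

~-split : ∀ {α β} → α ~ β → Σ Str λ u → Σ Str λ v → α ≡ u ++ v × β ≡ v ++ u
~-split {α} (k , refl) = rotate-split k α

~-sym : ∀ {α β} → α ~ β → β ~ α
~-sym p with ~-split p
... | u , v , refl , refl = ~-swap v u

~-reverse : ∀ {α β} → α ~ β → reverse α ~ reverse β
~-reverse p with ~-split p
... | u , v , refl , refl = subst₂ _~_ (sym (reverse-++ u v)) (sym (reverse-++ v u)) (~-swap (reverse v) (reverse u))

take-++ : ∀ {A : Set} (u : List A) v → take (length u) (u ++ v) ≡ u
take-++ []      v = refl
take-++ (a ∷ u) v = cong (a ∷_) (take-++ u v)

drop-++ : ∀ {A : Set} (u : List A) v → drop (length u) (u ++ v) ≡ v
drop-++ []      v = refl
drop-++ (a ∷ u) v = drop-++ u v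

∈-rotations⁻ : ∀ {α ρ} → ρ ∈ rotations α → α ~ ρ
∈-rotations⁻ {α} m with ∈-map⁻ (λ k → rot k α) m
... | k , _ , refl = subst (_~ rot k α) (take++drop≡id k α) (~-swap (take k α) (drop k α))

∈-rotations⁺ : ∀ {α ρ} → 0 < length α → α ~ ρ → ρ ∈ rotations α
∈-rotations⁺ {α} {ρ} pos p with ~-split p
... | u , [] , refl , refl = subst (_∈ rotations (u ++ []))
        (trans (++-identityʳ (u ++ [])) (++-identityʳ u)) (∈-map⁺ (λ k → rot k (u ++ [])) (∈-upTo⁺ pos))
... | u , c ∷ v , refl , refl = subst (_∈ rotations α′) (cong₂ _++_ (drop-++ u (c ∷ v)) (take-++ u (c ∷ v)))
        (∈-map⁺ (λ k → rot k α′) (∈-upTo⁺ (subst (length u <_) (sym (length-++ u)) (m<m+n (length u) (s≤s z≤n)))))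
  where α′ = u ++ c ∷ v

minS-∈ : ∀ d x xs → minS d (x ∷ xs) ∈ x ∷ xs
minS-∈ d x []       with leq x x
... | true  = here refl
... | false = here refl
minS-∈ d x (y ∷ ys) with leq x (minS x (y ∷ ys))
... | true  = here refl
... | false = there (minS-∈ x y ys)

minS-≤ : ∀ N d xs → (∀ {y} → y ∈ xs → length y ≡ N) → ∀ {y} → y ∈ xs → ¬ y ≺ minS d xs
minS-≤ N d (x ∷ []) f (here refl) q with leq x x
... | true  = ≺-irrefl q
... | false = ≺-irrefl q
minS-≤ N d (x ∷ z ∷ zs) f m q with leq x (minS x (z ∷ zs)) in eq
minS-≤ N d (x ∷ z ∷ zs) f (here refl) q | true  = ≺-irrefl q
minS-≤ N d (x ∷ z ∷ zs) f (there m)   q | true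
  with ⊀⇒≽ (minS x (z ∷ zs)) x (trans (f (there (minS-∈ x z zs))) (sym (f (here refl)))) (leq⇒⊁ eq)
... | inj₁ r = minS-≤ N x (z ∷ zs) (λ k → f (there k)) m (≺-trans q r)
... | inj₂ r = minS-≤ N x (z ∷ zs) (λ k → f (there k)) m (subst (_ ≺_) r q)
minS-≤ N d (x ∷ z ∷ zs) f (here refl) q | false =
  true≢false (≺⇒leq q) eq
minS-≤ N d (x ∷ z ∷ zs) f (there m)   q | false = minS-≤ N x (z ∷ zs) (λ k → f (there k)) m q

neck-~ : ∀ α → α ~ neck α
neck-~ []      = ~-refl
neck-~ α@(_ ∷ x) = ∈-rotations⁻ (minS-∈ α (rot 0 α) _)

neck-min : ∀ {α ρ} → α ~ ρ → ¬ ρ ≺ neck α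
neck-min {[]}    (k , refl) q rewrite rotate-[] k = ≺-irrefl q
neck-min {α@(_ ∷ _)} p q =
  minS-≤ (length α) α (rotations α) (λ m → sym (~-length (∈-rotations⁻ m))) (∈-rotations⁺ (s≤s z≤n) p) q

-- Necklaces and asymmetric bracelets

IsNecklace : Str → Set
IsNecklace γ = ∀ {ρ} → γ ~ ρ → ¬ ρ ≺ γ

neck-unique : ∀ {α γ} → α ~ γ → IsNecklace γ → neck α ≡ γ
neck-unique {α} {γ} p nk with ≺-cmp (neck α) γ (trans (sym (~-length (neck-~ α))) (~-length p))
... | inj₁ q        = ⊥-elim (nk (~-trans (~-sym p) (neck-~ α)) q)
... | inj₂ (inj₁ e) = e
... | inj₂ (inj₂ q) = ⊥-elim (neck-min p q)

neck-cong : ∀ {α β} → α ~ β → neck α ≡ neck β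
neck-cong {α} {β} p = neck-unique (~-trans p (neck-~ β)) (λ r → neck-min (~-trans (neck-~ β) r))

length-neck : ∀ α → length (neck α) ≡ length α
length-neck α = sym (~-length (neck-~ α))

-- The strict inequality combines bracelet minimality with asymmetry: equality with a rotation of
-- the reversal would be a symmetry.
record IsA (γ : Str) : Set where
  constructor isA
  field
    necklace : IsNecklace γ
    chiral   : ∀ {ρ} → reverse γ ~ ρ → γ ≺ ρ
open IsA public

inA⁻ : ∀ {n γ} → 0 < n → inA n γ ≡ true → length γ ≡ n × IsA γ
inA⁻ {n} {γ} pos e with ∧-true⁻ {length γ ≡ᵇ n} e
... | e₁ , e₂ with ≡ᵇ⇒≡ (length γ) n (subst T′ (sym e₁) _)
  where
  T′ : Bool → Set
  T′ = T
... | refl with ∧-true⁻ {isBracelet γ} e₂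
... | e₃ , e₄ with ∧-true⁻ {isNecklace γ} e₄
... | e₅ , e₆ = refl , isA nk ch
  where
  nk : IsNecklace γ
  nk p = leq⇒⊁ (all⁻ (leq γ) e₅ (∈-rotations⁺ pos p))
  pos′ : 0 < length (reverse γ)
  pos′ = subst (0 <_) (sym (length-reverse γ)) pos
  ch : ∀ {ρ} → reverse γ ~ ρ → γ ≺ ρ
  ch {ρ} p with ⊀⇒≽ ρ γ (trans (sym (~-length p)) (length-reverse γ))
                 (leq⇒⊁ (all⁻ (leq γ) e₃ (∈-++⁺ʳ (rotations γ) (∈-rotations⁺ pos′ p))))
  ... | inj₁ q = q
  ... | inj₂ refl = ⊥-elim (true≢false
          (any⁺ (eqS (reverse γ)) (∈-rotations⁺ pos (~-sym p)) (eqS-refl (reverse γ))) (not-true⁻ e₆))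

inA⁺ : ∀ {n γ} → length γ ≡ n → IsA γ → inA n γ ≡ true
inA⁺ {n} {γ} refl (isA nk ch) = ∧-true⁺ lenOK (∧-true⁺ br (∧-true⁺ nkᵇ asym))
  where
  lenOK : (length γ ≡ᵇ length γ) ≡ true
  lenOK with length γ ≡ᵇ length γ | ≡⇒≡ᵇ (length γ) (length γ) refl
  ... | true | _ = refl
  leq-rot : ∀ {ρ} → ρ ∈ rotations γ → leq γ ρ ≡ true
  leq-rot m = ⊁⇒leq γ _ (~-length (∈-rotations⁻ m)) (nk (∈-rotations⁻ m))
  nkᵇ : isNecklace γ ≡ true
  nkᵇ = all⁺ (leq γ) (rotations γ) leq-rot
  br-case : ∀ {ρ} → ρ ∈ rotations γ ++ rotations (reverse γ) → leq γ ρ ≡ true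
  br-case m with ∈-++⁻ (rotations γ) m
  ... | inj₁ k = leq-rot k
  ... | inj₂ k = ≺⇒leq (ch (∈-rotations⁻ k))
  br : isBracelet γ ≡ true
  br = all⁺ (leq γ) _ br-case
  asym : not (isSymmetric γ) ≡ true
  asym with isSymmetric γ in eq
  ... | false = refl
  ... | true  with any⁻ (eqS (reverse γ)) (rotations γ) eq
  ...   | ρ , m , q rewrite eqS⇒≡ (reverse γ) ρ q =
          ⊥-elim (≺-irrefl (ch (subst (_~ γ) refl (~-sym (∈-rotations⁻ m)))))

neck-IsA : ∀ {γ} → IsA γ → neck γ ≡ γ
neck-IsA a = neck-unique ~-refl (necklace a)

¬IsA-sym : ∀ {γ} → reverse γ ~ γ → ¬ IsA γ
¬IsA-sym p a = ≺-irrefl (chiral a p)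

-- Strings as periodic sequences

first : Str → Bool
first []      = false
first (a ∷ _) = a

-- Reading through `rotate` makes the index cyclic, so `bit α` is defined on all of ℕ with period
-- `length α`.
bit : Str → ℕ → Bool
bit α x = first (rotate x α)

bit-rotate : ∀ k α x → bit (rotate k α) x ≡ bit α (k + x)
bit-rotate k α x = cong first (sym (rotate-+ k x α))

bit-+period : ∀ α x k → bit α (x + k * length α) ≡ bit α x
bit-+period α x k = cong first (trans (cong (λ y → rotate y α) (+-comm x (k * length α)))
  (trans (rotate-+ (k * length α) x α) (cong (rotate x) (rotate-*length k α))))

applyUpTo-cong : ∀ {A : Set} {f h : ℕ → A} n → (∀ {x} → x < n → f x ≡ h x) → applyUpTo f n ≡ applyUpTo h n
applyUpTo-cong zero    e = refl
applyUpTo-cong (suc n) e = cong₂ _∷_ (e (s≤s z≤n)) (applyUpTo-cong n (λ p → e (s≤s p)))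

applyUpTo-++ : ∀ {A : Set} (f : ℕ → A) m n → applyUpTo f (m + n) ≡ applyUpTo f m ++ applyUpTo (λ x → f (m + x)) n
applyUpTo-++ f zero    n = refl
applyUpTo-++ f (suc m) n = cong (f 0 ∷_) (applyUpTo-++ (λ x → f (suc x)) m n)

applyDownFrom-applyUpTo : ∀ {A : Set} (f : ℕ → A) n → applyDownFrom f n ≡ applyUpTo (λ i → f (n ∸ suc i)) n
applyDownFrom-applyUpTo f zero    = refl
applyDownFrom-applyUpTo f (suc n) = cong (f n ∷_) (applyDownFrom-applyUpTo f n)

applyUpTo-injective : ∀ {A : Set} {f h : ℕ → A} n → applyUpTo f n ≡ applyUpTo h n → ∀ {x} → x < n → f x ≡ h x
applyUpTo-injective (suc n) e {zero}  _       = ∷-injectiveˡ e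
applyUpTo-injective (suc n) e {suc x} (s≤s p) = applyUpTo-injective n (∷-injectiveʳ e) p

applyUpTo-bit : ∀ x w k → k ≤ length x → applyUpTo (bit (x ++ w)) k ≡ take k x
applyUpTo-bit x       w zero    _       = refl
applyUpTo-bit (a ∷ x) w (suc k) (s≤s p) = cong (a ∷_)
  (trans (applyUpTo-cong k (λ {i} _ → cong (λ z → bit z i) (++-assoc x w (a ∷ []))))
    (applyUpTo-bit x (w ++ a ∷ []) k p))

take-bit : ∀ α k → k ≤ length α → take k α ≡ applyUpTo (bit α) k
take-bit α k p = trans (sym (applyUpTo-bit α [] k p)) (cong (λ z → applyUpTo (bit z) k) (++-identityʳ α))

take-length : ∀ {A : Set} (x : List A) → take (length x) x ≡ x
take-length []      = refl
take-length (a ∷ x) = cong (a ∷_) (take-length x)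

bits : ∀ α → α ≡ applyUpTo (bit α) (length α)
bits α = trans (sym (take-length α)) (take-bit α (length α) ≤-refl)

bit-ext : ∀ α β → length α ≡ length β → (∀ {x} → x < length α → bit α x ≡ bit β x) → α ≡ β
bit-ext α β e f = trans (bits α) (trans (applyUpTo-cong (length α) f)
  (trans (cong (applyUpTo (bit β)) e) (sym (bits β))))

bit-prefix : ∀ x w w′ {k} → k < length x → bit (x ++ w) k ≡ bit (x ++ w′) k
bit-prefix x w w′ p = applyUpTo-injective (length x)
  (trans (applyUpTo-bit x w _ ≤-refl) (sym (applyUpTo-bit x w′ _ ≤-refl))) p

bit-% : ∀ α m → length α ≡ suc m → ∀ x → bit α x ≡ bit α (x % suc m)
bit-% α m e x = trans (cong (bit α) (m≡m%n+[m/n]*n x (suc m)))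
  (trans (cong (λ l → bit α (x % suc m + x / suc m * l)) (sym e)) (bit-+period α (x % suc m) (x / suc m)))

-- −1 ≡ m modulo suc m: reflections are written without subtraction.
bit-reverse : ∀ α m → length α ≡ suc m → ∀ x → bit (reverse α) x ≡ bit α (m + m * x)
bit-reverse α m e x = begin
  bit (reverse α) x             ≡⟨ bit-% (reverse α) m (trans (length-reverse α) e) x ⟩
  bit (reverse α) r             ≡⟨ small (≤-pred (m%n<n x (suc m))) ⟩
  bit α (m ∸ r)                 ≡⟨ shift (m ∸ r) r ⟩
  bit α (m ∸ r + r * suc m)     ≡⟨ cong (bit α) (trans (ring₁ (m ∸ r) r m) (cong (_+ m * r) (m∸n+n≡m (≤-pred (m%n<n x (suc m)))))) ⟩
  bit α (m + m * r)             ≡⟨ shift (m + m * r) (m * (x / suc m)) ⟩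
  bit α (m + m * r + m * (x / suc m) * suc m) ≡⟨ cong (bit α) (ring₂ m r (x / suc m)) ⟩
  bit α (m + m * (r + x / suc m * suc m)) ≡⟨ cong (λ y → bit α (m + m * y)) (sym (m≡m%n+[m/n]*n x (suc m))) ⟩
  bit α (m + m * x) ∎
  where
  open ≡-Reasoning
  r = x % suc m
  ring₁ : ∀ d r m → d + r * suc m ≡ (d + r) + m * r
  ring₁ = solve-∀
  ring₂ : ∀ m r q → m + m * r + m * q * suc m ≡ m + m * (r + q * suc m)
  ring₂ = solve-∀
  shift : ∀ y k → bit α y ≡ bit α (y + k * suc m)
  shift y k = trans (sym (bit-+period α y k)) (cong (λ l → bit α (y + k * l)) e)
  rev-bits : applyUpTo (bit (reverse α)) (suc m) ≡ applyUpTo (λ i → bit α (m ∸ i)) (suc m)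
  rev-bits = begin
    applyUpTo (bit (reverse α)) (suc m) ≡⟨ cong (applyUpTo (bit (reverse α))) (sym (trans (length-reverse α) e)) ⟩
    applyUpTo (bit (reverse α)) (length (reverse α)) ≡⟨ sym (bits (reverse α)) ⟩
    reverse α ≡⟨ cong reverse (trans (bits α) (cong (applyUpTo (bit α)) e)) ⟩
    reverse (applyUpTo (bit α) (suc m)) ≡⟨ reverse-applyUpTo (bit α) (suc m) ⟩
    applyDownFrom (bit α) (suc m) ≡⟨ applyDownFrom-applyUpTo (bit α) (suc m) ⟩
    applyUpTo (λ i → bit α (m ∸ i)) (suc m) ∎
  small : ∀ {y} → y ≤ m → bit (reverse α) y ≡ bit α (m ∸ y)
  small p = applyUpTo-injective {f = bit (reverse α)} {h = λ i → bit α (m ∸ i)} (suc m) rev-bits (s≤s p)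

-- Modulo `suc m`, `s + m * x` is s - x. Reversal is the reflection x ↦ -1 - x; composed with x ↦ s
-- - x it becomes the translation by s + 1, which is the rotation given as witness.
reflection⇒reverse~ : ∀ α m → length α ≡ suc m → ∀ s → (∀ x → bit α x ≡ bit α (s + m * x)) → reverse α ~ α
reflection⇒reverse~ α m e s h = ~-sym (s + 1 , bit-ext _ _ (trans (length-rotate (s + 1) α) (sym (length-reverse α)))
  (λ {x} _ → trans (bit-rotate (s + 1) α x) (sym (begin
    bit (reverse α) x ≡⟨ bit-reverse α m e x ⟩
    bit α (m + m * x) ≡⟨ h (m + m * x) ⟩
    bit α (s + m * (m + m * x)) ≡⟨ shift (s + m * (m + m * x)) (1 + x) ⟩
    bit α (s + m * (m + m * x) + (1 + x) * suc m) ≡⟨ cong (bit α) (ring s m x) ⟩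
    bit α (s + 1 + x + m * (1 + x) * suc m) ≡⟨ sym (shift (s + 1 + x) (m * (1 + x))) ⟩
    bit α (s + 1 + x) ∎))))
  where
  open ≡-Reasoning
  ring : ∀ s m x → s + m * (m + m * x) + (1 + x) * suc m ≡ s + 1 + x + m * (1 + x) * suc m
  ring = solve-∀
  shift : ∀ y k → bit α y ≡ bit α (y + k * suc m)
  shift y k = trans (sym (bit-+period α y k)) (cong (λ l → bit α (y + k * l)) e)

-- Symmetry from moving a letter across a run

%-intro : ∀ m {x y} j k → x + j * suc m ≡ y + k * suc m → x % suc m ≡ y % suc m
%-intro m {x} {y} j k e = trans (sym ([m+kn]%n≡m%n x j (suc m))) (trans (cong (_% suc m) e) ([m+kn]%n≡m%n y k (suc m)))

%-elim : ∀ m {x y} → x % suc m ≡ y % suc m → Σ ℕ λ j → Σ ℕ λ k → x + j * suc m ≡ y + k * suc m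
%-elim m {x} {y} e = y / suc m , x / suc m , (begin
  x + y / suc m * suc m ≡⟨ cong (_+ y / suc m * suc m) (m≡m%n+[m/n]*n x (suc m)) ⟩
  x % suc m + x / suc m * suc m + y / suc m * suc m ≡⟨ cong (λ r → r + x / suc m * suc m + y / suc m * suc m) e ⟩
  y % suc m + x / suc m * suc m + y / suc m * suc m ≡⟨ ring (y % suc m) (x / suc m * suc m) (y / suc m * suc m) ⟩
  y % suc m + y / suc m * suc m + x / suc m * suc m ≡⟨ cong (_+ x / suc m * suc m) (sym (m≡m%n+[m/n]*n y (suc m))) ⟩
  y + x / suc m * suc m ∎)
  where
  open ≡-Reasoning
  ring : ∀ p q r → p + q + r ≡ p + r + q
  ring = solve-∀

-- F x and F (x + τ) differ only at x ≡ 0 and x ≡ a, and the reflection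
-- H x = F (a + τ − x) has the same property. So the set where F and H agree is
-- invariant under τ, hence under a, and it contains 1, …, a.
module Swap (m τ a′ : ℕ) (F : ℕ → Bool) (c : Bool)
  (periodic : ∀ x k → F (x + k * suc m) ≡ F x)
  (a<n  : suc a′ < suc m)
  (F0   : F 0 ≡ c)
  (Frun : ∀ y → 0 < y → y ≤ suc a′ → F y ≡ not c)
  (Fτ   : F τ ≡ not c)
  (Faτ  : F (suc a′ + τ) ≡ c)
  (inv  : ∀ x → x < suc m → x ≢ 0 → x ≢ suc a′ → F (x + τ) ≡ F x) where

  n a : ℕ
  n = suc m
  a = suc a′

  infix 4 _≈_
  _≈_ : ℕ → ℕ → Set
  x ≈ y = x % n ≡ y % n

  ≈-intro : ∀ {x y} j k → x + j * n ≡ y + k * n → x ≈ y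
  ≈-intro = %-intro m

  ≈-elim : ∀ {x y} → x ≈ y → Σ ℕ λ j → Σ ℕ λ k → x + j * n ≡ y + k * n
  ≈-elim = %-elim m

  F-cong : ∀ {x y} → x ≈ y → F x ≡ F y
  F-cong {x} {y} e with ≈-elim {x} {y} e
  ... | j , k , q = trans (sym (periodic x j)) (trans (cong F q) (periodic y k))

  +-cong≈ : ∀ {x y} z → x ≈ y → x + z ≈ y + z
  +-cong≈ {x} {y} z e with ≈-elim {x} {y} e
  ... | j , k , q = ≈-intro j k (trans (ring x z (j * n)) (trans (cong (_+ z) q) (sym (ring y z (k * n)))))
    where
    ring : ∀ x z p → x + z + p ≡ x + p + z
    ring = solve-∀

  *-cong≈ : ∀ {x y} z → x ≈ y → z * x ≈ z * y
  *-cong≈ {x} {y} z e with ≈-elim {x} {y} e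
  ... | j , k , q = ≈-intro (z * j) (z * k) (trans (ring z x j n) (trans (cong (z *_) q) (sym (ring z y k n))))
    where
    ring : ∀ z x j n → z * x + z * j * n ≡ z * (x + j * n)
    ring = solve-∀

  inv≈ : ∀ x → ¬ x ≈ 0 → ¬ x ≈ a → F (x + τ) ≡ F x
  inv≈ x x≉0 x≉a = trans (F-cong {x + τ} {x % n + τ} (+-cong≈ {x} {x % n} τ x≈r))
    (trans (inv (x % n) (m%n<n x n) (λ e → x≉0 e) (λ e → x≉a (trans e (sym (m<n⇒m%n≡m a<n)))))
      (F-cong {x % n} {x} (sym x≈r)))
    where
    x≈r : x ≈ x % n
    x≈r = sym (m<n⇒m%n≡m (m%n<n x n))

  H : ℕ → Bool
  H x = F (a + τ + m * x)

  Agree : ℕ → Set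
  Agree x = F x ≡ H x

  Fa : F a ≡ not c
  Fa = Frun a (s≤s z≤n) ≤-refl

  H-cong : ∀ {x y} → x ≈ y → H x ≡ H y
  H-cong {x} {y} e = F-cong {a + τ + m * x} {a + τ + m * y}
    (subst₂ _≈_ (+-comm (m * x) (a + τ)) (+-comm (m * y) (a + τ)) (+-cong≈ {m * x} {m * y} (a + τ) (*-cong≈ {x} {y} m e)))

  Agree-cong : ∀ {x y} → x ≈ y → Agree x → Agree y
  Agree-cong {x} {y} e p = trans (F-cong {y} {x} (sym e)) (trans p (H-cong {x} {y} e))

  H-shift : ∀ x → H (x + τ) ≡ F (a + m * x)
  H-shift x = trans (cong F (ring a τ m x)) (periodic (a + m * x) τ)
    where
    ring : ∀ a τ m x → a + τ + m * (x + τ) ≡ a + m * x + τ * suc m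
    ring = solve-∀

  -- The reflection x ↦ a - x exchanges 0 and a, the exceptional places of `inv`. With `u` for a -
  -- x, H (x + τ) is F u and H x is F (u + τ).
  H-step : ∀ x → ¬ x ≈ 0 → ¬ x ≈ a → H (x + τ) ≡ H x
  H-step x x≉0 x≉a = trans (H-shift x) (trans (sym (inv≈ u u≉0 u≉a)) (cong F (ring a τ (m * x))))
    where
    u = a + m * x
    ring : ∀ a τ p → a + p + τ ≡ a + τ + p
    ring = solve-∀
    ring₁ : ∀ a m x j → x + (a + m * x + j * suc m) ≡ a + (x + j) * suc m
    ring₁ = solve-∀
    x+u≈a : x + u ≈ a
    x+u≈a = ≈-intro 0 x (ring₃ x a m)
      where
      ring₃ : ∀ x a m → x + (a + m * x) + 0 * suc m ≡ a + x * suc m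
      ring₃ = solve-∀
    u≉0 : ¬ u ≈ 0
    u≉0 e = x≉a (trans (sym (trans (cong (_% n) (+-comm x u)) (+-cong≈ {u} {0} x e))) x+u≈a)
    u≉a : ¬ u ≈ a
    u≉a e with ≈-elim {u} {a} e
    ... | j , k , q = x≉0 (≈-intro k (x + j) (+-cancelˡ-≡ a _ _
          (trans (ring₄ a x (k * n)) (trans (cong (x +_) (sym q)) (trans (ring₁ a m x j) (cong (a +_) refl))))))
      where
      ring₄ : ∀ a x p → a + (x + p) ≡ x + (a + p)
      ring₄ = solve-∀

  -- The values of F at 0, a, τ and a + τ are prescribed, and the reflection defining H pairs 0 with
  -- a + τ and τ with a.
  both₀ : ∀ x → x ≈ 0 → Agree x × Agree (x + τ)
  both₀ x e = Agree-cong {0} {x} (sym e) (trans F0 (trans (sym Faτ) (cong F (ring a τ m)))) ,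
    Agree-cong {τ} {x + τ} (sym (+-cong≈ {x} {0} τ e)) (trans Fτ (trans (sym Fa) (trans (cong F (ring′ a m)) (sym (H-shift 0)))))
    where
    ring : ∀ a τ m → a + τ ≡ a + τ + m * 0
    ring = solve-∀
    ring′ : ∀ a m → a ≡ a + m * 0
    ring′ = solve-∀

  bothₐ : ∀ x → x ≈ a → Agree x × Agree (x + τ)
  bothₐ x e = Agree-cong {a} {x} (sym e) (trans Fa (trans (sym Fτ) (trans (sym (periodic τ a)) (cong F (ring a τ m))))) ,
    Agree-cong {a + τ} {x + τ} (sym (+-cong≈ {x} {a} τ e)) (trans Faτ (trans (sym F0) (trans (sym (periodic 0 a)) (trans (cong F (ring′ a m)) (sym (H-shift a))))))
    where
    ring : ∀ a τ m → τ + a * suc m ≡ a + τ + m * a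
    ring = solve-∀
    ring′ : ∀ a m → 0 + a * suc m ≡ a + m * a
    ring′ = solve-∀

  back-τ : ∀ x → Agree (x + τ) → Agree x
  back-τ x p with x % n ≟ 0 % n | x % n ≟ a % n
  ... | yes e | _     = proj₁ (both₀ x e)
  ... | no _  | yes e = proj₁ (bothₐ x e)
  ... | no e  | no e′ = trans (sym (inv≈ x e e′)) (trans p (H-step x e e′))

  back-kτ : ∀ k x → Agree (x + k * τ) → Agree x
  back-kτ zero    x p = subst Agree (+-identityʳ x) p
  back-kτ (suc k) x p = back-τ x (back-kτ k (x + τ) (subst Agree (sym (+-assoc x τ (k * τ))) p))

  -- The τ-walk from 0 enters the value not c at once and must come back to
  -- F (n τ) = c; the only place where it can change back is a.
  hit : Σ ℕ λ l → l * τ ≈ a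
  hit = go m 1 refl (trans (cong F (+-identityʳ τ)) Fτ)
    where
    go : ∀ fuel k → k + fuel ≡ n → F (k * τ) ≡ not c → Σ ℕ λ l → l * τ ≈ a
    go zero k e p = ⊥-elim (not-¬ refl (trans (sym F0) (trans (sym (periodic 0 τ)) (trans (cong F (trans (*-comm τ n) (cong (_* τ) (trans (sym e) (+-identityʳ k))))) p))))
    go (suc fuel) k e p with (k * τ) % n ≟ a % n
    ... | yes q = k , q
    ... | no q  = go fuel (suc k) (trans (sym (+-suc k fuel)) e)
          (trans (cong F (+-comm τ (k * τ))) (trans (inv≈ (k * τ) (λ z → not-¬ refl (trans (sym F0) (trans (F-cong {0} {k * τ} (sym z)) p))) q) p))

  back-a : ∀ x → Agree (x + a) → Agree x
  back-a x p with hit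
  ... | l , e = back-kτ l x (Agree-cong {x + a} {x + l * τ}
          (subst₂ _≈_ (+-comm a x) (+-comm (l * τ) x) (+-cong≈ {a} {l * τ} x (sym e))) p)

  -- For 0 < y < a the reflected place is a - y + τ, and a - y lies again inside the run, away from
  -- the exceptional places of `inv`.
  base : ∀ y → 0 < y → y ≤ a → Agree y
  base y 0<y y≤a with m≤n⇒∃[o]m+o≡n y≤a
  ... | zero  , e = subst Agree (trans (sym e) (+-identityʳ y)) (proj₁ (bothₐ a refl))
  ... | suc z , e = trans (Frun y 0<y y≤a) (sym (begin
        F (a + τ + m * y)       ≡⟨ cong (λ w → F (w + τ + m * y)) (sym e) ⟩
        F (y + suc z + τ + m * y) ≡⟨ cong F (ring y (suc z) τ m) ⟩
        F (suc z + τ + y * n)   ≡⟨ periodic (suc z + τ) y ⟩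
        F (suc z + τ)           ≡⟨ inv (suc z) (<-trans z<a a<n) (λ ()) (<⇒≢ z<a) ⟩
        F (suc z)               ≡⟨ Frun (suc z) (s≤s z≤n) (<⇒≤ z<a) ⟩
        not c ∎))
    where
    open ≡-Reasoning
    ring : ∀ y z τ m → y + z + τ + m * y ≡ z + τ + y * suc m
    ring = solve-∀
    z<a : suc z < a
    z<a = subst (suc z <_) e (+-monoˡ-< (suc z) 0<y)

  agree : ∀ x → Agree x
  -- x + x m is a multiple of n. Steps of length a climb from x towards it; the step that passes it
  -- lands on one of the residues 1, ..., a, where `base` applies.
  agree x = <-rec (λ d → ∀ x → x + d ≡ N * n → Agree x) go (x * m) x (sym (*-suc x m))
    where
    N = x
    go : ∀ d → (∀ {d′} → d′ < d → ∀ x → x + d′ ≡ N * n → Agree x) → ∀ x → x + d ≡ N * n → Agree x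
    go d rec x e with a ≤? d
    ... | yes a≤d with m≤n⇒∃[o]m+o≡n a≤d
    ...   | d′ , refl = back-a x (rec (s≤s (m≤n+m d′ a′)) (x + a) (trans (+-assoc x a d′) e))
    go d rec x e | no a≰d with m≤n⇒∃[o]m+o≡n (<⇒≤ (≰⇒> a≰d))
    ... | r , q = back-a x (Agree-cong {r} {x + a} (≈-intro N 0 (trans (cong (r +_) (sym e))
              (trans (ring r x d) (trans (cong (x +_) q) (sym (+-identityʳ (x + a))))) )) (base r r>0 (subst (r ≤_) q (m≤n+m r d))))
      where
      ring : ∀ r x d → r + (x + d) ≡ x + (d + r)
      ring = solve-∀
      r>0 : 0 < r
      r>0 = n≢0⇒n>0 (λ r≡0 → a≰d (≤-reflexive (trans (sym q) (trans (cong (d +_) r≡0) (+-identityʳ d)))))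

bit-++ : ∀ u v x → bit (u ++ v) (length u + x) ≡ bit (v ++ u) x
bit-++ u v x = trans (sym (bit-rotate (length u) (u ++ v) x)) (cong (λ z → bit z x) (rotate-++ u v))

bit-at : ∀ u c v → bit (u ++ c ∷ v) (length u) ≡ c
bit-at u c v = trans (cong (bit (u ++ c ∷ v)) (sym (+-identityʳ (length u)))) (bit-++ u (c ∷ v) 0)

bit-replicate : ∀ a b w {y} → y < a → bit (replicate a b ++ w) y ≡ b
bit-replicate (suc a) b w {zero}  _       = refl
bit-replicate (suc a) b w {suc y} (s≤s p) =
  trans (cong (λ z → bit z y) (++-assoc (replicate a b) w (b ∷ []))) (bit-replicate a b (w ++ b ∷ []) p)

-- The two strings differ only at positions 0 and a, which gives the hypotheses of `Swap` with the
-- rotation amount as τ. The letter `c` stays open because both colours occur: a 1 moved across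
-- zeros, and a 0 moved across ones.
swap-symmetric : ∀ c a′ Z → let b = replicate (suc a′) (not c) in
  c ∷ b ++ Z ~ b ++ c ∷ Z → reverse (c ∷ b ++ Z) ~ c ∷ b ++ Z
swap-symmetric c a′ Z (τ , eq) = reflection⇒reverse~ α m len (suc a′ + τ) agree
  where
  a = suc a′
  b = replicate a (not c)
  α = c ∷ b ++ Z
  β = b ++ c ∷ Z
  m = a + length Z
  len : length α ≡ suc m
  len = cong suc (trans (length-++ b) (cong (_+ length Z) (length-replicate a)))
  F : ℕ → Bool
  F = bit α
  Fβ : ∀ x → F (x + τ) ≡ bit β x
  Fβ x = trans (cong F (+-comm x τ)) (trans (sym (bit-rotate τ α x)) (cong (λ z → bit z x) eq))
  Frun : ∀ y → 0 < y → y ≤ a → F y ≡ not c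
  Frun (suc y) _ p = trans (cong (λ z → bit z y) (++-assoc b Z (c ∷ []))) (bit-replicate a (not c) (Z ++ c ∷ []) p)
  inv : ∀ x → x < suc m → x ≢ 0 → x ≢ a → F (x + τ) ≡ F x
  inv x x<n x≢0 x≢a with x ≤? a
  ... | yes x≤a = trans (Fβ x) (trans (bit-replicate a (not c) (c ∷ Z) (≤∧≢⇒< x≤a x≢a)) (sym (Frun x (n≢0⇒n>0 x≢0) x≤a)))
  ... | no x≰a with m≤n⇒∃[o]m+o≡n (≰⇒> x≰a)
  ...   | z , refl = trans (Fβ x) (trans β-side (sym α-side))
    where
    z<Z : z < length Z
    z<Z = +-cancelˡ-< (suc a) z (length Z) x<n
    u u′ : Str
    u  = c ∷ b
    u′ = b ++ c ∷ []
    lu : length u ≡ suc a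
    lu = cong suc (length-replicate a)
    lu′ : length u′ ≡ suc a
    lu′ = trans (length-++ b) (trans (+-comm (length b) 1) lu)
    α-side : bit α (suc a + z) ≡ bit (Z ++ u) z
    α-side = trans (cong (λ l → bit α (l + z)) (sym lu)) (bit-++ u Z z)
    β-side : bit β (suc a + z) ≡ bit (Z ++ u) z
    β-side = trans (cong₂ (λ l y → bit y (l + z)) (sym lu′) (sym (++-assoc b (c ∷ []) Z)))
      (trans (bit-++ u′ Z z) (bit-prefix Z u′ u z<Z))
  periodic : ∀ x k → F (x + k * suc m) ≡ F x
  periodic x k = trans (cong (λ l → F (x + k * l)) (sym len)) (bit-+period α x k)
  Faτ : F (a + τ) ≡ c
  Faτ = trans (Fβ a) (trans (cong (bit β) (sym (length-replicate a))) (bit-at b c Z))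
  open Swap m τ a′ F c periodic (s≤s (m≤m+n a (length Z))) refl Frun (Fβ 0) Faτ inv using (agree)

-- Splitting off runs

zeros ones : ℕ → Str
zeros k = replicate k false
ones k  = replicate k true

span : ∀ b (x : Str) → (Σ ℕ λ i → x ≡ replicate i b) ⊎ (Σ ℕ λ i → Σ Str λ r → x ≡ replicate i b ++ not b ∷ r)
span b []      = inj₁ (0 , refl)
span false (true ∷ x) = inj₂ (0 , x , refl)
span true (false ∷ x) = inj₂ (0 , x , refl)
span false (false ∷ x) with span false x
... | inj₁ (i , e)     = inj₁ (suc i , cong (false ∷_) e)
... | inj₂ (i , r , e) = inj₂ (suc i , r , cong (false ∷_) e)
span true (true ∷ x) with span true x
... | inj₁ (i , e)     = inj₁ (suc i , cong (true ∷_) e)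
... | inj₂ (i , r , e) = inj₂ (suc i , r , cong (true ∷_) e)

reverse-++-∷-replicate : ∀ (u : Str) b i c → reverse (u ++ b ∷ replicate i c) ≡ replicate i c ++ b ∷ reverse u
reverse-++-∷-replicate u b i c = begin
  reverse (u ++ b ∷ replicate i c)              ≡⟨ reverse-++ u (b ∷ replicate i c) ⟩
  reverse (b ∷ replicate i c) ++ reverse u      ≡⟨ cong (_++ reverse u) (unfold-reverse b (replicate i c)) ⟩
  (reverse (replicate i c) ++ b ∷ []) ++ reverse u ≡⟨ cong (λ z → (z ++ b ∷ []) ++ reverse u) (reverse-replicate i) ⟩
  (replicate i c ++ b ∷ []) ++ reverse u        ≡⟨ ++-assoc (replicate i c) (b ∷ []) (reverse u) ⟩
  replicate i c ++ b ∷ reverse u ∎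
  where open ≡-Reasoning

reverse-replicate-++-∷ : ∀ i c b (r : Str) → reverse (replicate i c ++ b ∷ r) ≡ reverse r ++ b ∷ replicate i c
reverse-replicate-++-∷ i c b r = begin
  reverse (replicate i c ++ b ∷ r)               ≡⟨ cong (λ z → reverse (replicate i c ++ b ∷ z)) (sym (reverse-involutive r)) ⟩
  reverse (replicate i c ++ b ∷ reverse (reverse r)) ≡⟨ cong reverse (sym (reverse-++-∷-replicate (reverse r) b i c)) ⟩
  reverse (reverse (reverse r ++ b ∷ replicate i c)) ≡⟨ reverse-involutive _ ⟩
  reverse r ++ b ∷ replicate i c ∎
  where open ≡-Reasoning

spanʳ : ∀ b (x : Str) → (Σ ℕ λ i → x ≡ replicate i b) ⊎ (Σ ℕ λ i → Σ Str λ r → x ≡ r ++ not b ∷ replicate i b)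
spanʳ b x with span b (reverse x)
... | inj₁ (i , e) = inj₁ (i , trans (sym (reverse-involutive x)) (trans (cong reverse e) (reverse-replicate i)))
... | inj₂ (i , r , e) = inj₂ (i , reverse r ,
        trans (sym (reverse-involutive x)) (trans (cong reverse e) (reverse-replicate-++-∷ i b (not b) r)))

replicate-split : ∀ {A : Set} M (b : A) u v → replicate M b ≡ u ++ v →
  u ≡ replicate (length u) b × v ≡ replicate (length v) b × M ≡ length u + length v
replicate-split M       b []      v e = refl , trans (sym e) (cong (λ k → replicate k b) M≡) , M≡
  where
  M≡ : M ≡ length v
  M≡ = trans (sym (length-replicate M)) (cong length e)
replicate-split (suc M) b (x ∷ u) v e with ∷-injectiveˡ e | replicate-split M b u v (∷-injectiveʳ e)
... | refl | p , q , r = cong (b ∷_) p , q , cong suc r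

-- Unique longest runs of zeros

-- The condition under which the prefix of `zeros M ++ y` is the only cyclic run of M or more zeros.
record Block (M : ℕ) (y : Str) : Set where
  field
    start   : Σ Str λ y₁ → y ≡ true ∷ y₁
    end     : Σ Str λ y₂ → y ≡ y₂ ++ true ∷ []
    noZeros : ∀ u v → y ≢ u ++ zeros M ++ v
open Block public

suffix-last : ∀ {A : Set} {y₂ : List A} {b} e c v → y₂ ++ b ∷ [] ≡ e ++ c ∷ v → Σ (List A) λ v₂ → c ∷ v ≡ v₂ ++ b ∷ []
suffix-last {y₂ = y₂} {b} e c v p with unsnoc c v
... | v₂ , z , q with ++-length-splitʳ y₂ (e ++ v₂) {z ∷ []} refl (trans p (trans (cong (e ++_) q) (sym (++-assoc e v₂ (z ∷ [])))))
...   | _ , refl = v₂ , q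

zeros-not-end : ∀ M (v v₂ w : Str) → v ≡ v₂ ++ true ∷ [] → zeros M ≢ v ++ w
zeros-not-end M v v₂ w refl e with replicate-split M false (v₂ ++ true ∷ []) w e
... | p , _ with replicate-split (length (v₂ ++ true ∷ [])) false v₂ (true ∷ []) (sym p)
...   | _ , () , _

-- If the cut lies inside y, then v ends in 1 and the zeros leading v u form a factor of y. If it
-- lies strictly inside the zeros, too few of them stand before the first 1 of y.
unique-run : ∀ {M y} → Block M y → ∀ u v r → zeros M ++ y ≡ u ++ v → v ++ u ≡ zeros M ++ r → u ≡ [] ⊎ v ≡ []
unique-run {M} {y} B u v r e f with ++-split (zeros M) u e
... | inj₁ (e₁ , refl , q) with v
...   | []     = inj₂ refl
...   | c ∷ v₁ with suffix-last e₁ c v₁ (trans (sym (proj₂ (end B))) q)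
...     | v₂ , s with ++-split (c ∷ v₁) (zeros M) f
...       | inj₁ (w , g , _)     = ⊥-elim (zeros-not-end M (c ∷ v₁) v₂ w s g)
...       | inj₂ (d , w , g , _) = ⊥-elim (noZeros B e₁ (d ∷ w) (trans q (cong (e₁ ++_) g)))
unique-run {M} {y} B u v r e f | inj₂ (x , e₁ , p , q) with replicate-split M false u (x ∷ e₁) p
... | pu , pe , pM with u
...   | []     = inj₁ refl
...   | a ∷ u₁ = ⊥-elim (contra (proj₂ (start B)))
  where
  U = a ∷ u₁
  eq : zeros (suc (length e₁)) ++ (y ++ U) ≡ zeros (suc (length e₁)) ++ zeros (length U) ++ r
  eq = begin
    zeros (suc (length e₁)) ++ (y ++ U) ≡⟨ cong (_++ (y ++ U)) (sym pe) ⟩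
    (x ∷ e₁) ++ (y ++ U) ≡⟨ sym (++-assoc (x ∷ e₁) y U) ⟩
    ((x ∷ e₁) ++ y) ++ U ≡⟨ cong (_++ U) (sym q) ⟩
    v ++ U ≡⟨ f ⟩
    zeros M ++ r ≡⟨ cong (λ k → zeros k ++ r) (trans pM (+-comm (length U) (suc (length e₁)))) ⟩
    zeros (suc (length e₁) + length U) ++ r ≡⟨ cong (_++ r) (replicate-++ (suc (length e₁)) (length U)) ⟩
    (zeros (suc (length e₁)) ++ zeros (length U)) ++ r ≡⟨ ++-assoc (zeros (suc (length e₁))) _ r ⟩
    zeros (suc (length e₁)) ++ zeros (length U) ++ r ∎
    where open ≡-Reasoning
  contra : ∀ {y₁} → y ≡ true ∷ y₁ → ⊥
  contra refl with ++-cancelˡ (zeros (suc (length e₁))) _ _ eq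
  ... | ()

-- A smaller string can deviate only behind the zeros. So any rotation competing with a block string
-- starts with 0ᴹ, and `Block-rotation` identifies it.
≺-zeros : ∀ M {ρ y} → ρ ≺ zeros M ++ y → Σ Str λ r → ρ ≡ zeros M ++ r × r ≺ y
≺-zeros zero    p         = _ , refl , p
≺-zeros (suc M) (later p) with ≺-zeros M p
... | r , e , q = r , cong (false ∷_) e , q

Block-reverse : ∀ {M y} → Block M y → Block M (reverse y)
Block-reverse {M} {y} B = record
  { start   = _ , trans (cong reverse (proj₂ (end B))) (reverse-∷ʳ (proj₁ (end B)) true)
  ; end     = _ , trans (cong reverse (proj₂ (start B))) (unfold-reverse true (proj₁ (start B)))
  ; noZeros = λ u v e → noZeros B (reverse v) (reverse u) (trans (sym (reverse-involutive y)) (trans (cong reverse e) (rev u v))) }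
  where
  rev : ∀ u v → reverse (u ++ zeros M ++ v) ≡ reverse v ++ zeros M ++ reverse u
  rev u v = trans (reverse-++ u (zeros M ++ v)) (trans (cong (_++ reverse u) (trans (reverse-++ (zeros M) v)
    (cong (reverse v ++_) (reverse-replicate M)))) (++-assoc (reverse v) (zeros M) (reverse u)))

Primitive : Str → Set
Primitive α = ∀ u v → α ≡ u ++ v → v ++ u ≡ α → u ≡ [] ⊎ v ≡ []

Block-primitive : ∀ {M y} → Block M y → Primitive (zeros M ++ y)
Block-primitive B u v e f = unique-run B u v _ e f

Block-rotation : ∀ {M y ρ r} → Block M y → zeros M ++ y ~ ρ → ρ ≡ zeros M ++ r → ρ ≡ zeros M ++ y
Block-rotation {M} {y} {r = r} B p e with ~-split p
... | u , v , q , s with unique-run B u v r q (trans (sym s) e)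
...   | inj₁ refl = trans s (trans (++-identityʳ v) (sym q))
...   | inj₂ refl = trans s (sym (trans q (++-identityʳ u)))

reverse-zeros-++ : ∀ M y → reverse (zeros M ++ y) ~ zeros M ++ reverse y
reverse-zeros-++ M y = subst (_~ zeros M ++ reverse y)
  (sym (trans (reverse-++ (zeros M) y) (cong (reverse y ++_) (reverse-replicate M)))) (~-swap (reverse y) (zeros M))

Block-necklace : ∀ {M y} → Block M y → IsNecklace (zeros M ++ y)
Block-necklace {M} {y} B p q with ≺-zeros M q
... | r , e , _ = ≺-irrefl (subst (_≺ zeros M ++ y) (Block-rotation B p e) q)

-- A rotation of the reversal that is not larger starts with 0ᴹ, and the only such rotation is 0ᴹ
-- followed by the reversed core.
Block-IsA⁺ : ∀ {M y} → Block M y → y ≺ reverse y → IsA (zeros M ++ y)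
Block-IsA⁺ {M} {y} B y≺ = isA (Block-necklace B) ch
  where
  ch : ∀ {ρ} → reverse (zeros M ++ y) ~ ρ → zeros M ++ y ≺ ρ
  ch {ρ} p with ≺-cmp (zeros M ++ y) ρ (trans (sym (length-reverse (zeros M ++ y))) (~-length p))
  ... | inj₁ q = q
  ... | inj₂ (inj₁ e) = ⊥-elim (≺-irrefl (subst (y ≺_) (++-cancelˡ (zeros M) _ _
          (trans (sym (Block-rotation (Block-reverse B) (~-trans (~-sym (reverse-zeros-++ M y)) p) (sym e))) (sym e))) y≺))
  ... | inj₂ (inj₂ q) with ≺-zeros M q
  ...   | r , e , r≺y = ⊥-elim (≺-asym y≺ (subst (_≺ y) (++-cancelˡ (zeros M) _ _
          (trans (sym e) (Block-rotation (Block-reverse B) (~-trans (~-sym (reverse-zeros-++ M y)) p) e))) r≺y))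

IsA⇒≺reverse : ∀ M y → IsA (zeros M ++ y) → y ≺ reverse y
IsA⇒≺reverse M y a = ≺-cancel (zeros M) (chiral a (reverse-zeros-++ M y))

firstOne-zeros : ∀ i r → firstOne (zeros i ++ true ∷ r) ≡ zeros i ++ false ∷ r
firstOne-zeros zero    r = refl
firstOne-zeros (suc i) r = cong (false ∷_) (firstOne-zeros i r)

firstZero-ones : ∀ i r → firstZero (ones i ++ false ∷ r) ≡ ones i ++ true ∷ r
firstZero-ones zero    r = refl
firstZero-ones (suc i) r = cong (true ∷_) (firstZero-ones i r)

lastZero-ones : ∀ y t → lastZero (y ++ false ∷ ones t) ≡ y ++ true ∷ ones t
lastZero-ones y t = begin
  reverse (firstZero (reverse (y ++ false ∷ ones t))) ≡⟨ cong (λ z → reverse (firstZero z)) (reverse-++-∷-replicate y false t true) ⟩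
  reverse (firstZero (ones t ++ false ∷ reverse y)) ≡⟨ cong reverse (firstZero-ones t (reverse y)) ⟩
  reverse (ones t ++ true ∷ reverse y) ≡⟨ reverse-replicate-++-∷ t true true (reverse y) ⟩
  reverse (reverse y) ++ true ∷ ones t ≡⟨ cong (_++ true ∷ ones t) (reverse-involutive y) ⟩
  y ++ true ∷ ones t ∎
  where open ≡-Reasoning

lastOne-snoc : ∀ z b → lastOne (z ++ b ∷ []) ≡ neck (z ++ false ∷ [])
lastOne-snoc z b = cong (λ w → neck (w ++ false ∷ []))
  (trans (cong (λ w → reverse (drop 1 w)) (reverse-∷ʳ z b)) (reverse-involutive z))

-- The shape of a string in A(n)

NoRun : ℕ → Str → Set
NoRun i γ = ∀ {ρ} r → γ ~ ρ → ρ ≢ zeros (suc i) ++ r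

-- Two readings of γ, around its first and around its last 1. Deleting that 1 merges the `suc i`
-- initial zeros with `j` or `k` others into a run of `suc i + suc j` or `suc i + suc k` zeros, and
-- the core `y` or `z` that remains is a `Block` for this length.
record Shape (γ : Str) : Set where
  field
    i j k : ℕ
    y z   : Str
    eqʸ   : γ ≡ zeros (suc i) ++ true ∷ zeros j ++ y
    eqᶻ   : γ ≡ zeros (suc i) ++ z ++ zeros k ++ true ∷ []
    noRun : NoRun (suc i) γ
    blockʸ : Block (suc i + suc j) y
    blockᶻ : Block (suc i + suc k) z

noRun-factor : ∀ {i γ} → NoRun i γ → ∀ u v → γ ≢ u ++ zeros (suc i) ++ v
noRun-factor {i} nr u v refl = nr (v ++ u) (~-swap u (zeros (suc i) ++ v)) (++-assoc (zeros (suc i)) v u)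

necklace-noRun : ∀ i r → IsNecklace (zeros i ++ true ∷ r) → NoRun i (zeros i ++ true ∷ r)
necklace-noRun i r nk s p refl = nk p (subst (_≺ zeros i ++ true ∷ r) (replicate-∷ʳ i s) (≺-prepend (zeros i) now))

noRun-Block : ∀ {i γ} j y₁ y₂ y → NoRun i γ → (Σ Str λ u → Σ Str λ v → γ ≡ u ++ y ++ v) →
  y ≡ true ∷ y₁ → y ≡ y₂ ++ true ∷ [] → Block (i + suc j) y
noRun-Block {i} j y₁ y₂ y nr (u , v , e) s₁ s₂ = record
  { start = y₁ , s₁ ; end = y₂ , s₂
  ; noZeros = λ a b f → noRun-factor nr (u ++ a) (zeros j ++ b ++ v) (trans e (trans (cong (λ w → u ++ w ++ v) f) (eq a b))) }
  where
  eq : ∀ a b → u ++ (a ++ zeros (i + suc j) ++ b) ++ v ≡ (u ++ a) ++ zeros (suc i) ++ zeros j ++ b ++ v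
  eq a b = begin
    u ++ (a ++ zeros (i + suc j) ++ b) ++ v ≡⟨ cong (u ++_) (++-assoc a _ v) ⟩
    u ++ a ++ (zeros (i + suc j) ++ b) ++ v ≡⟨ sym (++-assoc u a _) ⟩
    (u ++ a) ++ (zeros (i + suc j) ++ b) ++ v ≡⟨ cong (λ m → (u ++ a) ++ (zeros m ++ b) ++ v) (+-suc i j) ⟩
    (u ++ a) ++ (zeros (suc i + j) ++ b) ++ v ≡⟨ cong (λ w → (u ++ a) ++ (w ++ b) ++ v) (replicate-++ (suc i) j) ⟩
    (u ++ a) ++ ((zeros (suc i) ++ zeros j) ++ b) ++ v ≡⟨ cong ((u ++ a) ++_) (trans (cong (_++ v) (++-assoc (zeros (suc i)) (zeros j) b))
                                                            (trans (++-assoc (zeros (suc i)) (zeros j ++ b) v) (cong (zeros (suc i) ++_) (++-assoc (zeros j) b v)))) ⟩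
    (u ++ a) ++ zeros (suc i) ++ zeros j ++ b ++ v ∎
    where open ≡-Reasoning

¬IsA-replicate : ∀ n b → ¬ IsA (replicate n b)
¬IsA-replicate n b = ¬IsA-sym (~-reflexive (reverse-replicate n))

prefix-first : ∀ {s w b} z → b ∷ s ≡ z ++ b ∷ w → Σ Str λ z₁ → z ++ b ∷ [] ≡ b ∷ z₁
prefix-first []      e = [] , refl
prefix-first {b = b} (d ∷ z) e with ∷-injectiveˡ e
... | refl = z ++ b ∷ [] , refl

-- The strings 0ⁿ, 0ⁱ1 and 1ⁿ are symmetric. A final 0, or a leading 1 with a 0 further on, admits a
-- rotation with more initial zeros.
shape : ∀ {γ} → IsA γ → Shape γ
shape {γ} a with span false γ
... | inj₁ (n , refl) = ⊥-elim (¬IsA-replicate n false a)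
... | inj₂ (i₀ , [] , refl) = ⊥-elim (¬IsA-sym (subst (_~ zeros i₀ ++ true ∷ [])
        (sym (reverse-++ (zeros i₀) (true ∷ []))) (~-trans (~-reflexive (cong (true ∷_) (reverse-replicate i₀))) (~-swap (true ∷ []) (zeros i₀)))) a)
... | inj₂ (i₀ , c ∷ s , refl) with unsnoc c s
...   | s′ , false , e = ⊥-elim (necklace-noRun i₀ (c ∷ s) (necklace a) (true ∷ s′)
          (subst (_~ false ∷ zeros i₀ ++ true ∷ s′) (trans (++-assoc (zeros i₀) (true ∷ s′) (false ∷ [])) (cong (λ w → zeros i₀ ++ true ∷ w) (sym e)))
            (~-swap (zeros i₀ ++ true ∷ s′) (false ∷ []))) refl)
...   | s′ , true , e with i₀
...     | zero with span true (true ∷ c ∷ s)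
...       | inj₁ (n , e′) = ⊥-elim (¬IsA-replicate n true (subst IsA e′ a))
...       | inj₂ (m , r , e′) = ⊥-elim (necklace-noRun 0 (c ∷ s) (necklace a) (r ++ ones m)
              (subst (_~ false ∷ r ++ ones m) (sym e′) (~-swap (ones m) (false ∷ r))) refl)
shape {γ} a | inj₂ (i₀ , c ∷ s , refl) | s′ , true , e | suc i with span false (s′ ++ true ∷ []) | spanʳ false (true ∷ s′)
... | inj₁ (m , f) | _ = ⊥-elim (zeros-not-end m (s′ ++ true ∷ []) s′ [] refl (trans (sym f) (sym (++-identityʳ _))))
... | inj₂ _ | inj₁ (zero , ())
... | inj₂ _ | inj₁ (suc m , ())
... | inj₂ (j , y₁ , f) | inj₂ (k , z₂ , h) = record
  { i = i ; j = j ; k = k ; y = true ∷ y₁ ; z = z₂ ++ true ∷ []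
  ; eqʸ = eqʸ ; eqᶻ = eqᶻ ; noRun = nr
  ; blockʸ = noRun-Block j y₁ (proj₁ yend) (true ∷ y₁) nr
      (zeros (suc i) ++ true ∷ zeros j , [] , trans eqʸ (trans (sym (++-assoc (zeros (suc i)) (true ∷ zeros j) (true ∷ y₁)))
        (cong ((zeros (suc i) ++ true ∷ zeros j) ++_) (sym (++-identityʳ _))))) refl (proj₂ yend)
  ; blockᶻ = noRun-Block k (proj₁ zstart) z₂ (z₂ ++ true ∷ []) nr
      (zeros (suc i) , zeros k ++ true ∷ [] , eqᶻ) (proj₂ zstart) refl }
  where
  nr : NoRun (suc i) (zeros (suc i) ++ true ∷ c ∷ s)
  nr = necklace-noRun (suc i) (c ∷ s) (necklace a)
  eqʸ : zeros (suc i) ++ true ∷ c ∷ s ≡ zeros (suc i) ++ true ∷ zeros j ++ true ∷ y₁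
  eqʸ = cong (λ w → zeros (suc i) ++ true ∷ w) (trans e f)
  eqᶻ : zeros (suc i) ++ true ∷ c ∷ s ≡ zeros (suc i) ++ (z₂ ++ true ∷ []) ++ zeros k ++ true ∷ []
  eqᶻ = cong (zeros (suc i) ++_) (trans (cong (true ∷_) e) (trans (cong (_++ true ∷ []) h)
          (trans (++-assoc z₂ (true ∷ zeros k) (true ∷ [])) (sym (++-assoc z₂ (true ∷ []) (zeros k ++ true ∷ []))))))
  yend : Σ Str λ y₂ → true ∷ y₁ ≡ y₂ ++ true ∷ []
  yend = suffix-last (zeros j) true y₁ f
  zstart : Σ Str λ z₁ → z₂ ++ true ∷ [] ≡ true ∷ z₁
  zstart = prefix-first z₂ h

-- Uniqueness of the flipped position

~-∷-split : ∀ {b x B} → b ∷ x ~ B → Σ Str λ u → Σ Str λ v → B ≡ u ++ b ∷ v × x ≡ v ++ u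
~-∷-split p with ~-split (~-sym p)
... | u , []    , refl , e = [] , _ , trans (++-identityʳ u) (sym e) , sym (++-identityʳ _)
... | u , c ∷ v , refl , e with ∷-injectiveˡ e
...   | refl = u , v , refl , ∷-injectiveʳ e

~-∷-++ : ∀ b u v → b ∷ v ++ u ~ u ++ b ∷ v
~-∷-++ b u v = ~-swap (b ∷ v) u

-- Write 0ᴹ y = u 0 v with x = v u, so that u 1 v is a rotation of γ. The restored 1 must lie within
-- 0ᴹ, since otherwise a run of M zeros, longer than any in γ, would survive.
unique-one : ∀ i j y x → let γ = zeros (suc i) ++ true ∷ zeros j ++ y in
  Block (suc i + suc j) y → NoRun (suc i) γ → ¬ reverse γ ~ γ →
  true ∷ x ~ γ → false ∷ x ~ zeros (suc i + suc j) ++ y → x ≡ zeros j ++ y ++ zeros (suc i)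
unique-one i j y x B nr asym px qx with ~-∷-split qx
... | u , v , e , refl = go (++-split u (zeros M) (sym e))
  where
  γ = zeros (suc i) ++ true ∷ zeros j ++ y
  M = suc i + suc j
  γ~ρ : γ ~ u ++ true ∷ v
  γ~ρ = ~-trans (~-sym px) (~-∷-++ true u v)
  long : ∀ q r w → q ≡ suc (suc i) + r → u ++ true ∷ v ≡ zeros q ++ w → ⊥
  long q r w refl f = nr (zeros r ++ w) γ~ρ (trans f (trans (cong (_++ w) (replicate-++ (suc (suc i)) r)) (++-assoc (zeros (suc (suc i))) (zeros r) w)))
  M≡ : M ≡ suc (suc i) + j
  M≡ = cong suc (+-suc i j)
  run : ∀ q l → M ≡ q + suc l → u ≡ zeros q → v ≡ zeros l ++ y → v ++ u ≡ zeros j ++ y ++ zeros (suc i)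
  -- q zeros stand before the restored 1. More than i + 1 are too long a run, and exactly i + 1 is
  -- the claimed position. With fewer, u 1 v is γ with its first 1 moved across `suc a` zeros, and
  -- `swap-symmetric` applies.
  run q l Mq refl refl with <-cmp q (suc i)
  ... | tri> _ _ q> with m≤n⇒∃[o]m+o≡n q>
  ...   | r , f = ⊥-elim (long q r _ (sym f) refl)
  run q l Mq refl refl | tri≈ _ refl _ with suc-injective (+-cancelˡ-≡ (suc i) _ _ Mq)
  ... | refl = ++-assoc (zeros j) y (zeros (suc i))
  run q l Mq refl refl | tri< q< _ _ with m≤n⇒∃[o]m+o≡n q<
  ... | a , f = ⊥-elim (asym (~-trans (~-reverse (~-sym to-γ)) (~-trans symm to-γ)))
    where
    l≡ : l ≡ suc a + j
    l≡ = suc-injective (+-cancelˡ-≡ q _ _ (trans (sym Mq) (trans (cong (_+ suc j) (sym f)) (ring q a j))))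
      where
      ring : ∀ q a j → suc q + a + suc j ≡ q + suc (suc a + j)
      ring = solve-∀
    Z = (zeros j ++ y) ++ zeros q
    γ≡ : γ ≡ zeros q ++ zeros (suc a) ++ true ∷ zeros j ++ y
    γ≡ = trans (cong (λ k → zeros k ++ true ∷ zeros j ++ y) (trans (sym f) (sym (+-suc q a))))
      (trans (cong (_++ (true ∷ zeros j ++ y)) (replicate-++ q (suc a))) (++-assoc (zeros q) (zeros (suc a)) _))
    ρ≡ : zeros q ++ true ∷ zeros l ++ y ≡ zeros q ++ true ∷ zeros (suc a) ++ zeros j ++ y
    ρ≡ = cong (λ w → zeros q ++ true ∷ w) (trans (cong (λ k → zeros k ++ y) l≡)
      (trans (cong (_++ y) (replicate-++ (suc a) j)) (++-assoc (zeros (suc a)) (zeros j) y)))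
    α~ρ : true ∷ zeros (suc a) ++ Z ~ zeros q ++ true ∷ zeros (suc a) ++ zeros j ++ y
    α~ρ = subst (_~ zeros q ++ true ∷ zeros (suc a) ++ zeros j ++ y) (cong (true ∷_) (++-assoc (zeros (suc a)) (zeros j ++ y) (zeros q)))
      (~-swap (true ∷ zeros (suc a) ++ zeros j ++ y) (zeros q))
    β~γ : zeros (suc a) ++ true ∷ Z ~ zeros q ++ zeros (suc a) ++ true ∷ zeros j ++ y
    β~γ = subst (_~ zeros q ++ zeros (suc a) ++ true ∷ zeros j ++ y) (++-assoc (zeros (suc a)) (true ∷ zeros j ++ y) (zeros q))
      (~-swap (zeros (suc a) ++ true ∷ zeros j ++ y) (zeros q))
    to-γ : true ∷ zeros (suc a) ++ Z ~ γ
    to-γ = ~-trans α~ρ (~-trans (~-reflexive (sym ρ≡)) (~-sym γ~ρ))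
    symm : reverse (true ∷ zeros (suc a) ++ Z) ~ true ∷ zeros (suc a) ++ Z
    symm = swap-symmetric true a Z (~-trans to-γ (~-trans (~-reflexive γ≡) (~-sym β~γ)))
  go : (Σ Str λ e₁ → zeros M ≡ u ++ e₁ × false ∷ v ≡ e₁ ++ y) ⊎
       (Σ Bool λ c → Σ Str λ e₁ → u ≡ zeros M ++ c ∷ e₁ × y ≡ c ∷ e₁ ++ false ∷ v) →
       v ++ u ≡ zeros j ++ y ++ zeros (suc i)
  go (inj₂ (c , e₁ , f , _)) = ⊥-elim (long M j ((c ∷ e₁) ++ true ∷ v) M≡ (trans (cong (_++ true ∷ v) f) (++-assoc (zeros M) (c ∷ e₁) (true ∷ v))))
  go (inj₁ ([] , f , h)) with trans h (proj₂ (start B))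
  ... | ()
  go (inj₁ (c ∷ e₁ , f , h)) with replicate-split M false u (c ∷ e₁) f
  ... | pu , pe , pM = run (length u) (length e₁) pM pu (trans (∷-injectiveʳ h) (cong (_++ y) (∷-injectiveʳ pe)))

-- Write y 1 1ᵗ = u 1 v with x = v u, so that u 0 v is a rotation of γ. A 0 put inside y makes this
-- rotation smaller than γ. A 0 put among the final ones is the last 0 of γ moved across ones, which
-- makes γ symmetric.
unique-zero : ∀ y t x → IsA (y ++ false ∷ ones t) →
  false ∷ x ~ y ++ false ∷ ones t → true ∷ x ~ y ++ true ∷ ones t → x ≡ ones t ++ y
unique-zero y t x a px qx with ~-∷-split qx
... | u , v , e , refl = go (++-split y u e)
  where
  γ = y ++ false ∷ ones t
  γ~ρ : γ ~ u ++ false ∷ v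
  γ~ρ = ~-trans (~-sym px) (~-∷-++ false u v)
  go : (Σ Str λ e₁ → u ≡ y ++ e₁ × true ∷ ones t ≡ e₁ ++ true ∷ v) ⊎
       (Σ Bool λ c → Σ Str λ e₁ → y ≡ u ++ c ∷ e₁ × true ∷ v ≡ c ∷ e₁ ++ true ∷ ones t) →
       v ++ u ≡ ones t ++ y
  go (inj₁ ([] , refl , h)) = cong₂ _++_ (sym (∷-injectiveʳ h)) (++-identityʳ y)
  go (inj₁ (c ∷ e₁ , refl , h)) with replicate-split t true e₁ (true ∷ v) (∷-injectiveʳ h) | ∷-injectiveˡ h
  ... | pe , pv , pt | refl = ⊥-elim (¬IsA-sym (~-trans (~-reverse (~-sym to-γ)) (~-trans symm to-γ)) a)
    where
    p = length e₁
    b = length v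
    Z = ones b ++ y
    γ≡ : γ ≡ y ++ false ∷ ones (suc p) ++ ones b
    γ≡ = cong (λ w → y ++ false ∷ w) (trans (cong ones (trans pt (+-suc p b))) (replicate-++ (suc p) b))
    ρ≡ : (y ++ true ∷ e₁) ++ false ∷ v ≡ y ++ ones (suc p) ++ false ∷ ones b
    ρ≡ = trans (++-assoc y (true ∷ e₁) (false ∷ v)) (cong₂ (λ w w′ → y ++ (true ∷ w) ++ false ∷ w′) pe (∷-injectiveʳ pv))
    to-γ : false ∷ ones (suc p) ++ Z ~ γ
    to-γ = ~-trans (subst (_~ y ++ false ∷ ones (suc p) ++ ones b) (cong (false ∷_) (++-assoc (ones (suc p)) (ones b) y))
      (~-swap (false ∷ ones (suc p) ++ ones b) y)) (~-reflexive (sym γ≡))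
    to-ρ : ones (suc p) ++ false ∷ Z ~ y ++ ones (suc p) ++ false ∷ ones b
    to-ρ = subst (_~ y ++ ones (suc p) ++ false ∷ ones b) (++-assoc (ones (suc p)) (false ∷ ones b) y)
      (~-swap (ones (suc p) ++ false ∷ ones b) y)
    symm : reverse (false ∷ ones (suc p) ++ Z) ~ false ∷ ones (suc p) ++ Z
    symm = swap-symmetric false p Z (~-trans to-γ (~-trans γ~ρ (~-trans (~-reflexive ρ≡) (~-sym to-ρ))))
  go (inj₂ (c , e₁ , refl , h)) with ∷-injectiveˡ h
  ... | refl = ⊥-elim (necklace a γ~ρ (subst (u ++ false ∷ v ≺_) (sym (++-assoc u (true ∷ e₁) (false ∷ ones t))) (≺-prepend u now)))

module _ {γ} (a : IsA γ) where
  open Shape (shape a)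

  asymmetric : ¬ reverse γ ~ γ
  asymmetric p = ¬IsA-sym p a

  firstOne-shape : firstOne γ ≡ zeros (suc i + suc j) ++ y
  firstOne-shape = begin
    firstOne γ ≡⟨ cong firstOne eqʸ ⟩
    firstOne (zeros (suc i) ++ true ∷ zeros j ++ y) ≡⟨ firstOne-zeros (suc i) (zeros j ++ y) ⟩
    zeros (suc i) ++ zeros (suc j) ++ y ≡⟨ sym (++-assoc (zeros (suc i)) (zeros (suc j)) y) ⟩
    (zeros (suc i) ++ zeros (suc j)) ++ y ≡⟨ cong (_++ y) (sym (replicate-++ (suc i) (suc j))) ⟩
    zeros (suc i + suc j) ++ y ∎
    where open ≡-Reasoning

  z⁻ : Str
  z⁻ = zeros (suc i) ++ z ++ zeros k

  snoc-shape : γ ≡ z⁻ ++ true ∷ []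
  snoc-shape = trans eqᶻ (trans (cong (zeros (suc i) ++_) (sym (++-assoc z (zeros k) (true ∷ []))))
    (sym (++-assoc (zeros (suc i)) (z ++ zeros k) (true ∷ []))))

  lastOne-shape : lastOne γ ≡ neck (z⁻ ++ false ∷ [])
  lastOne-shape = trans (cong lastOne snoc-shape) (lastOne-snoc z⁻ true)

  zeros-z~ : z⁻ ++ false ∷ [] ~ zeros (suc i + suc k) ++ z
  zeros-z~ = subst₂ _~_ eq₁ eq₂ (~-swap (zeros (suc i) ++ z) (zeros (suc k)))
    where
    eq₁ : (zeros (suc i) ++ z) ++ zeros (suc k) ≡ z⁻ ++ false ∷ []
    eq₁ = trans (++-assoc (zeros (suc i)) z (zeros (suc k))) (trans (cong (λ w → zeros (suc i) ++ z ++ w)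
      (trans (sym (++-identityʳ _)) (sym (replicate-∷ʳ k []))))
      (trans (cong (zeros (suc i) ++_) (sym (++-assoc z (zeros k) (false ∷ [])))) (sym (++-assoc (zeros (suc i)) (z ++ zeros k) (false ∷ [])))))
    eq₂ : zeros (suc k) ++ zeros (suc i) ++ z ≡ zeros (suc i + suc k) ++ z
    eq₂ = trans (sym (++-assoc (zeros (suc k)) (zeros (suc i)) z)) (cong (_++ z)
      (trans (sym (replicate-++ (suc k) (suc i))) (cong zeros (+-comm (suc k) (suc i)))))

  unique-firstOne : ∀ {x} → true ∷ x ~ γ → false ∷ x ~ firstOne γ → x ≡ (zeros j ++ y) ++ zeros (suc i)
  unique-firstOne {x} p q = trans (unique-one i j y x blockʸ (subst (NoRun (suc i)) eqʸ noRun)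
    (subst (λ w → ¬ reverse w ~ w) eqʸ asymmetric)
    (~-trans p (~-reflexive eqʸ)) (~-trans q (~-reflexive firstOne-shape))) (sym (++-assoc (zeros j) y (zeros (suc i))))

  -- The mirror image of `unique-firstOne`: the reversal of γ rotates to `γ′`, whose first 1 is the
  -- last 1 of γ.
  unique-lastOne : ∀ {x} → true ∷ x ~ γ → false ∷ x ~ z⁻ ++ false ∷ [] → x ≡ z⁻
  unique-lastOne {x} p q = begin
    x ≡⟨ sym (reverse-involutive x) ⟩
    reverse (reverse x) ≡⟨ cong reverse (unique-one i k (reverse z) (reverse x) (Block-reverse blockᶻ) nr asym′ p′ q′) ⟩
    reverse (zeros k ++ reverse z ++ zeros (suc i)) ≡⟨ reverse-++ (zeros k) (reverse z ++ zeros (suc i)) ⟩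
    reverse (reverse z ++ zeros (suc i)) ++ reverse (zeros k) ≡⟨ cong₂ _++_ (reverse-++ (reverse z) (zeros (suc i))) (reverse-replicate k) ⟩
    (reverse (zeros (suc i)) ++ reverse (reverse z)) ++ zeros k ≡⟨ cong₂ (λ v w → (v ++ w) ++ zeros k) (reverse-replicate (suc i)) (reverse-involutive z) ⟩
    (zeros (suc i) ++ z) ++ zeros k ≡⟨ ++-assoc (zeros (suc i)) z (zeros k) ⟩
    z⁻ ∎
    where
    open ≡-Reasoning
    γ′ = zeros (suc i) ++ true ∷ zeros k ++ reverse z
    rev-γ : reverse γ ~ γ′
    rev-γ = ~-trans (~-reflexive (cong reverse eqᶻ)) (~-trans (reverse-zeros-++ (suc i) (z ++ zeros k ++ true ∷ []))
      (~-reflexive (cong (zeros (suc i) ++_) (trans (reverse-++ z (zeros k ++ true ∷ []))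
        (cong (_++ reverse z) (trans (reverse-++ (zeros k) (true ∷ [])) (cong (true ∷_) (reverse-replicate k))))))))
    rev-γ′ : γ ~ reverse γ′
    rev-γ′ = subst (_~ reverse γ′) (reverse-involutive γ) (~-reverse rev-γ)
    asym′ : ¬ reverse γ′ ~ γ′
    asym′ r = asymmetric (~-trans rev-γ (~-trans (~-sym r) (~-sym rev-γ′)))
    nr : NoRun (suc i) γ′
    nr {ρ} r s e = noRun (reverse r) (~-trans rev-γ′ (~-trans (~-reverse s) (~-trans (~-reflexive (cong reverse e)) (reverse-zeros-++ (suc (suc i)) r)))) refl
    p′ : true ∷ reverse x ~ γ′
    p′ = ~-trans (~-swap (true ∷ []) (reverse x)) (~-trans (~-reflexive (sym (unfold-reverse true x))) (~-trans (~-reverse p) rev-γ))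
    q′ : false ∷ reverse x ~ zeros (suc i + suc k) ++ reverse z
    q′ = ~-trans (~-swap (false ∷ []) (reverse x)) (~-trans (~-reflexive (sym (unfold-reverse false x)))
      (~-trans (~-reverse (~-trans q zeros-z~)) (reverse-zeros-++ (suc i + suc k) z)))

  unique-lastZero : ∀ {x} u t → γ ≡ u ++ false ∷ ones t → false ∷ x ~ γ → true ∷ x ~ u ++ true ∷ ones t → x ≡ ones t ++ u
  unique-lastZero {x} u t refl p q = unique-zero u t x a p q

-- LastZero preserves minimality

weight : Str → ℕ
weight []          = 0
weight (true ∷ x)  = suc (weight x)
weight (false ∷ x) = weight x

weight-++ : ∀ u v → weight (u ++ v) ≡ weight u + weight v
weight-++ []          v = refl
weight-++ (true ∷ u)  v = cong suc (weight-++ u v)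
weight-++ (false ∷ u) v = weight-++ u v

weight-++-comm : ∀ u v → weight (u ++ v) ≡ weight (v ++ u)
weight-++-comm u v = trans (weight-++ u v) (trans (+-comm (weight u) (weight v)) (sym (weight-++ v u)))

weight-~ : ∀ {α β} → α ~ β → weight α ≡ weight β
weight-~ p with ~-split p
... | u , v , refl , refl = weight-++-comm u v

weight-reverse : ∀ α → weight (reverse α) ≡ weight α
weight-reverse []      = refl
weight-reverse (b ∷ α) = trans (cong weight (unfold-reverse b α))
  (trans (weight-++-comm (reverse α) (b ∷ [])) (weight-∷ b))
  where
  weight-∷ : ∀ b → weight (b ∷ reverse α) ≡ weight (b ∷ α)
  weight-∷ true  = cong suc (weight-reverse α)
  weight-∷ false = weight-reverse α

weight≤length : ∀ α → weight α ≤ length α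
weight≤length []          = z≤n
weight≤length (true ∷ α)  = s≤s (weight≤length α)
weight≤length (false ∷ α) = m≤n⇒m≤1+n (weight≤length α)

weight-ones : ∀ t → weight (ones t) ≡ t
weight-ones zero    = refl
weight-ones (suc t) = cong suc (weight-ones t)

ones-max : ∀ t {v} → ¬ ones t ≺ v
ones-max (suc t) (later p) = ones-max t p

≺-ones-weight : ∀ t {v} → v ≺ ones t → length v ≡ t → weight v < t
≺-ones-weight (suc t) {false ∷ v} now       e = s≤s (≤-trans (weight≤length v) (≤-reflexive (suc-injective e)))
≺-ones-weight (suc t) (later p) e = s≤s (≺-ones-weight t p (suc-injective e))

-- A string strictly between the two starts with u, followed either by 0 and a tail above 1ᵗ, which
-- does not exist, or by 1 and a tail below 1ᵗ, which has fewer ones.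
between : ∀ u t {ρ} → u ++ false ∷ ones t ≺ ρ → ρ ≺ u ++ true ∷ ones t →
  length ρ ≡ length (u ++ true ∷ ones t) → weight ρ ≡ weight (u ++ true ∷ ones t) → ⊥
between []          t (later p) now       _ _ = ones-max t p
between []          t now       (later q) e f =
  <⇒≢ (≺-ones-weight t q (trans (suc-injective e) (length-replicate t))) (trans (suc-injective f) (weight-ones t))
between (false ∷ u) t (later p) (later q) e f = between u t p q (suc-injective e) f
between (true ∷ u)  t (later p) (later q) e f = between u t p q (suc-injective e) (suc-injective f)

-- Marks a letter and follows it through a rotation, so that it can be replaced on both sides at
-- once.
flip-rotation : ∀ {ρ} u b v → u ++ b ∷ v ~ ρ → Σ Str λ p → Σ Str λ q → ρ ≡ p ++ b ∷ q × (∀ c → u ++ c ∷ v ~ p ++ c ∷ q)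
flip-rotation {ρ} u b v r with ~-∷-split (~-trans (~-∷-++ b u v) r)
... | p , q , e , f = p , q , e , λ c → ~-trans (~-sym (~-∷-++ c u v)) (~-trans (~-reflexive (cong (c ∷_) f)) (~-∷-++ c p q))

-- Turning on the last zero keeps a bracelet a bracelet: an offending rotation
-- would lie strictly between u 0 1ᵗ and u 1 1ᵗ, hence have too few ones.
lastZero-IsA : ∀ u t → IsA (u ++ false ∷ ones t) → ¬ reverse (u ++ true ∷ ones t) ~ u ++ true ∷ ones t → IsA (u ++ true ∷ ones t)
lastZero-IsA u t a asym = isA nk ch
  where
  γ γ′ : Str
  γ  = u ++ false ∷ ones t
  γ′ = u ++ true ∷ ones t
  squeeze : ∀ p q → γ ≼ p ++ false ∷ q → length (p ++ true ∷ q) ≡ length γ′ → weight (p ++ true ∷ q) ≡ weight γ′ → ¬ p ++ true ∷ q ≺ γ′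
  squeeze p q (inj₁ r) el ew s = between u t (≺-trans r (≺-prepend p now)) s el ew
  squeeze p q (inj₂ e) el ew s = between u t (subst (_≺ p ++ true ∷ q) (sym e) (≺-prepend p now)) s el ew
  nk : IsNecklace γ′
  nk {ρ} r with flip-rotation u true (ones t) r
  ... | p , q , refl , f = squeeze p q
          (⊀⇒≽ (p ++ false ∷ q) γ (sym (~-length (f false))) (necklace a (f false))) (sym (~-length r)) (sym (weight-~ r))
  ch : ∀ {ρ} → reverse γ′ ~ ρ → γ′ ≺ ρ
  ch {ρ} r with flip-rotation (ones t) true (reverse u) (~-trans (~-reflexive (sym (reverse-++-∷-replicate u true t true))) r)
  ... | p , q , refl , f with ≺-cmp γ′ (p ++ true ∷ q) (trans (sym (length-reverse γ′)) (~-length r))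
  ...   | inj₁ s        = s
  ...   | inj₂ (inj₁ e) = ⊥-elim (asym (subst (reverse γ′ ~_) (sym e) r))
  ...   | inj₂ (inj₂ s) = ⊥-elim (squeeze p q (inj₁ (chiral a (~-trans (~-reflexive (reverse-++-∷-replicate u false t true)) (f false))))
            (trans (sym (~-length r)) (length-reverse γ′)) (trans (sym (weight-~ r)) (weight-reverse γ′)) s)

ones≺⁻ : ∀ p q {r s} → ones p ++ false ∷ r ≺ ones q ++ false ∷ s → p ≤ q
ones≺⁻ zero    q       _         = z≤n
ones≺⁻ (suc p) (suc q) (later r) = s≤s (ones≺⁻ p q r)

ones≺⁺ : ∀ p q {r s} → p < q → ones p ++ false ∷ r ≺ ones q ++ s
ones≺⁺ zero    (suc q) _       = now
ones≺⁺ (suc p) (suc q) (s≤s h) = later (ones≺⁺ p q h)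

ones≡⁻ : ∀ p q {r s} → ones p ++ false ∷ r ≡ ones q ++ s → q ≤ p
ones≡⁻ p       zero    _ = z≤n
ones≡⁻ zero    (suc q) ()
ones≡⁻ (suc p) (suc q) e = s≤s (ones≡⁻ p q (∷-injectiveʳ e))

zeros-unique : ∀ p q {r s} → zeros p ++ true ∷ r ≡ zeros q ++ true ∷ s → p ≡ q × r ≡ s
zeros-unique zero    zero    e = refl , ∷-injectiveʳ e
zeros-unique (suc p) (suc q) e with zeros-unique p q (∷-injectiveʳ e)
... | refl , f = refl , f

-- LastZero yields an asymmetric string

Palindrome : Str → Set
Palindrome x = reverse x ≡ x

-- A reflection of 0ᴵ w maps the initial run of zeros to itself or to a second run 0ᴵ.
symmetric-split : ∀ I {w w₁ w₂} → w ≡ true ∷ w₁ → w ≡ w₂ ++ true ∷ [] → zeros I ++ w ~ zeros I ++ reverse w →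
  Palindrome w ⊎ (Σ Str λ P → Σ Str λ Q → w ≡ P ++ zeros I ++ Q × Palindrome P × Palindrome Q)
symmetric-split I {w} {w₁} {w₂} ws we p with ~-split p
... | u , v , e , f with ++-split (zeros I) u e
...   | inj₂ (x , e₁ , g , h) with replicate-split I false u (x ∷ e₁) g
...     | pu , pe , pI with u
...       | []     = inj₁ (++-cancelˡ (zeros I) _ _ (trans f (trans (++-identityʳ v) (sym e))))
...       | c ∷ u₁ = ⊥-elim (contra (++-cancelˡ (x ∷ e₁) (w ++ c ∷ u₁) (c ∷ u₁ ++ reverse w) eq) (∷-injectiveˡ pu))
  where
  eq : (x ∷ e₁) ++ w ++ c ∷ u₁ ≡ (x ∷ e₁) ++ c ∷ u₁ ++ reverse w
  eq = begin
    (x ∷ e₁) ++ w ++ c ∷ u₁ ≡⟨ sym (++-assoc (x ∷ e₁) w (c ∷ u₁)) ⟩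
    ((x ∷ e₁) ++ w) ++ c ∷ u₁ ≡⟨ cong (_++ c ∷ u₁) (sym h) ⟩
    v ++ c ∷ u₁ ≡⟨ sym f ⟩
    zeros I ++ reverse w ≡⟨ cong (λ k → zeros k ++ reverse w) (trans pI (+-comm (length (c ∷ u₁)) (length (x ∷ e₁)))) ⟩
    zeros (length (x ∷ e₁) + length (c ∷ u₁)) ++ reverse w ≡⟨ cong (_++ reverse w) (replicate-++ (length (x ∷ e₁)) (length (c ∷ u₁))) ⟩
    (zeros (length (x ∷ e₁)) ++ zeros (length (c ∷ u₁))) ++ reverse w ≡⟨ ++-assoc (zeros (length (x ∷ e₁))) _ _ ⟩
    zeros (length (x ∷ e₁)) ++ zeros (length (c ∷ u₁)) ++ reverse w ≡⟨ cong₂ (λ a b → a ++ b ++ reverse w) (sym pe) (sym pu) ⟩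
    (x ∷ e₁) ++ c ∷ u₁ ++ reverse w ∎
    where open ≡-Reasoning
  contra : w ++ c ∷ u₁ ≡ c ∷ u₁ ++ reverse w → c ≡ false → ⊥
  contra q refl with trans (cong (_++ c ∷ u₁) (sym ws)) q
  ... | ()
symmetric-split I {w} {w₁} {w₂} ws we p | u , v , e , f | inj₁ (P , refl , h) with v
... | [] = inj₁ (++-cancelˡ (zeros I) _ _ (trans f (cong (zeros I ++_) (sym (trans h (++-identityʳ P))))))
... | c ∷ v₁ with ++-split (c ∷ v₁) (zeros I) (sym f)
...   | inj₁ (e₁ , g , _) with suffix-last P c v₁ (trans (sym we) h)
...     | v₂ , s = ⊥-elim (zeros-not-end I (c ∷ v₁) v₂ e₁ s g)
symmetric-split I {w} {w₁} {w₂} ws we p | u , v , e , f | inj₁ (P , refl , h) | c ∷ v₁ | inj₂ (x , e₁ , g , l) =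
  inj₂ (P , Q , w≡ , P-pal , Q-pal)
  where
  Q = x ∷ e₁
  w≡ : w ≡ P ++ zeros I ++ Q
  w≡ = trans h (cong (P ++_) g)
  rev-w : reverse w ≡ reverse Q ++ zeros I ++ reverse P
  rev-w = trans (cong reverse w≡) (trans (reverse-++ P (zeros I ++ Q)) (trans (cong (_++ reverse P) (trans (reverse-++ (zeros I) Q)
    (cong (reverse Q ++_) (reverse-replicate I)))) (++-assoc (reverse Q) (zeros I) (reverse P))))
  both : reverse Q ≡ Q × zeros I ++ reverse P ≡ zeros I ++ P
  both = ++-length-split (reverse Q) Q (length-reverse Q) (trans (sym rev-w) l)
  Q-pal = proj₁ both
  P-pal = ++-cancelˡ (zeros I) _ _ (proj₂ both)

-- The last 0 lies behind the first 1, as a core of ones only would be symmetric. Since γ ends in 1,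
-- the number `suc t′` of final ones is positive.
record LastZeroShape {γ} (S : Shape γ) : Set where
  open Shape S
  field
    Y  : Str
    t′ : ℕ
    w≡ : true ∷ zeros j ++ y ≡ (true ∷ Y) ++ false ∷ ones (suc t′)

lastZeroShape : ∀ {γ} (a : IsA γ) → LastZeroShape (shape a)
lastZeroShape {γ} a = go (spanʳ true W)
  where
  open Shape (shape a)
  W = true ∷ zeros j ++ y
  yEnd = proj₁ (end blockʸ)
  W-end : W ≡ (true ∷ zeros j ++ yEnd) ++ true ∷ []
  W-end = cong (true ∷_) (trans (cong (zeros j ++_) (proj₂ (end blockʸ))) (sym (++-assoc (zeros j) yEnd (true ∷ []))))
  go : (Σ ℕ λ i → W ≡ ones i) ⊎ (Σ ℕ λ t → Σ Str λ r → W ≡ r ++ false ∷ ones t) → LastZeroShape (shape a)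
  go (inj₁ (m , e)) = ⊥-elim (asymmetric a (subst (λ w → reverse w ~ w) (sym (trans eqʸ (cong (zeros (suc i) ++_) e)))
    (~-trans (reverse-zeros-++ (suc i) (ones m)) (~-reflexive (cong (zeros (suc i) ++_) (reverse-replicate m))))))
  go (inj₂ (t , [] , ()))
  go (inj₂ (zero , c ∷ r , e)) with ++-length-splitʳ (true ∷ zeros j ++ yEnd) (c ∷ r) {false ∷ []} refl (trans (sym W-end) e)
  ... | _ , ()
  go (inj₂ (suc t , c ∷ r , e)) with ∷-injectiveˡ e
  ... | refl = record { Y = r ; t′ = t ; w≡ = e }

module LastZero {γ} (a : IsA γ) where
  open Shape (shape a)
  open LastZeroShape (lastZeroShape a)

  t I : ℕ
  t = suc t′
  I = suc i
  X W W′ u : Str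
  X  = true ∷ Y
  W  = true ∷ zeros j ++ y
  W′ = X ++ true ∷ ones t
  u  = zeros I ++ X

  γ≡ : γ ≡ u ++ false ∷ ones t
  γ≡ = trans eqʸ (trans (cong (zeros I ++_) w≡) (sym (++-assoc (zeros I) X (false ∷ ones t))))

  -- `Hy` and `Hz` express that FirstOne and LastOne leave A(n). They restrict both ends of the
  -- core: W begins with 10 and ends in at most two ones.
  module NotFirstNotLast (Hy : ¬ y ≺ reverse y) (Hz : ¬ z ≺ reverse z)
    (¬root : ∀ m → γ ≢ zeros m ++ true ∷ false ∷ true ∷ true ∷ []) where

    y₁ : Str
    y₁ = proj₁ (start blockʸ)

    W≺ : W ≺ reverse W
    W≺ = IsA⇒≺reverse I W (subst IsA eqʸ a)

    reverse-W : reverse W ≡ ones t ++ false ∷ reverse X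
    reverse-W = trans (cong reverse w≡) (reverse-++-∷-replicate X false t true)

    -- If j were 0, W would be 1 y. As W ≺ reverse W, W has at most t leading ones, so y has fewer
    -- than t, while the reversal of y has exactly t. This makes y smaller than its reversal,
    -- against `Hy`.
    j-suc : Σ ℕ λ j′ → j ≡ suc j′
    j-suc = go j refl
      where
      go : ∀ l → j ≡ l → Σ ℕ λ j′ → j ≡ suc j′
      go (suc l) e = l , e
      go zero    e = ⊥-elim (contra (span true y))
        where
        W≡ : W ≡ true ∷ y
        W≡ = cong (λ l → true ∷ zeros l ++ y) e
        rev-y : reverse y ≡ ones t ++ false ∷ reverse Y
        rev-y = proj₁ (++-length-splitʳ (reverse y) (ones t ++ false ∷ reverse Y) {true ∷ []} refl
          (trans (sym (unfold-reverse true y)) (trans (cong reverse (sym W≡)) (trans reverse-W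
            (trans (cong (λ w → ones t ++ false ∷ w) (unfold-reverse true Y)) (sym (++-assoc (ones t) (false ∷ reverse Y) (true ∷ [])))))))) 
        contra : (Σ ℕ λ l → y ≡ ones l) ⊎ (Σ ℕ λ l → Σ Str λ r → y ≡ ones l ++ false ∷ r) → ⊥
        contra (inj₁ (l , f)) with replicate-split (suc l) true X (false ∷ ones t) (trans (cong (true ∷_) (sym f)) (trans (sym W≡) w≡))
        ... | _ , () , _
        contra (inj₂ (l , r , f)) = Hy (subst₂ _≺_ (sym f) (sym rev-y)
          (ones≺⁺ l t (ones≺⁻ (suc l) t (subst₂ _≺_ (trans W≡ (cong (true ∷_) f)) reverse-W W≺))))

    j′ : ℕ
    j′ = proj₁ j-suc

    W≡ : W ≡ true ∷ false ∷ zeros j′ ++ y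
    W≡ = cong (λ l → true ∷ zeros l ++ y) (proj₂ j-suc)

    Wᶻ : W ≡ z ++ zeros k ++ true ∷ []
    Wᶻ = ++-cancelˡ (zeros I) _ _ (trans (sym eqʸ) eqᶻ)

    z≡ : ∀ V → W ≡ V ++ true ∷ true ∷ [] → z ≡ V ++ true ∷ []
    z≡ V e = go k refl
      where
      zk : z ++ zeros k ≡ V ++ true ∷ []
      zk = proj₁ (++-length-splitʳ (z ++ zeros k) (V ++ true ∷ []) {true ∷ []} refl
        (trans (++-assoc z (zeros k) (true ∷ [])) (trans (sym Wᶻ) (trans e (sym (++-assoc V (true ∷ []) (true ∷ [])))))))
      go : ∀ l → k ≡ l → z ≡ V ++ true ∷ []
      go zero    f = trans (sym (++-identityʳ z)) (trans (cong (λ l → z ++ zeros l) (sym f)) zk)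
      go (suc l) f with ++-length-splitʳ (z ++ zeros l) V {true ∷ []} refl
        (trans (trans (++-assoc z (zeros l) (false ∷ [])) (cong (z ++_) (trans (replicate-∷ʳ l []) (++-identityʳ (zeros (suc l))))))
          (trans (cong (λ l → z ++ zeros l) (sym f)) zk))
      ... | _ , ()

    -- Three final ones would leave two at the end of z, which begins with 10. Then z ≺ reverse z,
    -- against `Hz`.
    ¬111 : ∀ V → W ≢ V ++ true ∷ true ∷ true ∷ []
    ¬111 []          e with trans (sym W≡) e
    ... | ()
    ¬111 (c ∷ [])    e with trans (sym W≡) e
    ... | ()
    ¬111 (c ∷ d ∷ V) e with trans (sym W≡) e
    ... | q with ∷-injectiveˡ q | ∷-injectiveˡ (∷-injectiveʳ q)
    ...   | refl | refl = Hz (subst₂ _≺_ (sym zV) (sym rev-z) (later now))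
      where
      zV : z ≡ (true ∷ false ∷ V ++ true ∷ []) ++ true ∷ []
      zV = z≡ (true ∷ false ∷ V ++ true ∷ []) (trans e (cong (λ w → true ∷ false ∷ w) (sym (++-assoc V (true ∷ []) (true ∷ true ∷ [])))))
      rev-z : reverse z ≡ true ∷ true ∷ reverse (true ∷ false ∷ V)
      rev-z = trans (cong reverse zV) (trans (reverse-∷ʳ (true ∷ false ∷ V ++ true ∷ []) true) (cong (true ∷_) (reverse-∷ʳ (true ∷ false ∷ V) true)))

    t≤2 : t ≤ 2
    t≤2 = go t refl
      where
      go : ∀ l → t ≡ l → l ≤ 2
      go zero _ = z≤n
      go 1    _ = s≤s z≤n
      go 2    _ = s≤s (s≤s z≤n)
      go (suc (suc (suc l))) e = ⊥-elim (¬111 (X ++ false ∷ ones l) (trans w≡ (trans (cong (λ l → X ++ false ∷ ones l) (trans e (+-comm 3 l)))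
        (trans (cong (λ w → X ++ false ∷ w) (replicate-++ l 3)) (sym (++-assoc X (false ∷ ones l) (ones 3)))))))

    -- W′ ends in 11, so as a palindrome it would begin with 11; but if Y is nonempty its second
    -- letter is that of W, a 0. Empty Y leaves W = 101, a palindrome, and W = 1011, the core of the
    -- root.
    case₁ : ¬ Palindrome W′
    case₁ pal = go Y refl
      where
      rev-W′ : reverse W′ ≡ true ∷ ones t ++ reverse X
      rev-W′ = trans (reverse-++-∷-replicate X true t true) (replicate-∷ʳ t (reverse X))
      go : ∀ V → Y ≡ V → ⊥
      go (c ∷ V) e with trans (sym (trans w≡ (cong (λ v → (true ∷ v) ++ false ∷ ones t) e))) W≡ | trans (cong (λ v → (true ∷ v) ++ true ∷ ones t) (sym e)) (trans (sym pal) rev-W′)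
      ... | p | q with trans (sym (∷-injectiveˡ (∷-injectiveʳ p))) (∷-injectiveˡ (∷-injectiveʳ q))
      ...   | ()
      go [] e = tcase t refl t≤2
        where
        W1 : W ≡ true ∷ false ∷ ones t
        W1 = trans w≡ (cong (λ v → (true ∷ v) ++ false ∷ ones t) e)
        tcase : ∀ l → t ≡ l → l ≤ 2 → ⊥
        tcase 1 f _ = ≺-irrefl (subst (λ w → w ≺ reverse w) (trans W1 (cong (λ l → true ∷ false ∷ ones l) f)) W≺)
        tcase 2 f _ = ¬root I (trans eqʸ (cong (zeros I ++_) (trans W1 (cong (λ l → true ∷ false ∷ ones l) f))))
        tcase (suc (suc (suc l))) _ (s≤s (s≤s ()))

    module Case₂ (P Q : Str) (W′≡ : W′ ≡ P ++ zeros I ++ Q) (P-pal : Palindrome P) (Q-pal : Palindrome Q) where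

      -- The second run 0ᴵ ends before the flipped 0: if it touched that 0, γ would contain I + 1
      -- consecutive zeros. `Q₀` is the nonempty string between the two.
      X-split : Σ Str λ Q₀ → 0 < length Q₀ × X ≡ P ++ zeros I ++ Q₀ × Q ≡ Q₀ ++ true ∷ ones t
      X-split with ++-split X (P ++ zeros I) (trans W′≡ (sym (++-assoc P (zeros I) Q)))
      ... | inj₂ (c , Q₀ , e , f) = c ∷ Q₀ , s≤s z≤n , trans e (++-assoc P (zeros I) (c ∷ Q₀)) , f
      ... | inj₁ ([] , e , f) = ⊥-elim (noRun-factor noRun (zeros I ++ P) (ones t) (trans eqʸ (trans (cong (zeros I ++_) (trans w≡ (trans
              (cong (_++ false ∷ ones t) (trans (sym (++-identityʳ X)) (sym e))) (trans (++-assoc P (zeros I) (false ∷ ones t)) (cong (P ++_) (replicate-∷ʳ I (ones t)))))))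
              (sym (++-assoc (zeros I) P (zeros (suc I) ++ ones t))))))
      ... | inj₁ (c ∷ e₁ , e , f) with replicate-split (suc t) true (c ∷ e₁) Q f | unsnoc c e₁
      ...   | pe , _ | e₂ , d , g with ++-length-splitʳ (P ++ zeros i) (X ++ e₂) {d ∷ []} refl
               (trans (trans (++-assoc P (zeros i) (false ∷ [])) (cong (P ++_) (trans (replicate-∷ʳ i []) (++-identityʳ (zeros I)))))
                 (trans e (trans (cong (X ++_) g) (sym (++-assoc X e₂ (d ∷ []))))))
                | replicate-split (length (c ∷ e₁)) true e₂ (d ∷ []) (trans (sym pe) g)
      ...     | _ , refl | _ , () , _

      Q₀ : Str
      Q₀ = proj₁ X-split

      X≡ : X ≡ P ++ zeros I ++ Q₀
      X≡ = proj₁ (proj₂ (proj₂ X-split))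

      A B : Str
      A = zeros I ++ P ++ zeros I
      B = Q₀ ++ false ∷ ones t

      W-AB : W ≡ P ++ zeros I ++ B
      W-AB = trans w≡ (trans (cong (_++ false ∷ ones t) X≡) (trans (++-assoc P (zeros I ++ Q₀) (false ∷ ones t))
        (cong (P ++_) (++-assoc (zeros I) Q₀ (false ∷ ones t)))))

      γ-AB : γ ≡ A ++ B
      γ-AB = trans eqʸ (trans (cong (zeros I ++_) W-AB) (trans (cong (zeros I ++_) (sym (++-assoc P (zeros I) B)))
        (sym (++-assoc (zeros I) (P ++ zeros I) B))))

      reverse-A : reverse A ≡ A
      reverse-A = trans (reverse-++ (zeros I) (P ++ zeros I)) (trans (cong₂ _++_ (trans (reverse-++ P (zeros I))
        (cong₂ _++_ (reverse-replicate I) P-pal)) (reverse-replicate I)) (++-assoc (zeros I) P (zeros I)))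

      -- A is a palindrome, so the reversal of γ = A B rotates to A followed by the reversal of B,
      -- and cancelling A from the minimality of γ leaves a comparison of B with its reversal.
      B≺ : B ≺ ones t ++ false ∷ reverse Q₀
      B≺ = ≺-cancel A (subst (_≺ A ++ ones t ++ false ∷ reverse Q₀) γ-AB (chiral a
        (subst (_~ A ++ ones t ++ false ∷ reverse Q₀) (sym rev-γ) (~-swap (ones t ++ false ∷ reverse Q₀) A))))
        where
        rev-γ : reverse γ ≡ (ones t ++ false ∷ reverse Q₀) ++ A
        rev-γ = trans (cong reverse γ-AB) (trans (reverse-++ A B) (cong₂ _++_ (reverse-++-∷-replicate Q₀ false t true) reverse-A))

      -- Suppose Q₀ contains a 0 behind q leading ones. The palindrome Q ends in t + 1 ones and so
      -- begins with as many, giving q > t, whereas `B≺` gives q ≤ t.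
      Q₀-ones : Σ ℕ λ q → Q₀ ≡ ones q × q < t
      Q₀-ones with span true Q₀
      ... | inj₁ (q , e) = q , e , ≤∧≢⇒< (ones≺⁻ q t B≺′) (λ { refl → ≺-irrefl B≺′ })
        where
        B≺′ : ones q ++ false ∷ ones t ≺ ones t ++ false ∷ ones q
        B≺′ = subst₂ _≺_ (cong (_++ false ∷ ones t) e) (cong (λ w → ones t ++ false ∷ w) (trans (cong reverse e) (reverse-replicate q))) B≺
      ... | inj₂ (q , s , e) = ⊥-elim (<-irrefl refl (≤-trans
              (ones≡⁻ q (suc t) (trans (sym (++-assoc (ones q) (false ∷ s) (true ∷ ones t))) (trans (cong (_++ true ∷ ones t) (sym e)) Q-eq)))
              (ones≺⁻ q t (subst (_≺ ones t ++ false ∷ reverse Q₀) (trans (cong (_++ false ∷ ones t) e) (++-assoc (ones q) (false ∷ s) (false ∷ ones t))) B≺))))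
        where
        Q-eq : Q₀ ++ true ∷ ones t ≡ ones (suc t) ++ reverse Q₀
        Q-eq = trans (sym (proj₂ (proj₂ (proj₂ X-split)))) (trans (sym Q-pal) (trans (cong reverse (proj₂ (proj₂ (proj₂ X-split))))
          (trans (reverse-++-∷-replicate Q₀ true t true) (replicate-∷ʳ t (reverse Q₀)))))

      tail₄ : Str
      tail₄ = true ∷ false ∷ true ∷ true ∷ []

      -- Only q = 1 and t = 2 satisfy 0 < q < t ≤ 2.
      W-1011 : W ≡ P ++ zeros I ++ tail₄
      W-1011 with Q₀-ones
      ... | q , e , q<t = go q t refl e q<t t≤2
        where
        go : ∀ q l → t ≡ l → Q₀ ≡ ones q → q < l → l ≤ 2 → W ≡ P ++ zeros I ++ tail₄
        go zero l _ f _ _ with subst (λ w → 0 < length w) f (proj₁ (proj₂ X-split))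
        ... | ()
        go (suc q) 1 _ _ (s≤s ()) _
        go (suc (suc q)) 2 _ _ (s≤s (s≤s ())) _
        go 1 2 tl f _ _ = trans W-AB (cong (λ w → P ++ zeros I ++ w) (cong₂ (λ a l → a ++ false ∷ ones l) f tl))
        go (suc q) (suc (suc (suc l))) _ _ _ (s≤s (s≤s ()))

      y-eq : ∀ l r → P ++ zeros I ++ tail₄ ≡ true ∷ zeros l ++ true ∷ r → j ≡ l × y ≡ true ∷ r
      y-eq l r e with zeros-unique j l (trans (cong (zeros j ++_) (sym (proj₂ (start blockʸ)))) (∷-injectiveʳ (trans W-1011 e)))
      ... | f , g = f , trans (proj₂ (start blockʸ)) (cong (true ∷_) g)

      z-eq : z ≡ P ++ zeros I ++ true ∷ false ∷ true ∷ []
      z-eq = trans (z≡ (P ++ zeros I ++ true ∷ false ∷ []) (trans W-1011 (assoc₃ (true ∷ true ∷ [])))) (sym (assoc₃ (true ∷ [])))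
        where
        assoc₃ : ∀ v → P ++ zeros I ++ true ∷ false ∷ v ≡ (P ++ zeros I ++ true ∷ false ∷ []) ++ v
        assoc₃ v = trans (cong (P ++_) (sym (++-assoc (zeros I) (true ∷ false ∷ []) v))) (sym (++-assoc P (zeros I ++ true ∷ false ∷ []) v))

      reverse-P0 : ∀ R v → reverse (R ++ zeros I ++ v) ≡ reverse v ++ zeros I ++ reverse R
      reverse-P0 R v = trans (reverse-++ R (zeros I ++ v)) (trans (cong (_++ reverse R) (trans (reverse-++ (zeros I) v)
        (cong (reverse v ++_) (reverse-replicate I)))) (++-assoc (reverse v) (zeros I) (reverse R)))

      reverse-z : reverse z ≡ true ∷ false ∷ true ∷ zeros I ++ P
      reverse-z = trans (cong reverse z-eq) (trans (reverse-P0 P (true ∷ false ∷ true ∷ [])) (cong (λ w → true ∷ false ∷ true ∷ zeros I ++ w) P-pal))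

      -- P is spelled out letter by letter. The beginning of W, the palindrome property, `Hy` and
      -- `Hz` exclude everything but P = 1011 P₄. What remains is excluded by rotations of γ
      -- together with `Hy`, separately for I = 1 and I ≥ 2.
      absurd : ⊥
      absurd = onP P refl
        where
        onP : ∀ R → P ≡ R → ⊥
        onP [] e with trans (sym W-1011) refl
        ... | q with trans (cong (_++ zeros I ++ tail₄) (sym e)) q
        ...   | ()
        onP (false ∷ R) e with trans (cong (_++ zeros I ++ tail₄) (sym e)) (sym W-1011)
        ... | ()
        onP (true ∷ R) e = onR (span false R)
          where
          onR : (Σ ℕ λ l → R ≡ zeros l) ⊎ (Σ ℕ λ l → Σ Str λ r → R ≡ zeros l ++ true ∷ r) → ⊥
          onR (inj₁ (zero , refl)) = Hy (subst (λ w → w ≺ reverse w)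
            (sym (proj₂ (y-eq I (false ∷ true ∷ true ∷ []) (cong (_++ zeros I ++ tail₄) e)))) (later now))
          onR (inj₁ (suc l , refl)) with trans (sym (reverse-++ (true ∷ []) (zeros (suc l)))) (trans (cong reverse (sym e)) (trans P-pal e))
          ... | q with trans (cong (_++ true ∷ []) (sym (reverse-replicate (suc l)))) q
          ...   | ()
          onR (inj₂ (l , P₃ , refl)) = onP₃ P₃ refl
            where
            yl : ∀ P₃′ → P₃ ≡ P₃′ → j ≡ l × y ≡ true ∷ P₃′ ++ zeros I ++ tail₄
            yl P₃′ refl = y-eq l (P₃ ++ zeros I ++ tail₄) (trans (cong (_++ zeros I ++ tail₄) e)
              (cong (true ∷_) (++-assoc (zeros l) (true ∷ P₃) (zeros I ++ tail₄))))
            rev-y : ∀ P₃′ → P₃ ≡ P₃′ → reverse y ≡ true ∷ true ∷ false ∷ true ∷ zeros I ++ reverse (true ∷ P₃′)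
            rev-y P₃′ f = trans (cong reverse (proj₂ (yl P₃′ f))) (reverse-P0 (true ∷ P₃′) tail₄)
            onP₃ : ∀ P₃′ → P₃ ≡ P₃′ → ⊥
            onP₃ [] f = Hy (subst₂ _≺_ (sym (proj₂ (yl [] f))) (sym (rev-y [] f)) (later now))
            onP₃ (false ∷ P₄) f = Hy (subst₂ _≺_ (sym (proj₂ (yl _ f))) (sym (rev-y _ f)) (later now))
            onP₃ (true ∷ P₄) f = onl l refl
              where
              P≡ : P ≡ true ∷ zeros l ++ true ∷ true ∷ P₄
              P≡ = trans e (cong (λ w → true ∷ zeros l ++ true ∷ w) f)
              onl : ∀ l′ → l ≡ l′ → ⊥
              onl zero g with trans (sym (proj₁ (yl _ f))) (proj₂ j-suc) | g
              ... | () | refl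
              onl (suc (suc l′)) g = Hz (subst₂ _≺_ (sym (trans z-eq (cong (_++ _) (trans P≡ (cong (λ l → true ∷ zeros l ++ true ∷ true ∷ P₄) g)))))
                (sym reverse-z) (later (later now)))
              onl 1 g = onI i refl
                where
                P₁ : P ≡ true ∷ false ∷ true ∷ true ∷ P₄
                P₁ = trans P≡ (cong (λ l → true ∷ zeros l ++ true ∷ true ∷ P₄) g)
                γP : γ ≡ zeros I ++ P ++ zeros I ++ tail₄
                γP = trans eqʸ (cong (zeros I ++_) W-1011)
                onI : ∀ i′ → i ≡ i′ → ⊥
                -- I = 1: the palindrome P ends in 101, so γ ends in 0101011. Moving this suffix to
                -- the front gives a string below γ, which begins with 01011.
                onI zero ei = necklace a (subst₂ _~_ eq refl (~-swap (false ∷ R₁ ++ true ∷ []) (false ∷ true ∷ false ∷ true ∷ false ∷ true ∷ true ∷ [])))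
                    (subst ((false ∷ true ∷ false ∷ true ∷ false ∷ true ∷ true ∷ false ∷ R₁ ++ true ∷ []) ≺_)
                      (sym (trans γP₀ (cong (λ w → false ∷ w ++ false ∷ tail₄) P₁))) (later (later (later (later now)))))
                  where
                  γP₀ : γ ≡ false ∷ P ++ false ∷ tail₄
                  γP₀ = trans γP (cong (λ l → zeros (suc l) ++ P ++ zeros (suc l) ++ tail₄) ei)
                  R₁ = reverse (true ∷ P₄)
                  P₂ : P ≡ R₁ ++ true ∷ false ∷ true ∷ []
                  P₂ = trans (sym P-pal) (trans (cong reverse P₁) (reverse-++ (true ∷ false ∷ true ∷ []) (true ∷ P₄)))
                  eq : (false ∷ R₁ ++ true ∷ []) ++ false ∷ true ∷ false ∷ true ∷ false ∷ true ∷ true ∷ [] ≡ γ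
                  eq = sym (trans γP₀ (cong (false ∷_) (trans (cong (_++ false ∷ tail₄) P₂) (trans (++-assoc R₁ (true ∷ false ∷ true ∷ []) (false ∷ tail₄))
                    (sym (++-assoc R₁ (true ∷ []) (false ∷ true ∷ false ∷ tail₄)))))))
                onI (suc i₂) ei = onP₄ P₄ refl
                  where
                  I₂ = suc (suc i₂)
                  γP₂ : γ ≡ zeros I₂ ++ P ++ zeros I₂ ++ tail₄
                  γP₂ = trans γP (cong (λ l → zeros (suc l) ++ P ++ zeros (suc l) ++ tail₄) ei)
                  rotation : γ ~ zeros I₂ ++ tail₄ ++ zeros I₂ ++ P
                  rotation = subst₂ _~_ (sym (trans γP₂ (sym (++-assoc (zeros I₂) P (zeros I₂ ++ tail₄))))) (++-assoc (zeros I₂) tail₄ (zeros I₂ ++ P))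
                    (~-swap (zeros I₂ ++ P) (zeros I₂ ++ tail₄))
                  H₁ : ∀ V → P₄ ≡ V → ¬ zeros I₂ ++ P ≺ V ++ zeros I₂ ++ tail₄
                  H₁ V v q = necklace a rotation (subst ((zeros I₂ ++ tail₄ ++ zeros I₂ ++ P) ≺_)
                    (sym (trans γP₂ (cong (λ w → zeros I₂ ++ w ++ zeros I₂ ++ tail₄) (trans P₁ (cong (λ w → true ∷ false ∷ true ∷ true ∷ w) v)))))
                    (≺-prepend (zeros I₂) (later (later (later (later q))))))
                  H₂ : ∀ V → P₄ ≡ V → ¬ V ++ zeros I₂ ++ tail₄ ≺ false ∷ true ∷ zeros I ++ reverse (true ∷ true ∷ P₄)
                  H₂ V v q = Hy (subst₂ _≺_ (sym (trans (proj₂ (yl _ f)) (cong₂ (λ w l → true ∷ true ∷ w ++ zeros (suc l) ++ tail₄) v ei))) (sym (rev-y _ f)) (later (later q)))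
                  onP₄ : ∀ V → P₄ ≡ V → ⊥
                  onP₄ []                 v = H₂ [] v (later now)
                  onP₄ (true ∷ V)         v = H₁ _ v now
                  onP₄ (false ∷ [])       v = H₂ _ v (later now)
                  onP₄ (false ∷ false ∷ V) v = H₂ _ v (later now)
                  onP₄ (false ∷ true ∷ V) v = H₁ _ v (later now)

    lastZero-asymmetric : ¬ reverse (u ++ true ∷ ones t) ~ u ++ true ∷ ones t
    lastZero-asymmetric p with symmetric-split I {W′} {w₂ = X ++ ones t} refl
      (trans (cong (X ++_) (trans (sym (++-identityʳ _)) (sym (replicate-∷ʳ t [])))) (sym (++-assoc X (ones t) (true ∷ []))))
      (~-trans (~-reflexive (sym u≡)) (~-trans (~-sym p) (~-trans (~-reflexive (cong reverse u≡)) (reverse-zeros-++ I W′))))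
      where
      u≡ : u ++ true ∷ ones t ≡ zeros I ++ W′
      u≡ = ++-assoc (zeros I) X (true ∷ ones t)
    ... | inj₁ pal = case₁ pal
    ... | inj₂ (P , Q , e , pP , pQ) = Case₂.absurd P Q e pP pQ

    lastZero-bracelet : IsA (lastZero γ)
    lastZero-bracelet = subst IsA (sym (trans (cong lastZero γ≡) (lastZero-ones u t))) (lastZero-IsA u t (subst IsA γ≡ a) lastZero-asymmetric)

-- The parent map

length-firstOne : ∀ x → length (firstOne x) ≡ length x
length-firstOne []          = refl
length-firstOne (true ∷ x)  = refl
length-firstOne (false ∷ x) = cong suc (length-firstOne x)

length-flip : ∀ (u : Str) b c v → length (u ++ b ∷ v) ≡ length (u ++ c ∷ v)
length-flip u b c v = trans (length-++ u) (sym (length-++ u))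

tail₄ : Str
tail₄ = true ∷ false ∷ true ∷ true ∷ []

-- This is where n ≥ 6 enters: 0ⁿ⁻⁴ has at least two zeros, more than the single 0 inside 1011.
root-Block : ∀ m → Block (suc (suc m)) tail₄
root-Block m = record { start = _ , refl ; end = true ∷ false ∷ true ∷ [] , refl ; noZeros = go }
  where
  go : ∀ u v → tail₄ ≢ u ++ zeros (suc (suc m)) ++ v
  go [] v ()
  go (_ ∷ []) v ()
  go (_ ∷ _ ∷ []) v ()
  go (_ ∷ _ ∷ _ ∷ []) v ()
  go (_ ∷ _ ∷ _ ∷ _ ∷ []) v ()
  go (_ ∷ _ ∷ _ ∷ _ ∷ _ ∷ u) v ()

length-root : ∀ n → 6 ≤ n → length (root n) ≡ n
length-root n p = trans (length-++ (zeros (n ∸ 4))) (trans (cong (_+ 4) (length-replicate (n ∸ 4)))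
  (m∸n+n≡m (≤-trans (s≤s (s≤s (s≤s (s≤s z≤n)))) p)))

root-IsA : ∀ n → 6 ≤ n → IsA (root n)
root-IsA _ (s≤s (s≤s (s≤s (s≤s (s≤s (s≤s {n = m} z≤n)))))) = Block-IsA⁺ (root-Block m) (later now)

lz : Str → ℕ
lz (false ∷ x) = suc (lz x)
lz _           = 0

lz-zeros : ∀ i r → lz (zeros i ++ true ∷ r) ≡ i
lz-zeros zero    r = refl
lz-zeros (suc i) r = cong suc (lz-zeros i r)

lz≤length : ∀ x → lz x ≤ length x
lz≤length []          = z≤n
lz≤length (true ∷ x)  = z≤n
lz≤length (false ∷ x) = s≤s (lz≤length x)

weight-flip : ∀ u v → weight (u ++ true ∷ v) ≡ suc (weight (u ++ false ∷ v))
weight-flip u v = trans (weight-++ u (true ∷ v)) (trans (+-suc (weight u) (weight v)) (cong suc (sym (weight-++ u (false ∷ v)))))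

if-true : ∀ {A : Set} {b} {x y : A} → b ≡ true → (if b then x else y) ≡ x
if-true refl = refl

if-false : ∀ {A : Set} {b} {x y : A} → b ≡ false → (if b then x else y) ≡ y
if-false refl = refl

par-first : ∀ n γ → inA n (firstOne γ) ≡ true → par n γ ≡ firstOne γ
par-first n γ e = if-true e

par-last : ∀ n γ → inA n (firstOne γ) ≡ false → inA n (lastOne γ) ≡ true → par n γ ≡ lastOne γ
par-last n γ e f = trans (if-false e) (if-true f)

par-zero : ∀ n γ → inA n (firstOne γ) ≡ false → inA n (lastOne γ) ≡ false → par n γ ≡ lastZero γ
par-zero n γ e f = trans (if-false e) (if-false f)

module Parent (n : ℕ) {γ} (a : IsA γ) (len : length γ ≡ n) where
  open Shape (shape a)
  open LastZeroShape (lastZeroShape a)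
  open LastZero a using (t; I; u; γ≡; module NotFirstNotLast)

  -- The indices encode the edge from γ to its parent: `b ∷ x` is the rotation of γ with the flipped
  -- bit in front, and `not b ∷ x` is a rotation of the parent.
  data ParCase : Bool → Str → Set where
    byFirst : inA n (firstOne γ) ≡ true → par n γ ≡ firstOne γ → ParCase true ((zeros j ++ y) ++ zeros I)
    byLast  : inA n (firstOne γ) ≡ false → inA n (lastOne γ) ≡ true → par n γ ≡ lastOne γ → ParCase true (z⁻ a)
    byZero  : inA n (firstOne γ) ≡ false → inA n (lastOne γ) ≡ false → par n γ ≡ lastZero γ → ParCase false (ones t ++ u)

  parCase : Σ Bool λ b → Σ Str λ x → ParCase b x
  parCase = go (bool-cases (inA n (firstOne γ))) (bool-cases (inA n (lastOne γ)))
    where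
    go : inA n (firstOne γ) ≡ true ⊎ inA n (firstOne γ) ≡ false → inA n (lastOne γ) ≡ true ⊎ inA n (lastOne γ) ≡ false →
      Σ Bool λ b → Σ Str λ x → ParCase b x
    go (inj₁ e) _        = _ , _ , byFirst e (par-first n γ e)
    go (inj₂ e) (inj₁ f) = _ , _ , byLast e f (par-last n γ e f)
    go (inj₂ e) (inj₂ f) = _ , _ , byZero e f (par-zero n γ e f)

  lastZero≡ : lastZero γ ≡ u ++ true ∷ ones t
  lastZero≡ = trans (cong lastZero γ≡) (lastZero-ones u t)

  lastOne≡ : lastOne γ ≡ zeros (I + suc k) ++ z
  lastOne≡ = trans (lastOne-shape a) (neck-unique (zeros-z~ a) (Block-necklace blockᶻ))

  first-~ : ∀ c → c ∷ (zeros j ++ y) ++ zeros I ~ zeros I ++ c ∷ zeros j ++ y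
  first-~ c = ~-∷-++ c (zeros I) (zeros j ++ y)

  edge-child : ∀ {b x} → ParCase b x → b ∷ x ~ γ
  edge-child (byFirst _ _)  = ~-trans (first-~ true) (~-reflexive (sym eqʸ))
  edge-child (byLast _ _ _) = ~-trans (~-swap (true ∷ []) (z⁻ a)) (~-reflexive (sym (snoc-shape a)))
  edge-child (byZero _ _ _) = ~-trans (~-∷-++ false u (ones t)) (~-reflexive (sym γ≡))

  edge-parent : ∀ {b x} → ParCase b x → not b ∷ x ~ par n γ
  edge-parent (byFirst _ e)  = ~-trans (first-~ false) (~-reflexive (sym (trans e (trans (cong firstOne eqʸ) (firstOne-zeros I (zeros j ++ y))))))
  edge-parent (byLast _ _ e) = ~-trans (~-swap (false ∷ []) (z⁻ a)) (~-trans (neck-~ _) (~-reflexive (sym (trans e (lastOne-shape a)))))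
  edge-parent (byZero _ _ e) = ~-trans (~-∷-++ true u (ones t)) (~-reflexive (sym (trans e lastZero≡)))

  edge-unique : ∀ {b x b′ x′} → ParCase b x → b′ ∷ x′ ~ γ → not b′ ∷ x′ ~ par n γ → b′ ≡ b × x′ ≡ x
  edge-unique {true}  {b′ = true} (byFirst _ e)  p q = refl , unique-firstOne a p (~-trans q (~-reflexive e))
  edge-unique {true}  {b′ = true} (byLast _ _ e) p q = refl , unique-lastOne a p
    (~-trans q (~-trans (~-reflexive (trans e (lastOne-shape a))) (~-sym (neck-~ _))))
  edge-unique {false} {b′ = false} (byZero _ _ e) p q = refl , unique-lastZero a u t γ≡ p (~-trans q (~-reflexive (trans e lastZero≡)))
  -- Opposite directions contradict each other by counting ones: one pair makes the parent lighter
  -- than γ, the other heavier.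
  edge-unique {true}  {x} {false} {x′} c p q = ⊥-elim (<-irrefl refl
    (≤-trans (≤-reflexive (weight-~ (~-trans (edge-child c) (~-sym p)))) (≤-trans (n≤1+n (weight x′)) (≤-reflexive (weight-~ (~-trans q (~-sym (edge-parent c))))))))
  edge-unique {false} {x} {true} {x′} c p q = ⊥-elim (<-irrefl refl
    (≤-trans (≤-reflexive (weight-~ (~-trans (edge-parent c) (~-sym q)))) (≤-trans (n≤1+n (weight x′)) (≤-reflexive (weight-~ (~-trans p (~-sym (edge-child c))))))))

  edge⁻ : ∀ {b x} → b ∷ x ~ γ → not b ∷ x ~ par n γ → ParCase b x
  edge⁻ {b} {x} p q = subst₂ ParCase (sym (proj₁ same)) (sym (proj₂ same)) (proj₂ (proj₂ parCase))
    where
    same : b ≡ proj₁ parCase × x ≡ proj₁ (proj₂ parCase)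
    same = edge-unique (proj₂ (proj₂ parCase)) p q

  length-par : length (par n γ) ≡ n
  length-par = trans (sym (~-length (edge-parent c))) (trans (~-length (edge-child c)) len)
    where c = proj₂ (proj₂ parCase)

  par-IsA : γ ≢ root n → IsA (par n γ)
  par-IsA γ≢root = go (proj₂ (proj₂ parCase))
    where
    pos : 0 < n
    pos = subst (0 <_) (trans (cong length (sym eqʸ)) len) (s≤s z≤n)
    go : ∀ {b x} → ParCase b x → IsA (par n γ)
    go (byFirst e f)  = subst IsA (sym f) (proj₂ (inA⁻ pos e))
    go (byLast _ e f) = subst IsA (sym f) (proj₂ (inA⁻ pos e))
    go (byZero e₁ e₂ f) = subst IsA (sym f) (NotFirstNotLast.lastZero-bracelet
      (λ y≺ → true≢false (inA⁺ (trans (length-firstOne γ) len) (subst IsA (sym (firstOne-shape a)) (Block-IsA⁺ blockʸ y≺))) e₁)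
      (λ z≺ → true≢false (inA⁺ len-lastOne (subst IsA (sym lastOne≡) (Block-IsA⁺ blockᶻ z≺))) e₂)
      not-root)
      where
      len-lastOne : length (lastOne γ) ≡ n
      len-lastOne = trans (cong length (lastOne-shape a)) (trans (length-neck (z⁻ a ++ false ∷ []))
        (trans (length-flip (z⁻ a) false true []) (trans (cong length (sym (snoc-shape a))) len)))
      not-root : ∀ m → γ ≢ zeros m ++ tail₄
      not-root m e = γ≢root (trans e (cong (λ l → zeros l ++ tail₄) m≡))
        where
        m≡ : m ≡ n ∸ 4
        m≡ = trans (sym (m+n∸n≡m m 4)) (cong (_∸ 4) (trans (cong (_+ 4) (sym (length-replicate m)))
          (trans (sym (length-++ (zeros m))) (trans (cong length (sym e)) len))))

  -- If u 1 1ᵗ = p q = q p properly, then u 0 1ᵗ has a smaller rotation.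
  lastZero-primitive : Primitive (u ++ true ∷ ones t)
  lastZero-primitive []      q       e f = inj₁ refl
  lastZero-primitive (c ∷ p) []      e f = inj₂ refl
  lastZero-primitive (c ∷ p) (d ∷ q) e f with ++-split u (c ∷ p) e
  ... | inj₁ (e₁ , _ , h) with replicate-split (suc t) true e₁ (d ∷ q) h
  ...   | _ , g , _ with trans (sym (∷-injectiveˡ g)) (∷-injectiveˡ f)
  ...     | ()
  lastZero-primitive (c ∷ p) (d ∷ q) e f | inj₂ (d′ , e₁ , h , g)
    with ++-split u (d′ ∷ e₁) (trans (sym f) (trans (cong (_++ c ∷ p) g) (++-assoc (d′ ∷ e₁) (true ∷ ones t) (c ∷ p))))
  ... | inj₁ (e₂ , h′ , _) = ⊥-elim (<-irrefl (cong length (trans h′ (cong (_++ e₂) h)))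
          (subst (length (d′ ∷ e₁) <_) (sym (trans (cong length (++-assoc (c ∷ p) (d′ ∷ e₁) e₂)) (length-++ (c ∷ p))))
            (s≤s (≤-trans (subst (length (d′ ∷ e₁) ≤_) (sym (length-++ (d′ ∷ e₁))) (m≤m+n _ _)) (m≤n+m _ (length p))))))
  ... | inj₂ (x , e₂ , h′ , g′) with ∷-injectiveˡ g′
  ...   | refl = ⊥-elim (necklace (subst IsA γ≡ a) rotation smaller)
    where
    V = d′ ∷ e₁
    rotation : u ++ false ∷ ones t ~ (V ++ false ∷ ones t) ++ c ∷ p
    rotation = subst (_~ (V ++ false ∷ ones t) ++ c ∷ p)
      (trans (sym (++-assoc (c ∷ p) V (false ∷ ones t))) (cong (_++ false ∷ ones t) (sym h))) (~-swap (c ∷ p) (V ++ false ∷ ones t))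
    smaller : (V ++ false ∷ ones t) ++ c ∷ p ≺ u ++ false ∷ ones t
    smaller = subst₂ _≺_ (sym (++-assoc V (false ∷ ones t) (c ∷ p)))
      (trans (sym (++-assoc V (true ∷ e₂) (false ∷ ones t))) (cong (_++ false ∷ ones t) (sym h′))) (≺-prepend V now)

  -- This is what makes it safe to end the tree at periodic labels: no string of A(n) other than the
  -- root has a periodic parent.
  par-primitive : Primitive (par n γ)
  par-primitive = go (proj₂ (proj₂ parCase))
    where
    go : ∀ {b x} → ParCase b x → Primitive (par n γ)
    go (byFirst _ e)  = subst Primitive (sym (trans e (firstOne-shape a))) (Block-primitive blockʸ)
    go (byLast _ _ e) = subst Primitive (sym (trans e lastOne≡)) (Block-primitive blockᶻ)
    go (byZero _ _ e) = subst Primitive (sym (trans e lastZero≡)) lastZero-primitive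

-- The first two parent operations lengthen the initial run of zeros; the third
-- one keeps it and adds a one.
μ : ℕ → Str → ℕ
μ n γ = lz γ * suc n + weight γ

μ-bound : ∀ n γ → length γ ≡ n → μ n γ < suc n * suc n
μ-bound n γ refl = begin-strict
  lz γ * suc n + weight γ ≤⟨ +-mono-≤ (*-monoˡ-≤ (suc n) (lz≤length γ)) (weight≤length γ) ⟩
  n * suc n + n           <⟨ n<1+n _ ⟩
  suc (n * suc n + n)     ≡⟨ +-comm (suc (n * suc n)) n ⟩
  n + suc (n * suc n)     ≡⟨ +-suc n (n * suc n) ⟩
  suc n * suc n ∎
  where open ≤-Reasoning

module _ (n : ℕ) {γ} (a : IsA γ) (len : length γ ≡ n) where
  open Shape (shape a)
  open LastZeroShape (lastZeroShape a)
  open LastZero a using (t; I; u; γ≡)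
  open Parent n a len

  μ-par : μ n γ < μ n (par n γ)
  μ-par = go (proj₂ (proj₂ parCase))
    where
    lzγ : lz γ ≡ I
    lzγ = trans (cong lz eqʸ) (lz-zeros I (zeros j ++ y))
    lz-Block : ∀ {M y} → Block M y → lz (zeros M ++ y) ≡ M
    lz-Block {M} B = trans (cong (λ w → lz (zeros M ++ w)) (proj₂ (start B))) (lz-zeros M _)
    longer : ∀ M β → lz β ≡ I + suc M → μ n γ < μ n β
    longer M β e = begin-strict
      lz γ * suc n + weight γ ≡⟨ cong (λ l → l * suc n + weight γ) lzγ ⟩
      I * suc n + weight γ    <⟨ +-monoʳ-< (I * suc n) (s≤s (≤-trans (weight≤length γ) (≤-reflexive len))) ⟩
      I * suc n + suc n       ≡⟨ +-comm (I * suc n) (suc n) ⟩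
      suc I * suc n           ≤⟨ *-monoˡ-≤ (suc n) (subst (suc I ≤_) (sym (+-suc I M)) (m≤m+n (suc I) M)) ⟩
      (I + suc M) * suc n     ≤⟨ m≤m+n _ (weight β) ⟩
      (I + suc M) * suc n + weight β ≡⟨ cong (λ l → l * suc n + weight β) (sym e) ⟩
      lz β * suc n + weight β ∎
      where open ≤-Reasoning
    go : ∀ {b x} → ParCase b x → μ n γ < μ n (par n γ)
    go (byFirst _ e)  = longer j (par n γ) (trans (cong lz (trans e (firstOne-shape a))) (lz-Block blockʸ))
    go (byLast _ _ e) = longer k (par n γ) (trans (cong lz (trans e lastOne≡)) (lz-Block blockᶻ))
    go (byZero _ _ e) = subst₂ _<_ (cong (λ l → l * suc n + weight γ) (sym lzγ)) (cong (λ l → l * suc n + weight (par n γ)) (sym lz-par))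
      (+-monoʳ-< (I * suc n) (≤-reflexive (trans (cong (λ w → suc (weight w)) γ≡) (trans (sym (weight-flip u (ones t))) (cong weight (sym par≡))))))
      where
      par≡ : par n γ ≡ u ++ true ∷ ones t
      par≡ = trans e lastZero≡
      lz-par : lz (par n γ) ≡ I
      lz-par = trans (cong lz (trans par≡ (++-assoc (zeros I) (true ∷ Y) (true ∷ ones t)))) (lz-zeros I _)

-- The successor rule

-- The conjugate pair {0x, 1x} joins the necklace of b x to its parent.
record Edge (n : ℕ) (b : Bool) (x : Str) : Set where
  constructor edge
  field
    child∈A : inA n (neck (b ∷ x)) ≡ true
    child≢root : neck (b ∷ x) ≢ root n
    parent≡ : par n (neck (b ∷ x)) ≡ neck (not b ∷ x)
open Edge public

∨-true⁻ : ∀ {a b} → a ∨ b ≡ true → a ≡ true ⊎ b ≡ true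
∨-true⁻ {true}  _ = inj₁ refl
∨-true⁻ {false} e = inj₂ e

∨-trueʳ : ∀ a {b} → b ≡ true → a ∨ b ≡ true
∨-trueʳ true  _ = refl
∨-trueʳ false e = e

largestOneIdx-zeros : ∀ k → largestOneIdx (zeros k) ≡ 0
largestOneIdx-zeros zero    = refl
largestOneIdx-zeros (suc k) rewrite largestOneIdx-zeros k = refl

largestOneIdx-snoc : ∀ u k → largestOneIdx (u ++ true ∷ zeros k) ≡ suc (length u)
largestOneIdx-snoc []      k rewrite largestOneIdx-zeros k = refl
largestOneIdx-snoc (b ∷ u) k rewrite largestOneIdx-snoc u k = refl

leadingOnes-split : ∀ x → x ≡ ones (leadingOnes x) ++ drop (leadingOnes x) x
leadingOnes-split []          = refl
leadingOnes-split (true ∷ x)  = cong (true ∷_) (leadingOnes-split x)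
leadingOnes-split (false ∷ x) = refl

leadingOnes-ones : ∀ t v → leadingOnes (ones t ++ false ∷ v) ≡ t
leadingOnes-ones zero    v = refl
leadingOnes-ones (suc t) v = cong suc (leadingOnes-ones t v)

¬IsA-~ : ∀ {w γ} → w ~ γ → reverse w ~ w → ¬ IsA γ
¬IsA-~ p s = ¬IsA-sym (~-trans (~-reverse (~-sym p)) (~-trans s p))

zeros-palindrome-sym : ∀ M w → Palindrome w → reverse (zeros M ++ w) ~ zeros M ++ w
zeros-palindrome-sym M w e = ~-trans (reverse-zeros-++ M w) (~-reflexive (cong (zeros M ++_) e))

module _ (n : ℕ) (6≤n : 6 ≤ n) where

  n>0 : 0 < n
  n>0 = ≤-trans (s≤s z≤n) 6≤n

  M : ℕ
  M = n ∸ 4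

  -- The tests in `g` have to fail at the root, which has no parent. They do because the three
  -- operations turn it into rotations of zeros followed by a palindrome: 11 for FirstOne, 101 for
  -- LastOne and 1111 for LastZero.
  root-firstOne : inA n (firstOne (root n)) ≡ false
  root-firstOne = ≢true⇒false λ e → ¬IsA-~ (~-reflexive (sym eq)) (zeros-palindrome-sym (suc (suc M)) (true ∷ true ∷ []) refl) (proj₂ (inA⁻ n>0 e))
    where
    eq : firstOne (root n) ≡ zeros (suc (suc M)) ++ true ∷ true ∷ []
    eq = trans (firstOne-zeros M _) (trans (replicate-∷ʳ M _) (cong (false ∷_) (replicate-∷ʳ M _)))

  flipped-root-symmetric : ∀ {γ} → zeros M ++ true ∷ false ∷ true ∷ false ∷ [] ~ γ → ¬ IsA γ
  flipped-root-symmetric p = ¬IsA-~ (~-trans (~-swap (false ∷ zeros M) (true ∷ false ∷ true ∷ []))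
      (~-trans (subst (true ∷ false ∷ true ∷ false ∷ zeros M ~_) refl (~-swap (true ∷ false ∷ true ∷ false ∷ []) (zeros M))) p))
    (zeros-palindrome-sym (suc M) (true ∷ false ∷ true ∷ []) refl)

  root-lastOne : inA n (lastOne (root n)) ≡ false
  root-lastOne = ≢true⇒false λ e → flipped-root-symmetric (~-trans (neck-~ _) (~-reflexive (sym eq))) (proj₂ (inA⁻ n>0 e))
    where
    eq : lastOne (root n) ≡ neck (zeros M ++ true ∷ false ∷ true ∷ false ∷ [])
    eq = trans (cong lastOne (sym (++-assoc (zeros M) (true ∷ false ∷ true ∷ []) (true ∷ []))))
      (trans (lastOne-snoc (zeros M ++ true ∷ false ∷ true ∷ []) true) (cong neck (++-assoc (zeros M) (true ∷ false ∷ true ∷ []) (false ∷ []))))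

  root-lastZero : inA n (lastZero (root n)) ≡ false
  root-lastZero = ≢true⇒false λ e → ¬IsA-~ (~-reflexive (sym eq)) (zeros-palindrome-sym M (ones 4) refl) (proj₂ (inA⁻ n>0 e))
    where
    eq : lastZero (root n) ≡ zeros M ++ ones 4
    eq = trans (cong lastZero (sym (++-assoc (zeros M) (true ∷ []) (false ∷ ones 2))))
      (trans (lastZero-ones (zeros M ++ true ∷ []) 2) (++-assoc (zeros M) (true ∷ []) (true ∷ ones 2)))

  module _ (a : Bool) (x : Str) where
    private
      idx = largestOneIdx (a ∷ x)
      l = leadingOnes x
    β₁ β₂ β₃ : Str
    β₁ = zeros (n ∸ idx) ++ true ∷ take (idx ∸ 1) x
    β₂ = x ++ true ∷ []
    β₃ = drop l x ++ false ∷ ones l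

    c₁ c₂ c₃ flips : Bool
    c₁ = inA n β₁ ∧ inA n (firstOne β₁)
    c₂ = inA n β₂ ∧ inA n (lastOne β₂) ∧ not (inA n (firstOne β₂))
    c₃ = inA n β₃ ∧ inA n (lastZero β₃) ∧ not (inA n (firstOne β₃)) ∧ not (inA n (lastOne β₃))
    flips = c₁ ∨ c₂ ∨ c₃

    g-unfold : g n (a ∷ x) ≡ (if flips then not a else a)
    g-unfold = refl

    c₁⇒edge : suc (length x) ≡ n → c₁ ≡ true → Edge n true x
    c₁⇒edge len e = go (spanʳ false (a ∷ x))
      where
      e₁ : inA n β₁ ≡ true
      e₁ = proj₁ (∧-true⁻ e)
      e₂ : inA n (firstOne β₁) ≡ true
      e₂ = proj₂ (∧-true⁻ {inA n β₁} e)
      go : (Σ ℕ λ k → a ∷ x ≡ zeros k) ⊎ (Σ ℕ λ k → Σ Str λ r → a ∷ x ≡ r ++ true ∷ zeros k) → Edge n true x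
      -- An all-zero window gets the default index 0, and β₁ then has n + 1 letters.
      go (inj₁ (k , f)) = ⊥-elim (1+n≢n (trans (sym (trans (cong length β₁≡) (trans (length-++ (zeros n)) (trans (+-comm (length (zeros n)) 1) (cong suc (length-replicate n))))))
            (proj₁ (inA⁻ {γ = β₁} n>0 e₁))))
        where
        β₁≡ : β₁ ≡ zeros n ++ true ∷ []
        β₁≡ rewrite trans (cong largestOneIdx f) (largestOneIdx-zeros k) = refl
      go (inj₂ (k , r , f)) = edge (trans (cong (inA n) neck₁) e₁)
          (λ q → true≢false (trans (cong (λ w → inA n (firstOne w)) (sym (trans (sym neck₁) q))) e₂) root-firstOne)
          (trans (cong (par n) neck₁) (trans par₁ (sym neck₀)))
        where
        V = take (length r) x
        idx≡ : idx ≡ suc (length r)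
        idx≡ = trans (cong largestOneIdx f) (largestOneIdx-snoc r k)
        n≡ : n ≡ suc (length r) + k
        n≡ = trans (sym len) (trans (cong length f) (trans (length-++ r) (trans (+-suc (length r) _) (cong (λ m → suc (length r + m)) (length-replicate k)))))
        β₁≡ : β₁ ≡ zeros k ++ true ∷ V
        β₁≡ = trans (cong (λ i → zeros (n ∸ i) ++ true ∷ take (i ∸ 1) x) idx≡)
          (cong (λ m → zeros m ++ true ∷ V) (trans (cong (_∸ suc (length r)) n≡) (m+n∸m≡n (suc (length r)) k)))
        xr : ∀ r → a ∷ x ≡ r ++ true ∷ zeros k → x ≡ take (length r) x ++ zeros k
        xr []      h = ∷-injectiveʳ h
        xr (c ∷ r) h = trans x≡ (cong (_++ zeros k) (sym (trans (cong₂ take (trans (+-comm 1 (length r)) (sym (length-++ r))) x≡) (take-++ (r ++ true ∷ []) (zeros k)))))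
          where
          x≡ : x ≡ (r ++ true ∷ []) ++ zeros k
          x≡ = trans (∷-injectiveʳ h) (sym (++-assoc r (true ∷ []) (zeros k)))
        rot₁ : ∀ c → c ∷ x ~ zeros k ++ c ∷ V
        rot₁ c = ~-trans (~-reflexive (cong (c ∷_) (xr r f))) (~-∷-++ c (zeros k) V)
        neck₁ : neck (true ∷ x) ≡ β₁
        neck₁ = neck-unique (~-trans (rot₁ true) (~-reflexive (sym β₁≡))) (necklace (proj₂ (inA⁻ n>0 e₁)))
        par₁ : par n β₁ ≡ firstOne β₁
        par₁ = par-first n β₁ e₂
        neck₀ : neck (false ∷ x) ≡ firstOne β₁
        neck₀ = neck-unique (~-trans (rot₁ false) (~-reflexive (sym (trans (cong firstOne β₁≡) (firstOne-zeros k V))))) (necklace (proj₂ (inA⁻ n>0 e₂)))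

    c₂⇒edge : c₂ ≡ true → Edge n true x
    c₂⇒edge e = edge (trans (cong (inA n) neck₁) e₁)
          (λ q → true≢false (trans (cong (λ w → inA n (lastOne w)) (sym (trans (sym neck₁) q))) e₂) root-lastOne)
          (trans (cong (par n) neck₁) (trans par₂ (trans (lastOne-snoc x true) (neck-cong (~-swap x (false ∷ []))))))
      where
      e₁ : inA n β₂ ≡ true
      e₁ = proj₁ (∧-true⁻ e)
      e₂ : inA n (lastOne β₂) ≡ true
      e₂ = proj₁ (∧-true⁻ (proj₂ (∧-true⁻ {inA n β₂} e)))
      e₃ : inA n (firstOne β₂) ≡ false
      e₃ = not-true⁻ (proj₂ (∧-true⁻ {inA n (lastOne β₂)} (proj₂ (∧-true⁻ {inA n β₂} e))))
      neck₁ : neck (true ∷ x) ≡ β₂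
      neck₁ = neck-unique (~-swap (true ∷ []) x) (necklace (proj₂ (inA⁻ n>0 e₁)))
      par₂ : par n β₂ ≡ lastOne β₂
      par₂ = par-last n β₂ e₃ e₂

    c₃⇒edge : c₃ ≡ true → Edge n false x
    c₃⇒edge e = edge (trans (cong (inA n) neck₀) e₁)
          (λ q → true≢false (trans (cong (λ w → inA n (lastZero w)) (sym (trans (sym neck₀) q))) e₂) root-lastZero)
          (trans (cong (par n) neck₀) (trans par₃ (sym neck₁)))
      where
      e₁ : inA n β₃ ≡ true
      e₁ = proj₁ (∧-true⁻ e)
      e′ : inA n (lastZero β₃) ∧ not (inA n (firstOne β₃)) ∧ not (inA n (lastOne β₃)) ≡ true
      e′ = proj₂ (∧-true⁻ {inA n β₃} e)
      e₂ : inA n (lastZero β₃) ≡ true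
      e₂ = proj₁ (∧-true⁻ e′)
      e₃ : inA n (firstOne β₃) ≡ false
      e₃ = not-true⁻ (proj₁ (∧-true⁻ (proj₂ (∧-true⁻ {inA n (lastZero β₃)} e′))))
      e₄ : inA n (lastOne β₃) ≡ false
      e₄ = not-true⁻ (proj₂ (∧-true⁻ {not (inA n (firstOne β₃))} (proj₂ (∧-true⁻ {inA n (lastZero β₃)} e′))))
      rot₃ : ∀ c → c ∷ x ~ drop l x ++ c ∷ ones l
      rot₃ c = ~-trans (~-reflexive (cong (c ∷_) (leadingOnes-split x))) (~-∷-++ c (drop l x) (ones l))
      neck₀ : neck (false ∷ x) ≡ β₃
      neck₀ = neck-unique (rot₃ false) (necklace (proj₂ (inA⁻ n>0 e₁)))
      neck₁ : neck (true ∷ x) ≡ lastZero β₃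
      neck₁ = neck-unique (~-trans (rot₃ true) (~-reflexive (sym (lastZero-ones (drop l x) l)))) (necklace (proj₂ (inA⁻ n>0 e₂)))
      par₃ : par n β₃ ≡ lastZero β₃
      par₃ = par-zero n β₃ e₃ e₄

  module _ {γ} (A : IsA γ) (len : length γ ≡ n) where
    open Shape (shape A)
    open LastZeroShape (lastZeroShape A)
    open LastZero A using (t; I; u; γ≡)
    open Parent n A len

    -- In each case `x` is γ without the flipped bit, read cyclically from behind that bit; the β
    -- belonging to the case turns it back and recovers γ, whatever `a` is.
    parCase⇒flips : γ ≢ root n → ∀ {b x} → ParCase b x → ∀ a → flips a x ≡ true
    parCase⇒flips _ (byFirst e f) a = cong (_∨ (c₂ a x ∨ c₃ a x)) (∧-true⁺ (trans (cong (inA n) β₁≡) (inA⁺ len A)) (trans (cong (λ w → inA n (firstOne w)) β₁≡) e))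
      where
      x = (zeros j ++ y) ++ zeros I
      y₂ = proj₁ (end blockʸ)
      x≡ : a ∷ x ≡ (a ∷ zeros j ++ y₂) ++ true ∷ zeros I
      x≡ = cong (a ∷_) (trans (cong (λ w → (zeros j ++ w) ++ zeros I) (proj₂ (end blockʸ)))
        (trans (cong (_++ zeros I) (sym (++-assoc (zeros j) y₂ (true ∷ [])))) (++-assoc (zeros j ++ y₂) (true ∷ []) (zeros I))))
      ly : length (zeros j ++ y) ≡ suc (length (zeros j ++ y₂))
      ly = trans (cong (λ w → length (zeros j ++ w)) (proj₂ (end blockʸ))) (trans (cong length (sym (++-assoc (zeros j) y₂ (true ∷ []))))
        (trans (length-++ (zeros j ++ y₂)) (+-comm (length (zeros j ++ y₂)) 1)))
      idx≡ : largestOneIdx (a ∷ x) ≡ suc (length (zeros j ++ y))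
      idx≡ = trans (cong largestOneIdx x≡) (trans (largestOneIdx-snoc (a ∷ zeros j ++ y₂) I) (cong suc (sym ly)))
      n∸ : n ∸ suc (length (zeros j ++ y)) ≡ I
      n∸ = trans (cong (_∸ suc (length (zeros j ++ y))) (trans (sym len) (trans (cong length eqʸ) (trans (length-++ (zeros I)) (cong (_+ suc (length (zeros j ++ y))) (length-replicate I))))))
        (m+n∸n≡m I (suc (length (zeros j ++ y))))
      β₁≡ : β₁ a x ≡ γ
      β₁≡ = trans (cong (λ i → zeros (n ∸ i) ++ true ∷ take (i ∸ 1) x) idx≡) (trans (cong₂ (λ m w → zeros m ++ true ∷ w) n∸ (take-++ (zeros j ++ y) (zeros I))) (sym eqʸ))
    parCase⇒flips _ (byLast e f h) a = ∨-trueʳ (c₁ a x) (cong (_∨ c₃ a x) (∧-true⁺ (trans (cong (inA n) β₂≡) (inA⁺ len A))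
        (∧-true⁺ (trans (cong (λ w → inA n (lastOne w)) β₂≡) f) (cong not (trans (cong (λ w → inA n (firstOne w)) β₂≡) e)))))
      where
      x = z⁻ A
      β₂≡ : β₂ a x ≡ γ
      β₂≡ = sym (snoc-shape A)
    parCase⇒flips γ≢root (byZero e f h) a = ∨-trueʳ (c₁ a x) (∨-trueʳ (c₂ a x) (∧-true⁺ (trans (cong (inA n) β₃≡) (inA⁺ len A))
        (∧-true⁺ (trans (cong (λ w → inA n (lastZero w)) β₃≡) (trans (cong (inA n) (sym h)) (inA⁺ length-par (par-IsA γ≢root))))
        (∧-true⁺ (cong not (trans (cong (λ w → inA n (firstOne w)) β₃≡) e)) (cong not (trans (cong (λ w → inA n (lastOne w)) β₃≡) f))))))
      where
      x = ones t ++ u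
      l≡ : leadingOnes x ≡ t
      l≡ = leadingOnes-ones t _
      β₃≡ : β₃ a x ≡ γ
      β₃≡ = trans (cong (λ l → drop l x ++ false ∷ ones l) l≡) (trans (cong (_++ false ∷ ones t)
        (trans (cong (λ l → drop l x) (sym (length-replicate t))) (drop-++ (ones t) u))) (sym γ≡))

  edge-IsA : ∀ {b x} → Edge n b x → IsA (neck (b ∷ x))
  edge-IsA E = proj₂ (inA⁻ n>0 (child∈A E))

  edge-length : ∀ {b x} → Edge n b x → length (neck (b ∷ x)) ≡ n
  edge-length {b} {x} E = proj₁ (inA⁻ {γ = neck (b ∷ x)} n>0 (child∈A E))

  edge-parCase : ∀ {b x} (E : Edge n b x) → Parent.ParCase n (edge-IsA E) (edge-length E) b x
  edge-parCase {b} {x} E = Parent.edge⁻ n (edge-IsA E) (edge-length E) (neck-~ (b ∷ x))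
    (~-trans (neck-~ (not b ∷ x)) (~-reflexive (sym (parent≡ E))))

  g-flip : ∀ {b x} → Edge n b x → ∀ a → g n (a ∷ x) ≡ not a
  g-flip {b} {x} E a = trans (g-unfold a x) (cong (if_then not a else a)
    (parCase⇒flips (edge-IsA E) (edge-length E) (child≢root E) (edge-parCase E) a))

  g-keep : ∀ {x} → suc (length x) ≡ n → ¬ Edge n true x → ¬ Edge n false x → ∀ a → g n (a ∷ x) ≡ a
  g-keep {x} len ¬E₁ ¬E₀ a = trans (g-unfold a x) (cong (if_then not a else a) (≢true⇒false no-flip))
    where
    no-flip : flips a x ≢ true
    no-flip e = [ (λ e₁ → ¬E₁ (c₁⇒edge a x len e₁)) , (λ e′ →
      [ (λ e₂ → ¬E₁ (c₂⇒edge a x e₂)) , (λ e₃ → ¬E₀ (c₃⇒edge a x e₃)) ]′ (∨-true⁻ {c₂ a x} e′)) ]′ (∨-true⁻ {c₁ a x} e)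

  Edge-unique : ∀ {b x b′ x′} → Edge n b x → Edge n b′ x′ → neck (b ∷ x) ≡ neck (b′ ∷ x′) → b′ ≡ b × x′ ≡ x
  Edge-unique {b} {x} {b′} {x′} E E′ e = Parent.edge-unique n (edge-IsA E) (edge-length E) (edge-parCase E)
    (~-trans (neck-~ (b′ ∷ x′)) (~-reflexive (sym e)))
    (~-trans (neck-~ (not b′ ∷ x′)) (~-reflexive (trans (sym (parent≡ E′)) (cong (par n) (sym e)))))

-- Periods

rotate-* : ∀ q {k α} → rotate k α ≡ α → rotate (q * k) α ≡ α
rotate-* zero    e = refl
rotate-* (suc q) {k} {α} e = trans (rotate-+ k (q * k) α) (trans (cong (rotate (q * k)) e) (rotate-* q e))

-- Euclid's algorithm: n and k are periods of the rotation, hence so is n mod k, and the descent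
-- stops at a divisor of n.
period-divisor : ∀ {α} k → 0 < k → rotate k α ≡ α →
  Σ ℕ λ d → Σ ℕ λ t → 0 < d × d ≤ k × length α ≡ t * d × rotate d α ≡ α
period-divisor {α} = <-rec _ go
  where
  n = length α
  Goal : ℕ → Set
  Goal k = 0 < k → rotate k α ≡ α → Σ ℕ λ d → Σ ℕ λ t → 0 < d × d ≤ k × n ≡ t * d × rotate d α ≡ α
  go : ∀ k → (∀ {r} → r < k → Goal r) → Goal k
  go (suc k) rec pos e with n % suc k in eq
  ... | zero  = suc k , n / suc k , pos , ≤-refl , trans (m≡m%n+[m/n]*n n (suc k)) (cong (_+ n / suc k * suc k) eq) , e
  ... | suc r with rec r<k (s≤s z≤n) per
    where
    r<k : suc r < suc k
    r<k = subst (_< suc k) eq (m%n<n n (suc k))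
    q = n / suc k
    per : rotate (suc r) α ≡ α
    per = begin
      rotate (suc r) α ≡⟨ cong (rotate (suc r)) (sym (rotate-* q e)) ⟩
      rotate (suc r) (rotate (q * suc k) α) ≡⟨ sym (rotate-+ (q * suc k) (suc r) α) ⟩
      rotate (q * suc k + suc r) α ≡⟨ cong (λ m → rotate m α) (trans (+-comm (q * suc k) (suc r)) (sym (trans (m≡m%n+[m/n]*n n (suc k)) (cong (_+ q * suc k) eq)))) ⟩
      rotate n α ≡⟨ rotate-length α ⟩
      α ∎
      where open ≡-Reasoning
  ...   | d , t , d>0 , d≤r , n≡ , ed = d , t , d>0 , ≤-trans d≤r (<⇒≤ (subst (_< suc k) eq (m%n<n n (suc k)))) , n≡ , ed

applyUpTo-pow : ∀ (f : ℕ → Bool) d t → (∀ x → f (d + x) ≡ f x) → applyUpTo f (t * d) ≡ pow (applyUpTo f d) t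
applyUpTo-pow f d zero    per = refl
applyUpTo-pow f d (suc t) per = trans (applyUpTo-++ f d (t * d)) (cong (applyUpTo f d ++_)
  (trans (applyUpTo-cong (t * d) (λ {x} _ → per x)) (applyUpTo-pow f d t per)))

bit-period : ∀ {α d} → rotate d α ≡ α → ∀ x → bit α (d + x) ≡ bit α x
bit-period {α} {d} e x = trans (sym (bit-rotate d α x)) (cong (λ w → bit w x) e)

period⇒pow : ∀ {α} d t → 0 < t → length α ≡ t * d → rotate d α ≡ α → pow (take d α) t ≡ α
period⇒pow {α} d (suc t) _ n≡ e = begin
  pow (take d α) (suc t) ≡⟨ cong (λ w → pow w (suc t)) (take-bit α d (subst (d ≤_) (sym n≡) (m≤m+n d (t * d)))) ⟩
  pow (applyUpTo (bit α) d) (suc t) ≡⟨ sym (applyUpTo-pow (bit α) d (suc t) (bit-period {α} {d} e)) ⟩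
  applyUpTo (bit α) (suc t * d) ≡⟨ cong (applyUpTo (bit α)) (sym n≡) ⟩
  applyUpTo (bit α) (length α) ≡⟨ sym (bits α) ⟩
  α ∎
  where open ≡-Reasoning

pow-comm : ∀ γ t → pow γ t ++ γ ≡ γ ++ pow γ t
pow-comm γ zero    = sym (++-identityʳ γ)
pow-comm γ (suc t) = trans (++-assoc γ (pow γ t) γ) (cong (γ ++_) (pow-comm γ t))

pow⇒period : ∀ γ t → rotate (length γ) (pow γ (suc t)) ≡ pow γ (suc t)
pow⇒period γ t = trans (rotate-++ γ (pow γ t)) (pow-comm γ t)

length-pow : ∀ γ t → length (pow γ t) ≡ t * length γ
length-pow γ zero    = refl
length-pow γ (suc t) = trans (length-++ γ) (cong (length γ +_) (length-pow γ t))

∈-oneTo⁺ : ∀ {k n} → 0 < k → k ≤ n → k ∈ oneTo n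
∈-oneTo⁺ {suc k} _ p = ∈-map⁺ suc (∈-upTo⁺ p)

∈-oneTo⁻ : ∀ {k n} → k ∈ oneTo n → 0 < k × k ≤ n
∈-oneTo⁻ m with ∈-map⁻ suc m
... | k , p , refl = s≤s z≤n , ∈-upTo⁻ p

Aperiodic : Str → Set
Aperiodic α = ∀ k → 0 < k → k < length α → rotate k α ≢ α

primitive⇒aperiodic : ∀ {α} → Primitive α → Aperiodic α
primitive⇒aperiodic {α} P k pos k<n e with P (take k α) (drop k α) (sym (take++drop≡id k α)) (trans (sym rot≡) e)
  where
  rot≡ : rotate k α ≡ drop k α ++ take k α
  rot≡ = trans (cong₂ rotate (sym (trans (length-take k α) (m≤n⇒m⊓n≡m (<⇒≤ k<n)))) (sym (take++drop≡id k α))) (rotate-++ (take k α) (drop k α))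
... | inj₁ f = <⇒≢ pos (trans (sym (cong length f)) (trans (length-take k α) (m≤n⇒m⊓n≡m (<⇒≤ k<n))))
... | inj₂ f = <-irrefl (trans (sym (trans (length-take k α) (m≤n⇒m⊓n≡m (<⇒≤ k<n))))
      (sym (trans (cong length (sym (take++drop≡id k α))) (trans (length-++ (take k α)) (trans (cong (λ w → length (take k α) + length w) f) (+-identityʳ _)))))) k<n

period-~ : ∀ {α β} k → α ~ β → rotate k α ≡ α → rotate k β ≡ β
period-~ {α} k (j , refl) e = trans (sym (rotate-+ j k α)) (trans (cong (λ m → rotate m α) (+-comm j k))
  (trans (rotate-+ k j α) (cong (rotate j) e)))

aperiodic-~ : ∀ {α β} → α ~ β → Aperiodic α → Aperiodic β
aperiodic-~ p ap k pos k<n e = ap k pos (subst (k <_) (sym (~-length p)) k<n) (period-~ k (~-sym p) e)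

rotate-distinct : ∀ {α d} → (∀ k → 0 < k → k < d → rotate k α ≢ α) → ∀ {i j} → i < j → j < d → rotate i α ≢ rotate j α
rotate-distinct {α} least {i} i<j j<d e with m≤n⇒∃[o]m+o≡n i<j
... | o , refl = least (suc o) (s≤s z≤n) (≤-trans (s≤s (s≤s (m≤n+m o i))) j<d) (period-~ (suc o) (~-sym (i , refl))
        (trans (sym (rotate-+ i (suc o) α)) (trans (cong (λ m → rotate m α) (+-suc i o)) (sym e))))

aperiodic-injective : ∀ {α} → Aperiodic α → ∀ {i j} → i < length α → j < length α → rotate i α ≡ rotate j α → i ≡ j
aperiodic-injective ap {i} {j} i<n j<n e with <-cmp i j
... | tri≈ _ p _   = p
... | tri< i<j _ _ = ⊥-elim (rotate-distinct ap i<j j<n e)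
... | tri> _ _ j<i = ⊥-elim (rotate-distinct ap j<i i<n (sym e))

isPeriodic⁻ : ∀ {α} → 0 < length α → isPeriodic α ≡ true → ¬ Aperiodic α
isPeriodic⁻ {α} pos e ap with any⁻ _ (oneTo (length α)) e
... | p , _ , e₁ with any⁻ (λ j → eqS (pow (take p α) (suc (suc j))) α) (upTo (length α)) e₁
...   | j , _ , e₂ with eqS⇒≡ (pow (take p α) (suc (suc j))) α e₂
...     | q = ap l l>0 l<n (subst (λ w → rotate l w ≡ w) q (pow⇒period (take p α) (suc j)))
  where
  l = length (take p α)
  n≡ : length α ≡ suc (suc j) * l
  n≡ = trans (cong length (sym q)) (length-pow (take p α) (suc (suc j)))
  l>0 : 0 < l
  l>0 = n≢0⇒n>0 (λ z → <⇒≢ pos (sym (trans n≡ (trans (cong (suc (suc j) *_) z) (*-zeroʳ (suc (suc j)))))))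
  l<n : l < length α
  l<n = subst (l <_) (sym n≡) (m<m+n l (≤-trans l>0 (m≤m+n l (j * l))))

isPeriodic⁺ : ∀ {α} → isPeriodic α ≡ false → Aperiodic α
isPeriodic⁺ {α} e k pos k<n f with period-divisor k pos f
... | d , zero , _ , _ , n≡ , _ = n≮0 (subst (k <_) n≡ k<n)
... | d , 1 , _ , d≤k , n≡ , _ = <-irrefl refl (≤-trans k<n (≤-trans (≤-reflexive (trans n≡ (+-identityʳ d))) d≤k))
... | d , suc (suc j) , d>0 , d≤k , n≡ , g = true≢false
    (any⁺ (λ p → any (λ j → eqS (pow (take p α) (suc (suc j))) α) (upTo (length α))) (∈-oneTo⁺ d>0 (<⇒≤ (≤-<-trans d≤k k<n)))
      (any⁺ (λ j → eqS (pow (take d α) (suc (suc j))) α) (∈-upTo⁺ j<n) (≡⇒eqS (period⇒pow d (suc (suc j)) (s≤s z≤n) n≡ g)))) e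
  where
  j<n : j < length α
  j<n = subst (j <_) (sym n≡) (≤-trans (s≤s (n≤1+n j)) (subst (_≤ suc (suc j) * d) (*-identityʳ (suc (suc j))) (*-monoʳ-≤ (suc (suc j)) d>0)))

firstS-filterᵇ : ∀ (P : Str → Bool) h d n → (Σ ℕ λ i → i < n × P (h i) ≡ true) →
  Σ ℕ λ i → i < n × P (h i) ≡ true × (∀ {i′} → i′ < i → P (h i′) ≡ false) × firstS d (filterᵇ P (applyUpTo h n)) ≡ h i
firstS-filterᵇ P h d (suc n) (i , i<n , e) with P (h 0) in eq
... | true = 0 , s≤s z≤n , eq , (λ ()) , refl
firstS-filterᵇ P h d (suc n) (zero , i<n , e) | false = ⊥-elim (true≢false e eq)
firstS-filterᵇ P h d (suc n) (suc i , s≤s i<n , e) | false with firstS-filterᵇ P (λ x → h (suc x)) d n (i , i<n , e)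
... | j , j<n , f , min , q = suc j , s≤s j<n , f , (λ { {zero} _ → eq ; {suc i′} (s≤s p) → min p }) , q

-- The definition of `ap` by powers, translated to rotations: its length is the least positive
-- period under rotation, hence the number of distinct rotations.
record ApSpec (α : Str) : Set where
  field
    d      : ℕ
    ap≡    : ap α ≡ take d α
    d>0    : 0 < d
    d≤n    : d ≤ length α
    period : rotate d α ≡ α
    least  : ∀ k → 0 < k → k < d → rotate k α ≢ α

isPowerOf⁺ : ∀ {α} d t → 0 < t → 0 < d → length α ≡ t * d → rotate d α ≡ α → isPowerOf (take d α) α ≡ true
isPowerOf⁺ {α} d t t>0 d>0 n≡ e = any⁺ (λ t → eqS (pow (take d α) t) α)
  (∈-oneTo⁺ t>0 (subst (t ≤_) (sym n≡) (subst (_≤ t * d) (*-identityʳ t) (*-monoʳ-≤ t d>0)))) (≡⇒eqS (period⇒pow d t t>0 n≡ e))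

apSpec : ∀ α → 0 < length α → ApSpec α
apSpec α pos with firstS-filterᵇ (λ γ → isPowerOf γ α) (λ p → take (suc p) α) α n found
  where
  n = length α
  found : Σ ℕ λ i → i < n × isPowerOf (take (suc i) α) α ≡ true
  found = n ∸ 1 , ≤-reflexive n-1 , subst (λ m → isPowerOf (take m α) α ≡ true) (sym n-1)
    (isPowerOf⁺ n 1 (s≤s z≤n) pos (sym (+-identityʳ n)) (rotate-length α))
    where
    n-1 : suc (n ∸ 1) ≡ n
    n-1 = m+[n∸m]≡n pos
... | i , i<n , e , min , q = record
  { d = suc i ; d>0 = s≤s z≤n ; d≤n = i<n
  ; ap≡ = trans (cong (λ xs → firstS α (filterᵇ (λ γ → isPowerOf γ α) xs)) list≡) q
  ; period = period ; least = least }
  where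
  n = length α
  list≡ : map (λ p → take p α) (oneTo n) ≡ applyUpTo (λ p → take (suc p) α) n
  list≡ = trans (cong (map (λ p → take p α)) (map-applyUpTo (λ x → x) suc n)) (map-applyUpTo suc (λ p → take p α) n)
  len : length (take (suc i) α) ≡ suc i
  len = trans (length-take (suc i) α) (m≤n⇒m⊓n≡m i<n)
  period : rotate (suc i) α ≡ α
  period with any⁻ (λ t → eqS (pow (take (suc i) α) t) α) (oneTo n) e
  ... | zero , m , _ with ∈-oneTo⁻ m
  ...   | () , _
  period | suc t , m , f = subst₂ (λ l w → rotate l w ≡ w) len (eqS⇒≡ (pow (take (suc i) α) (suc t)) α f) (pow⇒period (take (suc i) α) t)
  least : ∀ k → 0 < k → k < suc i → rotate k α ≢ α
  least k k>0 k<d f with period-divisor k k>0 f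
  ... | zero , t , () , _
  ... | suc d , zero , _ , _ , n≡ , _ = <⇒≢ pos (sym n≡)
  ... | suc d , suc t , d>0 , d≤k , n≡ , g = true≢false (isPowerOf⁺ (suc d) (suc t) (s≤s z≤n) d>0 n≡ g) (min (≤-pred (≤-<-trans d≤k k<d)))

ap-aperiodic : ∀ {α} → 0 < length α → Aperiodic α → ap α ≡ α
ap-aperiodic {α} pos a with apSpec α pos
... | s with m≤n⇒m<n∨m≡n (ApSpec.d≤n s)
...   | inj₁ d<n = ⊥-elim (a (ApSpec.d s) (ApSpec.d>0 s) d<n (ApSpec.period s))
...   | inj₂ d≡n = trans (ApSpec.ap≡ s) (trans (cong (λ m → take m α) d≡n) (take-length α))

-- Traversing the concatenation tree

range : ℕ → ℕ → List ℕ
range s zero    = []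
range s (suc l) = s ∷ range (suc s) l

range-++ : ∀ s l l′ → range s (l + l′) ≡ range s l ++ range (s + l) l′
range-++ s zero    l′ = cong (λ m → range m l′) (sym (+-identityʳ s))
range-++ s (suc l) l′ = cong (s ∷_) (trans (range-++ (suc s) l l′) (cong (λ m → range (suc s) l ++ range m l′) (sym (+-suc s l))))

applyUpTo-range : ∀ s n (f : ℕ → ℕ) → (∀ x → f x ≡ s + x) → applyUpTo f n ≡ range s n
applyUpTo-range s zero    f e = refl
applyUpTo-range s (suc n) f e = cong₂ _∷_ (trans (e 0) (+-identityʳ s)) (applyUpTo-range (suc s) n (λ x → f (suc x)) (λ x → trans (e (suc x)) (+-suc s x)))

oneTo-range : ∀ n → oneTo n ≡ range 1 n
oneTo-range n = trans (map-applyUpTo (λ x → x) suc n) (applyUpTo-range 1 n suc (λ x → refl))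

module _ {A : Set} where
  filterᵇ-true : ∀ (p : A → Bool) {x} xs → p x ≡ true → filterᵇ p (x ∷ xs) ≡ x ∷ filterᵇ p xs
  filterᵇ-true p xs e rewrite e = refl

  filterᵇ-false : ∀ (p : A → Bool) {x} xs → p x ≡ false → filterᵇ p (x ∷ xs) ≡ filterᵇ p xs
  filterᵇ-false p xs e rewrite e = refl

  filterᵇ-++ : ∀ (p : A → Bool) xs ys → filterᵇ p (xs ++ ys) ≡ filterᵇ p xs ++ filterᵇ p ys
  filterᵇ-++ p []       ys = refl
  filterᵇ-++ p (x ∷ xs) ys with bool-cases (p x)
  ... | inj₁ e = trans (filterᵇ-true p (xs ++ ys) e) (trans (cong (x ∷_) (filterᵇ-++ p xs ys)) (cong (_++ filterᵇ p ys) (sym (filterᵇ-true p xs e))))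
  ... | inj₂ e = trans (filterᵇ-false p (xs ++ ys) e) (trans (filterᵇ-++ p xs ys) (cong (_++ filterᵇ p ys) (sym (filterᵇ-false p xs e))))

  filterᵇ-swap : ∀ (p q : A → Bool) xs → filterᵇ p (filterᵇ q xs) ≡ filterᵇ q (filterᵇ p xs)
  filterᵇ-swap p q []       = refl
  filterᵇ-swap p q (x ∷ xs) with bool-cases (p x) | bool-cases (q x)
  ... | inj₁ e | inj₁ f rewrite filterᵇ-true q {x} xs f | filterᵇ-true p {x} xs e | filterᵇ-true p {x} (filterᵇ q xs) e | filterᵇ-true q {x} (filterᵇ p xs) f = cong (x ∷_) (filterᵇ-swap p q xs)
  ... | inj₁ e | inj₂ f rewrite filterᵇ-false q {x} xs f | filterᵇ-true p {x} xs e | filterᵇ-false q {x} (filterᵇ p xs) f = filterᵇ-swap p q xs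
  ... | inj₂ e | inj₁ f rewrite filterᵇ-true q {x} xs f | filterᵇ-false p {x} xs e | filterᵇ-false p {x} (filterᵇ q xs) e = filterᵇ-swap p q xs
  ... | inj₂ e | inj₂ f rewrite filterᵇ-false q {x} xs f | filterᵇ-false p {x} xs e = filterᵇ-swap p q xs

  filterᵇ-map : ∀ {B : Set} (p : A → Bool) (h : B → A) xs → filterᵇ p (map h xs) ≡ map h (filterᵇ (λ x → p (h x)) xs)
  filterᵇ-map p h []       = refl
  filterᵇ-map p h (x ∷ xs) with p (h x)
  ... | true  = cong (h x ∷_) (filterᵇ-map p h xs)
  ... | false = filterᵇ-map p h xs

<ᵇ-true : ∀ {m n} → m < n → (m <ᵇ n) ≡ true
<ᵇ-true {m} {n} p with m <ᵇ n | <⇒<ᵇ p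
... | true | _ = refl

<ᵇ-false : ∀ {m n} → n ≤ m → (m <ᵇ n) ≡ false
<ᵇ-false {m} {n} p = ≢true⇒false λ e → <⇒≱ (<ᵇ⇒< m n (subst T (sym e) _)) p

filterᵇ-range-all : ∀ (p : ℕ → Bool) s l → (∀ k → s ≤ k → k < s + l → p k ≡ true) → filterᵇ p (range s l) ≡ range s l
filterᵇ-range-all p s zero    f = refl
filterᵇ-range-all p s (suc l) f = trans (filterᵇ-true p (range (suc s) l) (f s ≤-refl (m<m+n s (s≤s z≤n))))
  (cong (s ∷_) (filterᵇ-range-all p (suc s) l (λ k a b → f k (<⇒≤ a) (subst (k <_) (sym (+-suc s l)) b))))

filterᵇ-range-none : ∀ (p : ℕ → Bool) s l → (∀ k → s ≤ k → k < s + l → p k ≡ false) → filterᵇ p (range s l) ≡ []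
filterᵇ-range-none p s zero    f = refl
filterᵇ-range-none p s (suc l) f = trans (filterᵇ-false p (range (suc s) l) (f s ≤-refl (m<m+n s (s≤s z≤n))))
  (filterᵇ-range-none p (suc s) l (λ k a b → f k (<⇒≤ a) (subst (k <_) (sym (+-suc s l)) b)))

childrenIn : ℕ → Str → ℕ → ℕ → List (ℕ × Str)
childrenIn n α s l = map (λ k → k , flipAt k α) (filterᵇ (childOK n α) (range s l))

module _ (n : ℕ) (α : Str) (lp lq : ℕ) (n≡ : n ≡ lp + suc lq) where
  private
    h : ℕ → ℕ × Str
    h k = k , flipAt k α
    c = suc lp
    split : oneTo n ≡ range 1 lp ++ c ∷ range (suc c) lq
    split = trans (oneTo-range n) (trans (cong (range 1) n≡) (range-++ 1 lp (suc lq)))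

  rightChildren≡ : rightChildren n c α ≡ childrenIn n α (suc c) lq
  rightChildren≡ = trans (filterᵇ-map (λ p → c <ᵇ proj₁ p) h (filterᵇ (childOK n α) (oneTo n)))
    (cong (map h) (trans (filterᵇ-swap (c <ᵇ_) (childOK n α) (oneTo n)) (cong (filterᵇ (childOK n α)) (trans (cong (filterᵇ (c <ᵇ_)) split)
      (trans (filterᵇ-++ (c <ᵇ_) (range 1 lp) (c ∷ range (suc c) lq)) (cong₂ _++_
        (filterᵇ-range-none (c <ᵇ_) 1 lp (λ k _ k< → <ᵇ-false (<⇒≤ k<)))
        (trans (filterᵇ-false (c <ᵇ_) {c} (range (suc c) lq) (<ᵇ-false {c} ≤-refl)) (filterᵇ-range-all (c <ᵇ_) (suc c) lq (λ k c<k _ → <ᵇ-true c<k)))))))))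

  leftChildren≡ : leftChildren n c α ≡ childrenIn n α 1 lp
  leftChildren≡ = trans (filterᵇ-map (λ p → proj₁ p <ᵇ c) h (filterᵇ (childOK n α) (oneTo n)))
    (cong (map h) (trans (filterᵇ-swap (_<ᵇ c) (childOK n α) (oneTo n)) (cong (filterᵇ (childOK n α)) (trans (cong (filterᵇ (_<ᵇ c)) split)
      (trans (filterᵇ-++ (_<ᵇ c) (range 1 lp) (c ∷ range (suc c) lq)) (trans (cong₂ _++_
        (filterᵇ-range-all (_<ᵇ c) 1 lp (λ k _ k< → <ᵇ-true k<))
        (trans (filterᵇ-false (_<ᵇ c) {c} (range (suc c) lq) (<ᵇ-false {c} ≤-refl)) (filterᵇ-range-none (_<ᵇ c) (suc c) lq (λ k c<k _ → <ᵇ-false (<⇒≤ c<k)))))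
        (++-identityʳ (range 1 lp))))))))

flipAt-++ : ∀ p a q → flipAt (suc (length p)) (p ++ a ∷ q) ≡ p ++ not a ∷ q
flipAt-++ []      a q = refl
flipAt-++ (b ∷ p) a q = cong (b ∷_) (flipAt-++ p a q)

locate : ∀ (p′ : Str) b q′ p a q → p′ ++ b ∷ q′ ≡ p ++ a ∷ q →
  (p′ ≡ p × b ≡ a × q′ ≡ q) ⊎ (Σ Str λ e → p ≡ p′ ++ b ∷ e × q′ ≡ e ++ a ∷ q) ⊎ (Σ Str λ e → p′ ≡ p ++ a ∷ e × q ≡ e ++ b ∷ q′)
locate p′ b q′ p a q e with ++-split p′ p e
... | inj₁ ([] , f , g)     = inj₁ (trans (sym (++-identityʳ p′)) (sym f) , ∷-injectiveˡ g , ∷-injectiveʳ g)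
... | inj₁ (c ∷ e₁ , f , g) with ∷-injectiveˡ g
...   | refl = inj₂ (inj₁ (e₁ , f , ∷-injectiveʳ g))
locate p′ b q′ p a q e | inj₂ (c , e₁ , f , g) with ∷-injectiveˡ g
... | refl = inj₂ (inj₂ (e₁ , f , ∷-injectiveʳ g))

∈-snoc⁻ : ∀ {A : Set} {w y : A} xs → w ∈ xs ++ y ∷ [] → w ∈ xs ⊎ w ≡ y
∈-snoc⁻ xs i with ∈-++⁻ xs i
... | inj₁ j        = inj₁ j
... | inj₂ (here e) = inj₂ e

rotation-position : ∀ {α ρ} → 0 < length α → α ~ ρ → Σ Str λ p → Σ Bool λ b → Σ Str λ q → α ≡ p ++ b ∷ q × ρ ≡ b ∷ q ++ p
rotation-position {ρ = []} pos r with subst (0 <_) (~-length r) pos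
... | ()
rotation-position {ρ = b ∷ x} pos r with ~-∷-split (~-sym r)
... | p , q , e , refl = p , b , q , e , refl

-- Walks of the successor rule

module _ (n : ℕ) (6≤n : 6 ≤ n) where

  childOK⇒Edge : ∀ p a q → childOK n (p ++ a ∷ q) (suc (length p)) ≡ true → Edge n (not a) (q ++ p)
  childOK⇒Edge p a q e = edge (subst (λ w → inA n w ≡ true) neck≡ (proj₁ (∧-true⁻ e)))
      (λ r → true≢false (≡⇒eqS (trans neck≡ r)) (not-true⁻ (proj₁ (∧-true⁻ e′))))
      (trans (cong (par n) (sym neck≡)) (trans (eqS⇒≡ (par n γ) (neck (p ++ a ∷ q)) (proj₂ (∧-true⁻ {not (eqS γ (root n))} e′)))
        (trans (neck-cong (~-swap p (a ∷ q))) (cong (λ b → neck (b ∷ q ++ p)) (sym (not-involutive a))))))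
    where
    γ = neck (flipAt (suc (length p)) (p ++ a ∷ q))
    e′ : not (eqS γ (root n)) ∧ eqS (par n γ) (neck (p ++ a ∷ q)) ≡ true
    e′ = proj₂ (∧-true⁻ {inA n γ} e)
    neck≡ : γ ≡ neck (not a ∷ q ++ p)
    neck≡ = trans (cong neck (flipAt-++ p a q)) (neck-cong (~-swap p (not a ∷ q)))

  Edge⇒childOK : ∀ p a q → Edge n (not a) (q ++ p) → childOK n (p ++ a ∷ q) (suc (length p)) ≡ true
  Edge⇒childOK p a q E = ∧-true⁺ (subst (λ w → inA n w ≡ true) (sym neck≡) (child∈A E)) (∧-true⁺
      (cong not (≢true⇒false (λ r → child≢root E (trans (sym neck≡) (eqS⇒≡ _ (root n) r)))))
      (≡⇒eqS (trans (cong (par n) neck≡) (trans (parent≡ E) (trans (cong (λ b → neck (b ∷ q ++ p)) (not-involutive a)) (neck-cong (~-swap (a ∷ q) p)))))))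
    where
    neck≡ : neck (flipAt (suc (length p)) (p ++ a ∷ q)) ≡ neck (not a ∷ q ++ p)
    neck≡ = trans (cong neck (flipAt-++ p a q)) (neck-cong (~-swap p (not a ∷ q)))

  -- Run w e vs w′: starting from the window w, the rule g emits e, passes
  -- through the windows vs and arrives at w′.
  data Run : Str → Str → List Str → Str → Set where
    stop : ∀ {w} → Run w [] [] w
    move : ∀ {a x e vs w′} b → g n (a ∷ x) ≡ b → Run (x ++ b ∷ []) e vs w′ → Run (a ∷ x) (b ∷ e) ((a ∷ x) ∷ vs) w′

  run-++ : ∀ {w e vs w′ e′ vs′ w″} → Run w e vs w′ → Run w′ e′ vs′ w″ → Run w (e ++ e′) (vs ++ vs′) w″
  run-++ stop         s = s
  run-++ (move b f r) s = move b f (run-++ r s)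

  -- `down` adds a step at the top of the chain, so that recursion enters the subtree of a child
  -- just as the traversal does.
  data Desc (β : Str) : Str → Set where
    self : Desc β β
    down : ∀ {γ₁ γ} → inA n γ₁ ≡ true → γ₁ ≢ root n → par n γ₁ ≡ β → Desc γ₁ γ → Desc β γ

  Good : Str → Set
  Good w = inA n (neck w) ≡ true × neck w ≢ root n

  -- The node labelled p a q with change index |p| + 1. Its walk starts just after
  -- bit a has been emitted and re-reads p at the end, whence the shape of emit.
  record Node (P : Str → Set) (p : Str) (a : Bool) (q : Str) : Set where
    field
      U     : Str
      tree  : RCLnode n (suc (length p)) (p ++ a ∷ q) U
      E     : Str
      vs    : List Str
      run   : Run (q ++ p ++ a ∷ []) E vs (a ∷ q ++ p)
      emit  : p ++ a ∷ E ≡ U ++ p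
      good  : All P vs
      cover : ∀ {γ} → Desc (neck (p ++ a ∷ q)) γ → ∀ {ρ} → γ ~ ρ → ρ ∈ vs ++ (a ∷ q ++ p) ∷ []

  -- One sweep over the positions of `r` in the label α = p r q, where m is the length of p. `own`
  -- collects the windows of α itself, `sub` those of the subtrees hanging at these positions. In
  -- `emit`, the bits of α that have been read but are not yet matched with the traversal grow from
  -- p to p r.
  record Segment (P : Str → Set) (α : Str) (m : ℕ) (p r q : Str) : Set where
    field
      U    : Str
      list : RCLlist n (childrenIn n α (suc m) (length r)) U
      E    : Str
      vs   : List Str
      run  : Run (r ++ q ++ p) E vs (q ++ p ++ r)
      emit : p ++ E ≡ U ++ p ++ r
      good : All P vs
      own  : ∀ r₁ b r₂ → r ≡ r₁ ++ b ∷ r₂ → (b ∷ r₂ ++ q ++ p ++ r₁) ∈ vs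
      sub  : ∀ r₁ b r₂ → r ≡ r₁ ++ b ∷ r₂ → childOK n α (suc (m + length r₁)) ≡ true →
             ∀ {γ} → Desc (neck (flipAt (suc (m + length r₁)) α)) γ → ∀ {ρ} → γ ~ ρ → ρ ∈ vs

  -- `P` is what is recorded about the visited windows: `Good` below the root, and at the root
  -- membership in S(n) together with being different from the closing window.
  module Segments (P : Str → Set) (α : Str) (len : length α ≡ n)
    (good⇒P : ∀ {w} → Good w → P w)
    (child : ∀ p a q → α ≡ p ++ a ∷ q → childOK n α (suc (length p)) ≡ true → Node Good p (not a) q) where

    All-good : ∀ {vs} → All Good vs → All P vs
    All-good All.[]         = All.[]
    All-good (x All.∷ xs) = good⇒P x All.∷ All-good xs

    segment : ∀ m p r q → m ≡ length p → α ≡ p ++ r ++ q →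
      (∀ r₁ b r₂ → r ≡ r₁ ++ b ∷ r₂ → ¬ Edge n b (r₂ ++ q ++ p ++ r₁)) →
      (∀ r₁ b r₂ → r ≡ r₁ ++ b ∷ r₂ → P (b ∷ r₂ ++ q ++ p ++ r₁)) → Segment P α m p r q
    segment m p [] q m≡ α≡ noUp own = record
      { U = [] ; list = nil ; E = [] ; vs = [] ; run = subst (λ w → Run (q ++ p) [] [] (q ++ w)) (sym (++-identityʳ p)) stop
      ; emit = refl ; good = All.[] ; own = λ { [] _ _ () ; (_ ∷ _) _ _ () } ; sub = λ { [] _ _ () ; (_ ∷ _) _ _ () } }
    segment m p (a ∷ r) q m≡ α≡ noUp own = byCase (bool-cases (childOK n α (suc m)))
      where
      p⁺ = p ++ a ∷ []
      x  = r ++ q ++ p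
      α≡⁺ : α ≡ p⁺ ++ r ++ q
      α≡⁺ = trans α≡ (sym (++-assoc p (a ∷ []) (r ++ q)))
      m≡⁺ : suc m ≡ length p⁺
      m≡⁺ = trans (cong suc m≡) (trans (+-comm 1 (length p)) (sym (length-++ p)))
      shift : ∀ r₁ b (r₂ : Str) → b ∷ r₂ ++ q ++ p⁺ ++ r₁ ≡ b ∷ r₂ ++ q ++ p ++ a ∷ r₁
      shift r₁ b r₂ = cong (λ w → b ∷ r₂ ++ q ++ w) (++-assoc p (a ∷ []) r₁)
      S : Segment P α (suc m) p⁺ r q
      S = segment (suc m) p⁺ r q m≡⁺ α≡⁺
        (λ r₁ b r₂ e E → noUp (a ∷ r₁) b r₂ (cong (a ∷_) e) (subst (Edge n b) (∷-injectiveʳ (shift r₁ b r₂)) E))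
        (λ r₁ b r₂ e → subst P (sym (shift r₁ b r₂)) (own (a ∷ r₁) b r₂ (cong (a ∷_) e)))
      module S = Segment S
      tail-own : ∀ {c} r₁ b r₂ → a ∷ r ≡ c ∷ r₁ ++ b ∷ r₂ → (b ∷ r₂ ++ q ++ p ++ c ∷ r₁) ∈ S.vs
      tail-own r₁ b r₂ e = subst (_∈ S.vs) (trans (shift r₁ b r₂) (cong (λ d → b ∷ r₂ ++ q ++ p ++ d ∷ r₁) (∷-injectiveˡ e))) (S.own r₁ b r₂ (∷-injectiveʳ e))
      snoc-x : ∀ c → x ++ c ∷ [] ≡ r ++ q ++ p ++ c ∷ []
      snoc-x c = trans (++-assoc r (q ++ p) (c ∷ [])) (cong (r ++_) (++-assoc q p (c ∷ [])))
      head-state : ∀ (r₁ : Str) b r₂ → a ∷ r ≡ r₁ ++ b ∷ r₂ → r₁ ≡ [] → _≡_ {A = Str} (b ∷ r₂ ++ q ++ p ++ r₁) (a ∷ x)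
      head-state .[] b r₂ e refl = trans (cong (λ w → b ∷ r₂ ++ q ++ w) (++-identityʳ p)) (cong (_++ q ++ p) (sym e))
      own₀ : P (a ∷ x)
      own₀ = subst P (head-state [] a r refl refl) (own [] a r refl)
      noUp₀ : ¬ Edge n a x
      noUp₀ E = noUp [] a r refl (subst (Edge n a) (sym (∷-injectiveʳ (head-state [] a r refl refl))) E)
      len-x : suc (length x) ≡ n
      len-x = trans (trans (cong suc (trans (length-++ r) (trans (cong (length r +_) (length-++ q)) (ring (length r) (length q) (length p)))))
        (sym (trans (length-++ p) (trans (+-suc (length p) _) (cong (λ k → suc (length p + k)) (length-++ r)))))) (trans (cong length (sym α≡)) len)
        where
        ring : ∀ a b c → a + (b + c) ≡ c + (a + b)
        ring = solve-∀
      final : ∀ {E vs} → Run (r ++ q ++ p ++ a ∷ []) E vs (q ++ p⁺ ++ r) → Run (r ++ q ++ p ++ a ∷ []) E vs (q ++ p ++ a ∷ r)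
      final {E} {vs} = subst (λ w → Run (r ++ q ++ p ++ a ∷ []) E vs (q ++ w)) (++-assoc p (a ∷ []) r)
      okα : ∀ {c} → childOK n α (suc m) ≡ c → childOK n (p ++ a ∷ (r ++ q)) (suc (length p)) ≡ c
      okα e = trans (cong₂ (λ w k → childOK n w (suc k)) (sym α≡) (sym m≡)) e
      index : ∀ (r₁ : Str) → suc (suc m + length r₁) ≡ suc (m + suc (length r₁))
      index r₁ = cong suc (sym (+-suc m (length r₁)))
      byCase : childOK n α (suc m) ≡ true ⊎ childOK n α (suc m) ≡ false → Segment P α m p (a ∷ r) q
      byCase (inj₂ no-child) = record
        { U = S.U
        ; list = subst (λ ks → RCLlist n (map (λ k → k , flipAt k α) ks) S.U)
                   (sym (filterᵇ-false (childOK n α) (range (suc (suc m)) (length r)) no-child)) S.list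
        ; E = a ∷ S.E ; vs = (a ∷ x) ∷ S.vs
        ; run = move a keep (subst (λ w → Run w S.E S.vs (q ++ p ++ a ∷ r)) (sym (snoc-x a)) (final S.run))
        ; emit = trans (sym (++-assoc p (a ∷ []) S.E)) (trans S.emit (cong (S.U ++_) (++-assoc p (a ∷ []) r)))
        ; good = own₀ All.∷ S.good
        ; own = own′ ; sub = sub′ }
        where
        noDown : ¬ Edge n (not a) x
        noDown E = true≢false (Edge⇒childOK p a (r ++ q) (subst (Edge n (not a)) (sym (++-assoc r q p)) E)) (okα no-child)
        keep : g n (a ∷ x) ≡ a
        keep = go a noUp₀ noDown
          where
          go : ∀ a → ¬ Edge n a x → ¬ Edge n (not a) x → g n (a ∷ x) ≡ a
          go true  u d = g-keep n 6≤n len-x u d true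
          go false u d = g-keep n 6≤n len-x d u false
        own′ : ∀ r₁ b r₂ → a ∷ r ≡ r₁ ++ b ∷ r₂ → (b ∷ r₂ ++ q ++ p ++ r₁) ∈ (a ∷ x) ∷ S.vs
        own′ []       b r₂ e = here (head-state [] b r₂ e refl)
        own′ (c ∷ r₁) b r₂ e = there (tail-own r₁ b r₂ e)
        sub′ : ∀ r₁ b r₂ → a ∷ r ≡ r₁ ++ b ∷ r₂ → childOK n α (suc (m + length r₁)) ≡ true →
               ∀ {γ} → Desc (neck (flipAt (suc (m + length r₁)) α)) γ → ∀ {ρ} → γ ~ ρ → ρ ∈ (a ∷ x) ∷ S.vs
        sub′ []       b r₂ e ok = ⊥-elim (true≢false (trans (cong (λ k → childOK n α (suc k)) (sym (+-identityʳ m))) ok) no-child)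
        sub′ (c ∷ r₁) b r₂ e ok {γ} D s = there (S.sub r₁ b r₂ (∷-injectiveʳ e) (trans (cong (childOK n α) (index r₁)) ok)
          (subst (λ k → Desc (neck (flipAt k α)) γ) (sym (index r₁)) D) s)
      -- `g` complements twice here: at `a ∷ x`, which enters the subtree, and at `not a ∷ x`, where
      -- the walk of the child ends, which emits `a` and resumes the sweep.
      byCase (inj₁ has-child) = record
        { U = N.U ++ S.U
        ; list = subst (λ ks → RCLlist n (map (λ k → k , flipAt k α) ks) (N.U ++ S.U))
                   (sym (filterᵇ-true (childOK n α) (range (suc (suc m)) (length r)) has-child)) (cons tree′ S.list)
        ; E = not a ∷ N.E ++ a ∷ S.E ; vs = (a ∷ x) ∷ N.vs ++ (not a ∷ x) ∷ S.vs
        ; run = move (not a) (g-flip n 6≤n E₀ a) (run-++ run₁ (move a (trans (g-flip n 6≤n E₀ (not a)) (not-involutive a))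
                  (subst (λ w → Run w S.E S.vs (q ++ p ++ a ∷ r)) (sym (snoc-x a)) (final S.run))))
        ; emit = emit′
        ; good = own₀ All.∷ All-++⁺ (All-good N.good) (good⇒P (child∈A E₀ , child≢root E₀) All.∷ S.good)
        ; own = own′ ; sub = sub′ }
        where
        N = child p a (r ++ q) α≡ (trans (cong (λ k → childOK n α (suc k)) (sym m≡)) has-child)
        module N = Node N
        E₀ : Edge n (not a) x
        E₀ = subst (Edge n (not a)) (++-assoc r q p) (childOK⇒Edge p a (r ++ q) (okα has-child))
        flip≡ : flipAt (suc m) α ≡ p ++ not a ∷ (r ++ q)
        flip≡ = trans (cong₂ (λ k w → flipAt (suc k) w) m≡ α≡) (flipAt-++ p a (r ++ q))
        tree′ : RCLnode n (suc m) (flipAt (suc m) α) N.U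
        tree′ = subst₂ (λ k w → RCLnode n (suc k) w N.U) (sym m≡) (sym flip≡) N.tree
        final≡ : not a ∷ (r ++ q) ++ p ≡ not a ∷ x
        final≡ = cong (not a ∷_) (++-assoc r q p)
        run₁ : Run (x ++ not a ∷ []) N.E N.vs (not a ∷ x)
        run₁ = subst₂ (λ w w′ → Run w N.E N.vs w′)
          (trans (++-assoc r q (p ++ not a ∷ [])) (sym (snoc-x (not a)))) final≡ N.run
        emit′ : p ++ not a ∷ N.E ++ a ∷ S.E ≡ (N.U ++ S.U) ++ p ++ a ∷ r
        emit′ = begin
          p ++ (not a ∷ N.E) ++ a ∷ S.E ≡⟨ sym (++-assoc p (not a ∷ N.E) (a ∷ S.E)) ⟩
          (p ++ not a ∷ N.E) ++ a ∷ S.E ≡⟨ cong (_++ a ∷ S.E) N.emit ⟩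
          (N.U ++ p) ++ a ∷ S.E ≡⟨ ++-assoc N.U p (a ∷ S.E) ⟩
          N.U ++ p ++ a ∷ S.E ≡⟨ cong (N.U ++_) (sym (++-assoc p (a ∷ []) S.E)) ⟩
          N.U ++ p⁺ ++ S.E ≡⟨ cong (N.U ++_) S.emit ⟩
          N.U ++ S.U ++ p⁺ ++ r ≡⟨ sym (++-assoc N.U S.U (p⁺ ++ r)) ⟩
          (N.U ++ S.U) ++ p⁺ ++ r ≡⟨ cong ((N.U ++ S.U) ++_) (++-assoc p (a ∷ []) r) ⟩
          (N.U ++ S.U) ++ p ++ a ∷ r ∎
          where open ≡-Reasoning
        late : ∀ {w} → w ∈ S.vs → w ∈ (a ∷ x) ∷ N.vs ++ (not a ∷ x) ∷ S.vs
        late i = there (∈-++⁺ʳ N.vs (there i))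
        inner-∈ : ∀ {w} → w ∈ N.vs ++ (not a ∷ (r ++ q) ++ p) ∷ [] → w ∈ (a ∷ x) ∷ N.vs ++ (not a ∷ x) ∷ S.vs
        inner-∈ i = [ (λ j → there (∈-++⁺ˡ j)) , (λ e → there (∈-++⁺ʳ N.vs (here (trans e final≡)))) ]′ (∈-snoc⁻ N.vs i)
        own′ : ∀ r₁ b r₂ → a ∷ r ≡ r₁ ++ b ∷ r₂ → (b ∷ r₂ ++ q ++ p ++ r₁) ∈ (a ∷ x) ∷ N.vs ++ (not a ∷ x) ∷ S.vs
        own′ []       b r₂ e = here (head-state [] b r₂ e refl)
        own′ (c ∷ r₁) b r₂ e = late (tail-own r₁ b r₂ e)
        sub′ : ∀ r₁ b r₂ → a ∷ r ≡ r₁ ++ b ∷ r₂ → childOK n α (suc (m + length r₁)) ≡ true →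
               ∀ {γ} → Desc (neck (flipAt (suc (m + length r₁)) α)) γ → ∀ {ρ} → γ ~ ρ → ρ ∈ (a ∷ x) ∷ N.vs ++ (not a ∷ x) ∷ S.vs
        sub′ []       b r₂ e ok D s = inner-∈ (N.cover (subst (λ w → Desc w _) (trans (cong (λ k → neck (flipAt (suc k) α)) (+-identityʳ m)) (cong neck flip≡)) D) s)
        sub′ (c ∷ r₁) b r₂ e ok {γ} D s = late (S.sub r₁ b r₂ (∷-injectiveʳ e) (trans (cong (childOK n α) (index r₁)) ok)
          (subst (λ k → Desc (neck (flipAt k α)) γ) (sym (index r₁)) D) s)

-- Walks through inner nodes and leaves

rotate-position : ∀ (p : Str) b q → rotate (length p) (p ++ b ∷ q) ≡ b ∷ q ++ p
rotate-position p b q = rotate-++ p (b ∷ q)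

length-position : ∀ (p : Str) b q → length p < length (p ++ b ∷ q)
length-position p b q = subst (length p <_) (sym (length-++ p)) (m<m+n (length p) (s≤s z≤n))

module _ (n : ℕ) (6≤n : 6 ≤ n) where

  edge-μ : ∀ {b x} → Edge n b x → μ n (neck (b ∷ x)) < μ n (neck (not b ∷ x))
  edge-μ {b} {x} E = subst (λ w → μ n (neck (b ∷ x)) < μ n w) (parent≡ E) (μ-par n (edge-IsA n 6≤n E) (edge-length n 6≤n E))

  -- `μ` would have to rise in both directions. Applied to the change bit: its complement leads to
  -- the parent, so it is not a child position.
  edge-acyclic : ∀ {b x} → Edge n b x → ¬ Edge n (not b) x
  edge-acyclic {b} {x} E E′ = <-asym (edge-μ E) (subst (λ c → μ n (neck (not b ∷ x)) < μ n (neck (c ∷ x))) (not-involutive b) (edge-μ E′))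

  child-position : ∀ {α γ₁} → inA n γ₁ ≡ true → γ₁ ≢ root n → par n γ₁ ≡ neck α →
    Σ Str λ p → Σ Bool λ c → Σ Str λ q → α ≡ p ++ c ∷ q × Edge n (not c) (q ++ p) × neck (p ++ not c ∷ q) ≡ γ₁
  child-position {α} {γ₁} e≡ γ₁≢root par≡ = go parCase
    where
    A = proj₂ (inA⁻ {γ = γ₁} (n>0 n 6≤n) e≡)
    open Parent n A (proj₁ (inA⁻ {γ = γ₁} (n>0 n 6≤n) e≡))
    go : (Σ Bool λ b → Σ Str λ x → ParCase b x) →
      Σ Str λ p → Σ Bool λ c → Σ Str λ q → α ≡ p ++ c ∷ q × Edge n (not c) (q ++ p) × neck (p ++ not c ∷ q) ≡ γ₁
    go (b , x , c) with ~-∷-split (~-trans (edge-parent c) (~-trans (~-reflexive par≡) (~-sym (neck-~ α))))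
    ... | p , q , α≡ , refl = p , not b , q , α≡ ,
          subst (λ d → Edge n d (q ++ p)) (sym (not-involutive b))
            (edge (trans (cong (inA n) neck≡) e≡) (λ r → γ₁≢root (trans (sym neck≡) r))
              (trans (cong (par n) neck≡) (trans par≡ (neck-cong (~-trans (~-reflexive α≡) (~-swap p (not b ∷ q))))))) ,
          trans (neck-cong (~-swap p (not (not b) ∷ q))) (trans (cong (λ d → neck (d ∷ q ++ p)) (not-involutive b)) neck≡)
      where
      neck≡ : neck (b ∷ q ++ p) ≡ γ₁
      neck≡ = neck-unique (edge-child c) (necklace A)

  parent-aperiodic : ∀ {α γ₁} → inA n γ₁ ≡ true → par n γ₁ ≡ neck α → Aperiodic α
  parent-aperiodic {α} {γ₁} e par≡ = aperiodic-~ (~-trans (~-reflexive par≡) (~-sym (neck-~ α)))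
    (primitive⇒aperiodic (Parent.par-primitive n (proj₂ (inA⁻ {γ = γ₁} (n>0 n 6≤n) e)) (proj₁ (inA⁻ {γ = γ₁} (n>0 n 6≤n) e))))

  -- The position exempted in `noUp` and `own` is the change bit, at which the walk ends. `noUp`
  -- keeps the walk from leaving towards the parent earlier. In this form the hypotheses are also
  -- met by the root, which has no parent.
  module Inner (P : Str → Set) (p : Str) (a : Bool) (q : Str) (len : length (p ++ a ∷ q) ≡ n)
    (non-periodic : isPeriodic (p ++ a ∷ q) ≡ false)
    (good⇒P : ∀ {w} → Good n 6≤n w → P w)
    (child : ∀ p′ b q′ → p ++ a ∷ q ≡ p′ ++ b ∷ q′ → childOK n (p ++ a ∷ q) (suc (length p′)) ≡ true → Node n 6≤n (Good n 6≤n) p′ (not b) q′)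
    (noUp : ∀ p′ b q′ → p ++ a ∷ q ≡ p′ ++ b ∷ q′ → length p′ ≢ length p → ¬ Edge n b (q′ ++ p′))
    (own : ∀ p′ b q′ → p ++ a ∷ q ≡ p′ ++ b ∷ q′ → length p′ ≢ length p → P (b ∷ q′ ++ p′))
    (noSelf : ¬ Edge n (not a) (q ++ p)) where

    private
      α = p ++ a ∷ q
      pos : 0 < length α
      pos = subst (0 <_) (sym len) (n>0 n 6≤n)

    right-state : ∀ b (r₁ r₂ : Str) → b ∷ r₂ ++ [] ++ (p ++ a ∷ []) ++ r₁ ≡ b ∷ r₂ ++ p ++ a ∷ r₁
    right-state b r₁ r₂ = cong (λ w → b ∷ r₂ ++ w) (++-assoc p (a ∷ []) r₁)
    right-α : ∀ r₁ b r₂ → q ≡ r₁ ++ b ∷ r₂ → α ≡ (p ++ a ∷ r₁) ++ b ∷ r₂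
    right-α r₁ b r₂ e = trans (cong (λ w → p ++ a ∷ w) e) (sym (++-assoc p (a ∷ r₁) (b ∷ r₂)))
    right-≢ : ∀ (r₁ : Str) → length (p ++ a ∷ r₁) ≢ length p
    right-≢ r₁ e = <-irrefl (sym e) (length-position p a r₁)
    left-state : ∀ b (r₁ r₂ : Str) → b ∷ r₂ ++ (a ∷ q) ++ [] ++ r₁ ≡ b ∷ (r₂ ++ a ∷ q) ++ r₁
    left-state b r₁ r₂ = cong (b ∷_) (sym (++-assoc r₂ (a ∷ q) r₁))
    left-α : ∀ r₁ b r₂ → p ≡ r₁ ++ b ∷ r₂ → α ≡ r₁ ++ b ∷ (r₂ ++ a ∷ q)
    left-α r₁ b r₂ e = trans (cong (_++ a ∷ q) e) (++-assoc r₁ (b ∷ r₂) (a ∷ q))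
    left-≢ : ∀ (r₁ : Str) b r₂ → p ≡ r₁ ++ b ∷ r₂ → length r₁ ≢ length p
    left-≢ r₁ b r₂ e f = <-irrefl (trans f (cong length e)) (length-position r₁ b r₂)

    open Segments n 6≤n P α len good⇒P child using (segment)

    -- Right children lie behind the change bit and left children before it. When the first sweep
    -- ends, exactly the label has been read, which places `ap α` between the two.
    R : Segment n 6≤n P α (suc (length p)) (p ++ a ∷ []) q []
    R = segment (suc (length p)) (p ++ a ∷ []) q [] (trans (+-comm 1 (length p)) (sym (length-++ p)))
      (trans (cong (λ w → p ++ a ∷ w) (sym (++-identityʳ q))) (sym (++-assoc p (a ∷ []) (q ++ []))))
      (λ r₁ b r₂ e E → noUp (p ++ a ∷ r₁) b r₂ (right-α r₁ b r₂ e) (right-≢ r₁) (subst (Edge n b) (∷-injectiveʳ (right-state b r₁ r₂)) E))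
      (λ r₁ b r₂ e → subst P (sym (right-state b r₁ r₂)) (own (p ++ a ∷ r₁) b r₂ (right-α r₁ b r₂ e) (right-≢ r₁)))

    L′ : Segment n 6≤n P α 0 [] p (a ∷ q)
    L′ = segment 0 [] p (a ∷ q) refl refl
      (λ r₁ b r₂ e E → noUp r₁ b (r₂ ++ a ∷ q) (left-α r₁ b r₂ e) (left-≢ r₁ b r₂ e) (subst (Edge n b) (∷-injectiveʳ (left-state b r₁ r₂)) E))
      (λ r₁ b r₂ e → subst P (sym (left-state b r₁ r₂)) (own r₁ b (r₂ ++ a ∷ q) (left-α r₁ b r₂ e) (left-≢ r₁ b r₂ e)))

    module R = Segment R
    module L′ = Segment L′

    ap≡α : ap α ≡ α
    ap≡α = ap-aperiodic pos (isPeriodic⁺ non-periodic)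

    node : Node n 6≤n P p a q
    node = record
      { U = R.U ++ ap α ++ L′.U
      ; tree = inner non-periodic (subst (λ ks → RCLlist n ks R.U) (sym (rightChildren≡ n α (length p) (length q) n≡)) R.list)
                                  (subst (λ ks → RCLlist n ks L′.U) (sym (leftChildren≡ n α (length p) (length q) n≡)) L′.list)
      ; E = R.E ++ L′.E ; vs = R.vs ++ L′.vs
      ; run = run-++ n 6≤n
          (subst (Run n 6≤n (q ++ p ++ a ∷ []) R.E R.vs) (++-assoc p (a ∷ []) q) R.run)
          (subst₂ (λ w w′ → Run n 6≤n (p ++ w) L′.E L′.vs w′) (++-identityʳ (a ∷ q)) refl L′.run)
      ; emit = emit
      ; good = All-++⁺ R.good L′.good
      ; cover = cover }
      where
      n≡ : n ≡ length p + suc (length q)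
      n≡ = trans (sym len) (length-++ p)
      emit : p ++ a ∷ R.E ++ L′.E ≡ (R.U ++ ap α ++ L′.U) ++ p
      emit = begin
        p ++ (a ∷ R.E) ++ L′.E ≡⟨ sym (++-assoc p (a ∷ R.E) L′.E) ⟩
        (p ++ a ∷ R.E) ++ L′.E ≡⟨ cong (_++ L′.E) (trans (sym (++-assoc p (a ∷ []) R.E)) R.emit) ⟩
        (R.U ++ (p ++ a ∷ []) ++ q) ++ L′.E ≡⟨ cong (λ w → (R.U ++ w) ++ L′.E) (trans (++-assoc p (a ∷ []) q) (sym ap≡α)) ⟩
        (R.U ++ ap α) ++ L′.E ≡⟨ cong ((R.U ++ ap α) ++_) L′.emit ⟩
        (R.U ++ ap α) ++ L′.U ++ p ≡⟨ sym (++-assoc (R.U ++ ap α) L′.U p) ⟩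
        ((R.U ++ ap α) ++ L′.U) ++ p ≡⟨ cong (_++ p) (++-assoc R.U (ap α) L′.U) ⟩
        (R.U ++ ap α ++ L′.U) ++ p ∎
        where open ≡-Reasoning
      fromR : ∀ {w} → w ∈ R.vs → w ∈ (R.vs ++ L′.vs) ++ (a ∷ q ++ p) ∷ []
      fromR i = ∈-++⁺ˡ (∈-++⁺ˡ i)
      fromL : ∀ {w} → w ∈ L′.vs → w ∈ (R.vs ++ L′.vs) ++ (a ∷ q ++ p) ∷ []
      fromL i = ∈-++⁺ˡ (∈-++⁺ʳ R.vs i)
      own∈ : ∀ p′ b q′ → α ≡ p′ ++ b ∷ q′ → (b ∷ q′ ++ p′) ∈ (R.vs ++ L′.vs) ++ (a ∷ q ++ p) ∷ []
      own∈ p′ b q′ α≡ = case (locate p′ b q′ p a q (sym α≡))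
        where
        case : (p′ ≡ p × b ≡ a × q′ ≡ q) ⊎ (Σ Str λ e → p ≡ p′ ++ b ∷ e × q′ ≡ e ++ a ∷ q) ⊎ (Σ Str λ e → p′ ≡ p ++ a ∷ e × q ≡ e ++ b ∷ q′) →
          (b ∷ q′ ++ p′) ∈ (R.vs ++ L′.vs) ++ (a ∷ q ++ p) ∷ []
        case (inj₁ (p≡ , b≡ , q≡)) = ∈-++⁺ʳ (R.vs ++ L′.vs) (here (cong₂ _∷_ b≡ (cong₂ _++_ q≡ p≡)))
        case (inj₂ (inj₁ (e , p≡ , q≡))) = fromL (subst (_∈ L′.vs) (trans (left-state b p′ e) (cong (λ w → b ∷ w ++ p′) (sym q≡))) (L′.own p′ b e p≡))
        case (inj₂ (inj₂ (e , p≡ , q≡))) = fromR (subst (_∈ R.vs) (trans (right-state b e q′) (cong (λ w → b ∷ q′ ++ w) (sym p≡))) (R.own e b q′ q≡))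
      child∈ : ∀ {γ₁ γ} p′ c q′ → α ≡ p′ ++ c ∷ q′ → Edge n (not c) (q′ ++ p′) → neck (p′ ++ not c ∷ q′) ≡ γ₁ →
        Desc n 6≤n γ₁ γ → ∀ {ρ} → γ ~ ρ → ρ ∈ (R.vs ++ L′.vs) ++ (a ∷ q ++ p) ∷ []
      child∈ {γ₁} {γ} p′ c q′ α≡ E neck≡ D {ρ} s = case (locate p′ c q′ p a q (sym α≡))
        where
        ok : ∀ k → suc (length p′) ≡ k → childOK n α k ≡ true
        ok k e = trans (cong (childOK n α) (sym e)) (trans (cong (λ w → childOK n w (suc (length p′))) α≡) (Edge⇒childOK n 6≤n p′ c q′ E))
        desc : ∀ k → suc (length p′) ≡ k → Desc n 6≤n (neck (flipAt k α)) γ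
        desc k e = subst (λ w → Desc n 6≤n w γ) (sym (trans (cong neck (trans (cong₂ flipAt (sym e) α≡) (flipAt-++ p′ c q′))) neck≡)) D
        case : (p′ ≡ p × c ≡ a × q′ ≡ q) ⊎ (Σ Str λ e → p ≡ p′ ++ c ∷ e × q′ ≡ e ++ a ∷ q) ⊎ (Σ Str λ e → p′ ≡ p ++ a ∷ e × q ≡ e ++ c ∷ q′) →
          ρ ∈ (R.vs ++ L′.vs) ++ (a ∷ q ++ p) ∷ []
        case (inj₁ (p≡ , c≡ , q≡)) = ⊥-elim (noSelf (subst₂ (Edge n) (cong not c≡) (cong₂ _++_ q≡ p≡) E))
        case (inj₂ (inj₁ (e , p≡ , _))) = fromL (L′.sub p′ c e p≡ (ok _ refl) (desc _ refl) s)
        case (inj₂ (inj₂ (e , p≡ , q≡))) = fromR (R.sub e c q′ q≡ (ok _ lp) (desc _ lp) s)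
          where
          lp : suc (length p′) ≡ suc (suc (length p) + length e)
          lp = cong suc (trans (cong length p≡) (trans (length-++ p) (+-suc (length p) (length e))))
      cover : ∀ {γ} → Desc n 6≤n (neck α) γ → ∀ {ρ} → γ ~ ρ → ρ ∈ (R.vs ++ L′.vs) ++ (a ∷ q ++ p) ∷ []
      cover self {ρ} s = let p′ , b , q′ , α≡ , ρ≡ = rotation-position pos (~-trans (neck-~ α) s) in
        subst (_∈ (R.vs ++ L′.vs) ++ (a ∷ q ++ p) ∷ []) (sym ρ≡) (own∈ p′ b q′ α≡)
      cover (down {γ₁} e≡ γ₁≢root par≡ D) s = let p′ , c , q′ , α≡ , E , neck≡ = child-position {α} e≡ γ₁≢root par≡ in
        child∈ p′ c q′ α≡ E neck≡ D s

  run-rotate : ∀ l w → 0 < length w → (∀ {k} → k < l → g n (rotate k w) ≡ bit w k) →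
    Run n 6≤n w (applyUpTo (bit w) l) (applyUpTo (λ k → rotate k w) l) (rotate l w)
  run-rotate zero    w       _ _ = stop
  run-rotate (suc l) (a ∷ x) pos h = move a (h (s≤s z≤n))
    (run-rotate l (x ++ a ∷ []) (subst (0 <_) (sym (length-rotate₁ (a ∷ x))) pos) (λ k<l → h (s≤s k<l)))

  -- Rotating w₀ by the least period d returns to w₀. The change bit has been emitted on entry, so d
  -- - 1 further bits lead back to w₀, where `g` turns to the parent.
  module Leaf (p : Str) (a : Bool) (q : Str) (len : length (p ++ a ∷ q) ≡ n)
    (periodic : isPeriodic (p ++ a ∷ q) ≡ true) (up : Edge n a (q ++ p)) where

    private
      α w₀ w : Str
      α  = p ++ a ∷ q
      w₀ = a ∷ q ++ p
      w  = (q ++ p) ++ a ∷ []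
      pos : 0 < length α
      pos = subst (0 <_) (sym len) (n>0 n 6≤n)
      α~w₀ : α ~ w₀
      α~w₀ = ~-swap p (a ∷ q)
      open ApSpec (apSpec α pos) using (d; ap≡; d>0; d≤n; period; least)
      d′ = d ∸ 1
      d≡ : suc d′ ≡ d
      d≡ = m+[n∸m]≡n d>0

    noDown : ∀ {b x} → b ∷ x ~ α → ¬ Edge n (not b) x
    noDown {b} {x} s E = isPeriodic⁻ {α} pos periodic (parent-aperiodic {α} {neck (not b ∷ x)} (child∈A E)
      (trans (parent≡ E) (trans (cong (λ c → neck (c ∷ x)) (not-involutive b)) (neck-cong s))))

    keep : ∀ {k} → k < d′ → g n (rotate k w) ≡ bit w k
    keep {k} k<d′ = go (rotate (suc k) w₀) refl
      where
      go : ∀ v → rotate (suc k) w₀ ≡ v → g n v ≡ first v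
      go [] e = ⊥-elim (<⇒≢ (n>0 n 6≤n) (trans (sym (~-length (suc k , e))) (trans (sym (~-length α~w₀)) len)))
      go (b ∷ x) e = decide b noUp (noDown v~α)
        where
        v~α : b ∷ x ~ α
        v~α = ~-trans (~-sym (suc k , e)) (~-sym α~w₀)
        len-x : suc (length x) ≡ n
        len-x = trans (~-length v~α) len
        -- By `Edge-unique` the edge to the parent belongs to the window w₀ alone; meeting it again
        -- after fewer than d steps would be a shorter period.
        noUp : ¬ Edge n b x
        noUp E = least (suc k) (s≤s z≤n) (subst (suc k <_) d≡ (s≤s k<d′)) (period-~ (suc k) (~-sym α~w₀) (trans e (cong₂ _∷_ (proj₁ same) (proj₂ same))))
          where
          same : b ≡ a × x ≡ q ++ p
          same = Edge-unique n 6≤n up E (neck-cong (suc k , e))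
        decide : ∀ c → ¬ Edge n c x → ¬ Edge n (not c) x → g n (c ∷ x) ≡ c
        decide true  u d = g-keep n 6≤n len-x u d true
        decide false u d = g-keep n 6≤n len-x d u false

    node : Node n 6≤n (Good n 6≤n) p a q
    node = record
      { U = ap α ; tree = leaf periodic
      ; E = applyUpTo (bit w) d′ ; vs = vs
      ; run = subst₂ (λ v v′ → Run n 6≤n v (applyUpTo (bit w) d′) vs v′) (++-assoc q p (a ∷ []))
          (trans (cong (λ k → rotate k w₀) d≡) (period-~ d α~w₀ period)) (run-rotate d′ w (subst (0 <_) (sym lw) (s≤s z≤n)) keep)
      ; emit = emit
      ; good = All-applyUpTo⁺ (λ k → rotate k w) d′ (λ {k} _ → good k)
      ; cover = cover }
      where
      vs : List Str
      vs = applyUpTo (λ k → rotate k w) d′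
      lw : length w ≡ suc (length (q ++ p))
      lw = length-rotate₁ w₀
      good : ∀ k → Good n 6≤n (rotate k w)
      good k = subst (λ v → inA n v ≡ true) neck≡ (child∈A up) , λ r → child≢root up (trans neck≡ r)
        where
        neck≡ : neck w₀ ≡ neck (rotate k w)
        neck≡ = neck-cong (suc k , refl)
      emit : p ++ a ∷ applyUpTo (bit w) d′ ≡ ap α ++ p
      emit = begin
        p ++ applyUpTo (bit w₀) (suc d′) ≡⟨ cong₂ (λ u k → u ++ applyUpTo (bit w₀) k) p≡ d≡ ⟩
        applyUpTo (bit α) lp ++ applyUpTo (bit w₀) d ≡⟨ cong (applyUpTo (bit α) lp ++_) (applyUpTo-cong d (λ {k} _ → sym (bit-++ p (a ∷ q) k))) ⟩
        applyUpTo (bit α) lp ++ applyUpTo (λ k → bit α (lp + k)) d ≡⟨ sym (applyUpTo-++ (bit α) lp d) ⟩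
        applyUpTo (bit α) (lp + d) ≡⟨ cong (applyUpTo (bit α)) (+-comm lp d) ⟩
        applyUpTo (bit α) (d + lp) ≡⟨ applyUpTo-++ (bit α) d lp ⟩
        applyUpTo (bit α) d ++ applyUpTo (λ k → bit α (d + k)) lp ≡⟨ cong₂ _++_ (sym (trans ap≡ (take-bit α d d≤n)))
                                                                    (trans (applyUpTo-cong lp (λ {k} _ → bit-period {α} {d} period k)) (sym p≡)) ⟩
        ap α ++ p ∎
        where
        open ≡-Reasoning
        lp = length p
        p≡ : p ≡ applyUpTo (bit α) lp
        p≡ = trans (sym (take-++ p (a ∷ q))) (take-bit α lp (<⇒≤ (length-position p a q)))
      cover : ∀ {γ} → Desc n 6≤n (neck α) γ → ∀ {ρ} → γ ~ ρ → ρ ∈ vs ++ w₀ ∷ []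
      cover (down {γ₁} e≡ _ par≡ _) _ = ⊥-elim (isPeriodic⁻ {α} pos periodic (parent-aperiodic {α} {γ₁} e≡ par≡))
      cover self {ρ} s = go (k % suc d′) (m%n<n k (suc d′)) (trans (sym rot≡) (proj₂ w₀~ρ))
        where
        w₀~ρ : w₀ ~ ρ
        w₀~ρ = ~-trans (~-sym α~w₀) (~-trans (neck-~ α) s)
        k = proj₁ w₀~ρ
        rot≡ : rotate k w₀ ≡ rotate (k % suc d′) w₀
        rot≡ = trans (cong (λ m → rotate m w₀) (trans (m≡m%n+[m/n]*n k (suc d′)) (+-comm (k % suc d′) (k / suc d′ * suc d′))))
          (trans (rotate-+ (k / suc d′ * suc d′) (k % suc d′) w₀) (cong (rotate (k % suc d′))
            (rotate-* (k / suc d′) (trans (cong (λ j → rotate j w₀) d≡) (period-~ d α~w₀ period)))))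
        go : ∀ r → r < suc d′ → rotate r w₀ ≡ ρ → ρ ∈ vs ++ w₀ ∷ []
        go zero    _        f = ∈-++⁺ʳ vs (here (sym f))
        go (suc r) (s≤s r<) f = ∈-++⁺ˡ (subst (_∈ vs) f (∈-applyUpTo⁺ (λ k → rotate k w) r<))

  -- The recursion is on `μ` of the label, which drops from a label to its children by `edge-μ`.
  build : ∀ M p a q → μ n (neck (p ++ a ∷ q)) ≡ M → length (p ++ a ∷ q) ≡ n → Edge n a (q ++ p) → Node n 6≤n (Good n 6≤n) p a q
  build = <-rec _ go
    where
    go : ∀ M → (∀ {M′} → M′ < M → ∀ p a q → μ n (neck (p ++ a ∷ q)) ≡ M′ → length (p ++ a ∷ q) ≡ n → Edge n a (q ++ p) → Node n 6≤n (Good n 6≤n) p a q) →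
      ∀ p a q → μ n (neck (p ++ a ∷ q)) ≡ M → length (p ++ a ∷ q) ≡ n → Edge n a (q ++ p) → Node n 6≤n (Good n 6≤n) p a q
    go M rec p a q M≡ len up with bool-cases (isPeriodic (p ++ a ∷ q))
    ... | inj₁ periodic = Leaf.node p a q len periodic up
    ... | inj₂ aper = Inner.node (Good n 6≤n) p a q len aper (λ x → x) child noUp own (edge-acyclic up)
      where
      α = p ++ a ∷ q
      neck-pos : ∀ p′ b q′ → α ≡ p′ ++ b ∷ q′ → neck (a ∷ q ++ p) ≡ neck (b ∷ q′ ++ p′)
      neck-pos p′ b q′ e = neck-cong (~-trans (~-swap (a ∷ q) p) (~-trans (~-reflexive e) (~-swap p′ (b ∷ q′))))
      child : ∀ p′ b q′ → α ≡ p′ ++ b ∷ q′ → childOK n α (suc (length p′)) ≡ true → Node n 6≤n (Good n 6≤n) p′ (not b) q′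
      child p′ b q′ e ok = rec smaller p′ (not b) q′ refl (trans (length-flip p′ (not b) b q′) (trans (cong length (sym e)) len)) E
        where
        E : Edge n (not b) (q′ ++ p′)
        E = childOK⇒Edge n 6≤n p′ b q′ (trans (cong (λ w → childOK n w (suc (length p′))) (sym e)) ok)
        smaller : μ n (neck (p′ ++ not b ∷ q′)) < M
        smaller = subst₂ _<_ (cong (μ n) (neck-cong (~-swap (not b ∷ q′) p′)))
          (trans (cong (μ n) (trans (cong (λ c → neck (c ∷ q′ ++ p′)) (not-involutive b)) (neck-cong (~-trans (~-swap (b ∷ q′) p′) (~-reflexive (sym e)))))) M≡)
          (edge-μ E)
      -- A second position with an edge to the parent would show the same window as the change bit,
      -- which an aperiodic label excludes.
      noUp : ∀ p′ b q′ → α ≡ p′ ++ b ∷ q′ → length p′ ≢ length p → ¬ Edge n b (q′ ++ p′)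
      noUp p′ b q′ e l≢ E = l≢ (aperiodic-injective (isPeriodic⁺ {α} aper)
          (subst (λ w → length p′ < length w) (sym e) (length-position p′ b q′)) (length-position p a q)
          (trans (cong (rotate (length p′)) e) (trans (rotate-position p′ b q′) (trans (cong₂ _∷_ (proj₁ same) (proj₂ same)) (sym (rotate-position p a q))))))
        where
        same : b ≡ a × q′ ++ p′ ≡ q ++ p
        same = Edge-unique n 6≤n up E (neck-pos p′ b q′ e)
      own : ∀ p′ b q′ → α ≡ p′ ++ b ∷ q′ → length p′ ≢ length p → Good n 6≤n (b ∷ q′ ++ p′)
      own p′ b q′ e _ = subst (λ v → inA n v ≡ true) (neck-pos p′ b q′ e) (child∈A up) , λ r → child≢root up (trans (neck-pos p′ b q′ e) r)

-- Enumerating S(n)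

∈-allStrs : ∀ x → x ∈ allStrs (length x)
∈-allStrs []          = here refl
∈-allStrs (false ∷ x) = ∈-++⁺ˡ (∈-map⁺ (false ∷_) (∈-allStrs x))
∈-allStrs (true ∷ x)  = ∈-++⁺ʳ (map (false ∷_) (allStrs (length x))) (∈-map⁺ (true ∷_) (∈-allStrs x))

allStrs-unique : ∀ n → Unique (allStrs n)
allStrs-unique zero    = All.[] AllPairs.∷ AllPairs.[]
allStrs-unique (suc n) = Unique-++⁺ (Unique-map⁺ ∷-injectiveʳ (allStrs-unique n)) (Unique-map⁺ ∷-injectiveʳ (allStrs-unique n)) disjoint
  where
  disjoint : Disjoint (map (false ∷_) (allStrs n)) (map (true ∷_) (allStrs n))
  disjoint (i , j) with ∈-map⁻ (false ∷_) i | ∈-map⁻ (true ∷_) j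
  ... | _ , _ , refl | _ , _ , ()

∈-Alist⁺ : ∀ {n γ} → length γ ≡ n → inA n γ ≡ true → γ ∈ Alist n
∈-Alist⁺ {n} {γ} refl e = ∈-filter⁺ (T? ∘ inA n) (∈-allStrs γ) (Equivalence.from T-≡ e)

∈-Alist⁻ : ∀ {n γ} → γ ∈ Alist n → inA n γ ≡ true
∈-Alist⁻ {n} {γ} i = Equivalence.to T-≡ (proj₂ (∈-filter⁻ (T? ∘ inA n) {v = γ} {xs = allStrs n} i))

Alist-unique : ∀ n → Unique (Alist n)
Alist-unique n = Unique-filter⁺ (T? ∘ inA n) (allStrs-unique n)

-- These are the distinct rotations of γ, so over A(n) they add up to `L n` strings.
orbit : Str → List Str
orbit γ = applyUpTo (λ k → rotate k γ) (length (ap γ))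

orbits : List Str → List Str
orbits xs = concat (map orbit xs)

length-orbits : ∀ xs → length (orbits xs) ≡ sum (map (λ α → length (ap α)) xs)
length-orbits []       = refl
length-orbits (γ ∷ xs) = trans (length-++ (orbit γ)) (cong₂ _+_ (length-applyUpTo (λ k → rotate k γ) (length (ap γ))) (length-orbits xs))

length-ap : ∀ {γ} (s : ApSpec γ) → length (ap γ) ≡ ApSpec.d s
length-ap {γ} s = trans (cong length (ApSpec.ap≡ s)) (trans (length-take (ApSpec.d s) γ) (m≤n⇒m⊓n≡m (ApSpec.d≤n s)))

orbit-unique : ∀ {γ} → 0 < length γ → Unique (orbit γ)
orbit-unique {γ} pos = Unique-applyUpTo⁺ (λ k → rotate k γ) (length (ap γ))
  (λ i<j j<d → rotate-distinct (ApSpec.least s) i<j (subst (_ <_) (length-ap s) j<d))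
  where s = apSpec γ pos

∈-orbit⁻ : ∀ {γ w} → w ∈ orbit γ → γ ~ w
∈-orbit⁻ {γ} i with ∈-applyUpTo⁻ (λ k → rotate k γ) i
... | k , _ , refl = k , refl

∈-orbit⁺ : ∀ {γ w} → 0 < length γ → γ ~ w → w ∈ orbit γ
∈-orbit⁺ {γ} pos (k , refl) = go (ApSpec.d s) (ApSpec.d>0 s) (length-ap s) (ApSpec.period s)
  where
  s = apSpec γ pos
  go : ∀ d → 0 < d → length (ap γ) ≡ d → rotate d γ ≡ γ → rotate k γ ∈ orbit γ
  go (suc d) _ l≡ per = subst (_∈ orbit γ) (sym rot≡)
    (∈-applyUpTo⁺ (λ k → rotate k γ) (subst (k % suc d <_) (sym l≡) (m%n<n k (suc d))))
    where
    rot≡ : rotate k γ ≡ rotate (k % suc d) γ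
    rot≡ = trans (cong (λ m → rotate m γ) (trans (m≡m%n+[m/n]*n k (suc d)) (+-comm (k % suc d) (k / suc d * suc d))))
      (trans (rotate-+ (k / suc d * suc d) (k % suc d) γ) (cong (rotate (k % suc d)) (rotate-* (k / suc d) per)))

orbits-unique : ∀ {xs} → Unique xs → (∀ {γ} → γ ∈ xs → IsA γ × 0 < length γ) → Unique (orbits xs)
orbits-unique {[]}     _ _ = AllPairs.[]
orbits-unique {γ ∷ xs} (γ∉ AllPairs.∷ u) f = Unique-++⁺ (orbit-unique (proj₂ (f (here refl)))) (orbits-unique u (λ i → f (there i))) disjoint
  where
  distinct : ∀ {γ′ ys} → All (γ ≢_) ys → γ′ ∈ ys → γ ≢ γ′
  distinct (p All.∷ _)  (here refl) = p
  distinct (_ All.∷ ps) (there i)   = distinct ps i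
  disjoint : Disjoint (orbit γ) (orbits xs)
  disjoint {w} (i , j) with ∈-concat⁻′ (map orbit xs) j
  ... | _ , k , l with ∈-map⁻ orbit l
  ...   | γ′ , m , refl = distinct γ∉ m (trans (sym (neck-IsA (proj₁ (f (here refl)))))
            (trans (neck-cong (~-trans (∈-orbit⁻ i) (~-sym (∈-orbit⁻ k)))) (neck-IsA (proj₁ (f (there m))))))

-- Cyclic windows

drop-applyUpTo : ∀ {A : Set} i N (f : ℕ → A) → drop i (applyUpTo f N) ≡ applyUpTo (λ x → f (i + x)) (N ∸ i)
drop-applyUpTo zero    N       f = refl
drop-applyUpTo (suc i) zero    f = refl
drop-applyUpTo (suc i) (suc N) f = drop-applyUpTo i N (λ x → f (suc x))

take-applyUpTo : ∀ {A : Set} k N (f : ℕ → A) → k ≤ N → take k (applyUpTo f N) ≡ applyUpTo f k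
take-applyUpTo zero    N       f _       = refl
take-applyUpTo (suc k) (suc N) f (s≤s p) = cong (f 0 ∷_) (take-applyUpTo k N (λ x → f (suc x)) p)

window-bits : ∀ n s i → i < length s → window n s i ≡ applyUpTo (λ x → bit s (i + x)) n
window-bits n s i i<N = begin
  take n (drop i (pow s (suc (suc n)))) ≡⟨ cong (λ w → take n (drop i w)) pow≡ ⟩
  take n (drop i (applyUpTo (bit s) (suc (suc n) * N))) ≡⟨ cong (take n) (drop-applyUpTo i (suc (suc n) * N) (bit s)) ⟩
  take n (applyUpTo (λ x → bit s (i + x)) (suc (suc n) * N ∸ i)) ≡⟨ take-applyUpTo n _ (λ x → bit s (i + x)) enough ⟩
  applyUpTo (λ x → bit s (i + x)) n ∎
  where
  open ≡-Reasoning
  N = length s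
  pow≡ : pow s (suc (suc n)) ≡ applyUpTo (bit s) (suc (suc n) * N)
  pow≡ = trans (cong (λ w → pow w (suc (suc n))) (bits s)) (sym (applyUpTo-pow (bit s) N (suc (suc n)) (bit-period {s} {N} (rotate-length s))))
  -- One copy of `s` makes up for the offset i, and n nonempty copies hold n bits.
  enough : n ≤ suc (suc n) * N ∸ i
  enough = ≤-trans (≤-trans (subst (_≤ n * N) (*-identityʳ n) (*-monoʳ-≤ n (≤-trans (s≤s z≤n) i<N)))
    (≤-trans (m≤n+m (n * N) N) (≤-reflexive (sym (m+n∸m≡n N (N + n * N)))))) (∸-monoʳ-≤ (suc (suc n) * N) (<⇒≤ i<N))

-- The start index is -(i + n) modulo the length: the window at i ends at i + n - 1, and reversal
-- sends this end to -1 - (i + n - 1).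
window-reverse : ∀ n s m → length s ≡ suc m → ∀ {i} → i < suc m →
  reverse (window n (reverse s) i) ≡ window n s ((m * (i + n)) % suc m)
window-reverse n s m len {i} i<N = begin
  reverse (window n (reverse s) i) ≡⟨ cong reverse (window-bits n (reverse s) i (subst (i <_) (sym (trans (length-reverse s) len)) i<N)) ⟩
  reverse (applyUpTo (λ x → bit (reverse s) (i + x)) n) ≡⟨ reverse-applyUpTo (λ x → bit (reverse s) (i + x)) n ⟩
  applyDownFrom (λ x → bit (reverse s) (i + x)) n ≡⟨ applyDownFrom-applyUpTo (λ x → bit (reverse s) (i + x)) n ⟩
  applyUpTo (λ x → bit (reverse s) (i + (n ∸ suc x))) n ≡⟨ applyUpTo-cong n (λ {x} → pointwise x) ⟩
  applyUpTo (λ x → bit s (k + x)) n ≡⟨ sym (window-bits n s k (subst (k <_) (sym len) (m%n<n (m * (i + n)) (suc m)))) ⟩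
  window n s k ∎
  where
  open ≡-Reasoning
  k = (m * (i + n)) % suc m
  shift : ∀ y c → bit s y ≡ bit s (y + c * suc m)
  shift y c = trans (sym (bit-+period s y c)) (cong (λ l → bit s (y + c * l)) len)
  pointwise : ∀ x → x < n → bit (reverse s) (i + (n ∸ suc x)) ≡ bit s (k + x)
  pointwise x x<n = begin
    bit (reverse s) (i + y) ≡⟨ bit-reverse s m len (i + y) ⟩
    bit s (m + m * (i + y)) ≡⟨ shift (m + m * (i + y)) x ⟩
    bit s (m + m * (i + y) + x * suc m) ≡⟨ cong (bit s) (ring₁ m i y x) ⟩
    bit s (m * (i + (suc x + y)) + x) ≡⟨ cong (λ z → bit s (m * (i + z) + x)) (m+[n∸m]≡n x<n) ⟩
    bit s (m * (i + n) + x) ≡⟨ cong (λ z → bit s (z + x)) (m≡m%n+[m/n]*n (m * (i + n)) (suc m)) ⟩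
    bit s (k + c * suc m + x) ≡⟨ cong (bit s) (ring₂ k (c * suc m) x) ⟩
    bit s (k + x + c * suc m) ≡⟨ sym (shift (k + x) c) ⟩
    bit s (k + x) ∎
    where
    y = n ∸ suc x
    c = (m * (i + n)) / suc m
    ring₁ : ∀ m i y x → m + m * (i + y) + x * suc m ≡ m * (i + (suc x + y)) + x
    ring₁ = solve-∀
    ring₂ : ∀ k c x → k + c + x ≡ k + x + c
    ring₂ = solve-∀

-- Both sides are negatives modulo `suc m`, so equality would make the difference `suc o` of the
-- indices divisible by `suc m`, although 0 < `suc o` < `suc m`.
reflection-injective : ∀ m n {i j} → i < j → j < suc m → (m * (i + n)) % suc m ≢ (m * (j + n)) % suc m
reflection-injective m n {i} i<j j<N e with m≤n⇒∃[o]m+o≡n i<j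
... | o , refl with %-elim m {m * (i + n)} {m * (suc i + o + n)} e
...   | a , b , q = 1+n≢0 (trans (sym (m<n⇒m%n≡m o<N)) (%-intro m {suc o} {0} (a + (i + n)) (b + (i + n) + suc o)
          (trans (ring₁ m i n o a) (trans (cong (λ z → suc (i + o) + n + z) q) (ring₂ m i n o b)))))
  where
  o<N : suc o < suc m
  o<N = ≤-trans (s≤s (s≤s (m≤n+m o i))) j<N
  ring₁ : ∀ m i n o a → suc o + (a + (i + n)) * suc m ≡ suc (i + o) + n + (m * (i + n) + a * suc m)
  ring₁ = solve-∀
  ring₂ : ∀ m i n o b → suc (i + o) + n + (m * (suc i + o + n) + b * suc m) ≡ 0 + (b + (i + n) + suc o) * suc m
  ring₂ = solve-∀

take-drop-++ : ∀ {A : Set} i n (X Y : List A) → i + n ≤ length X → take n (drop i (X ++ Y)) ≡ take n (drop i X)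
take-drop-++ zero    zero    X       Y p       = refl
take-drop-++ zero    (suc n) (x ∷ X) Y (s≤s p) = cong (x ∷_) (take-drop-++ zero n X Y p)
take-drop-++ (suc i) n       (x ∷ X) Y (s≤s p) = take-drop-++ i n X Y p

headM-drop-++ : ∀ k (X Y : Str) → k < length X → headM (drop k (X ++ Y)) ≡ headM (drop k X)
headM-drop-++ zero    (x ∷ X) Y _       = refl
headM-drop-++ (suc k) (x ∷ X) Y (s≤s p) = headM-drop-++ k X Y p

-- The closed walk at the root

module Root (n : ℕ) (6≤n : 6 ≤ n) where

  next : Str → Str
  next []      = []
  next (a ∷ x) = x ++ g n (a ∷ x) ∷ []

  iter : ℕ → Str → Str
  iter zero    w = w
  iter (suc k) w = iter k (next w)

  iter-+ : ∀ j k w → iter (j + k) w ≡ iter k (iter j w)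
  iter-+ zero    k w = refl
  iter-+ (suc j) k w = iter-+ j k (next w)

  run-iter : ∀ {w e vs w′} → Run n 6≤n w e vs w′ → vs ≡ applyUpTo (λ i → iter i w) (length e) × iter (length e) w ≡ w′
  run-iter stop            = refl , refl
  run-iter (move b refl r) with run-iter r
  ... | p , q = cong (_ ∷_) p , q

  -- Each step drops the front bit of the window and appends the emitted one, so the states are the
  -- windows of the string w e. `more` leaves room for further copies of the output.
  run-windows : ∀ {w e vs w′} → Run n 6≤n w e vs w′ → length w ≡ n → ∀ more → let z = w ++ e ++ more in
    vs ≡ applyUpTo (λ i → take n (drop i z)) (length e) ×
    (∀ {i} → i < length e → headM (drop (i + n) z) ≡ just (g n (take n (drop i z))))
  run-windows stop len more = refl , λ ()
  run-windows (move {a} {x} {e} {vs} b f r) len more with run-windows r (trans (length-rotate₁ (b ∷ x)) len) more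
  ... | p , q = cong₂ _∷_ (sym first-window) (trans p (applyUpTo-cong (length e) (λ {i} _ → cong (λ w → take n (drop i w)) assoc))) , succ
    where
    assoc : (x ++ b ∷ []) ++ e ++ more ≡ x ++ b ∷ e ++ more
    assoc = ++-assoc x (b ∷ []) (e ++ more)
    first-window : take n (a ∷ x ++ b ∷ e ++ more) ≡ a ∷ x
    first-window = trans (cong (λ k → take k (a ∷ x ++ b ∷ e ++ more)) (sym len)) (take-++ (a ∷ x) (b ∷ e ++ more))
    succ : ∀ {i} → i < suc (length e) →
      headM (drop (i + n) (a ∷ x ++ b ∷ e ++ more)) ≡ just (g n (take n (drop i (a ∷ x ++ b ∷ e ++ more))))
    succ {zero} _ = trans (cong headM (trans (cong (λ k → drop k (a ∷ x ++ b ∷ e ++ more)) (sym len)) (drop-++ (a ∷ x) (b ∷ e ++ more))))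
      (cong just (trans (sym f) (cong (g n) (sym first-window))))
    succ {suc i} (s≤s i<) = subst (λ w → headM (drop (i + n) w) ≡ just (g n (take n (drop i w)))) assoc (q i<)

  -- The root has change index n: its label consists of `p`, the change bit 1 and an empty rest.
  p : Str
  p = zeros (n ∸ 4) ++ true ∷ false ∷ true ∷ []

  ρ : Str
  ρ = p ++ true ∷ []

  ρ≡root : ρ ≡ root n
  ρ≡root = ++-assoc (zeros (n ∸ 4)) (true ∷ false ∷ true ∷ []) (true ∷ [])

  length-ρ : length ρ ≡ n
  length-ρ = trans (cong length ρ≡root) (length-root n 6≤n)

  length-p : suc (length p) ≡ n
  length-p = trans (+-comm 1 (length p)) (trans (sym (length-++ p)) length-ρ)

  root∈A : inA n (root n) ≡ true
  root∈A = inA⁺ (length-root n 6≤n) (root-IsA n 6≤n)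

  neck-root : ∀ {w} → w ~ ρ → neck w ≡ root n
  neck-root s = neck-unique (~-trans s (~-reflexive ρ≡root)) (necklace (root-IsA n 6≤n))

  root-aperiodic : Aperiodic (root n)
  root-aperiodic = go n 6≤n
    where
    go : ∀ n → 6 ≤ n → Aperiodic (root n)
    go _ (s≤s (s≤s (s≤s (s≤s (s≤s (s≤s {n = m} z≤n)))))) = primitive⇒aperiodic (Block-primitive (root-Block m))

  ρ-aperiodic : Aperiodic ρ
  ρ-aperiodic = subst Aperiodic (sym ρ≡root) root-aperiodic

  -- The rotation of the root that starts at its change bit. Keeping that bit, `g` leads from here
  -- to ρ and closes the walk.
  w⋆ : Str
  w⋆ = true ∷ p

  InA≢w⋆ : Str → Set
  InA≢w⋆ w = inA n (neck w) ≡ true × w ≢ w⋆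

  position~ρ : ∀ p′ b q′ → ρ ≡ p′ ++ b ∷ q′ → b ∷ q′ ++ p′ ~ ρ
  position~ρ p′ b q′ e = ~-trans (~-swap (b ∷ q′) p′) (~-reflexive (sym e))

  -- Complementing the last bit of the root gives 0ⁿ⁻⁴1010, a rotation of the symmetric string
  -- 0ⁿ⁻³101.
  noSelf : ¬ Edge n false p
  noSelf E = flipped-root-symmetric n 6≤n (~-trans (~-reflexive (sym (++-assoc (zeros (n ∸ 4)) (true ∷ false ∷ true ∷ []) (false ∷ []))))
    (~-trans (~-swap p (false ∷ [])) (neck-~ (false ∷ p)))) (edge-IsA n 6≤n E)

  noUp : ∀ p′ b q′ → ρ ≡ p′ ++ b ∷ q′ → ¬ Edge n b (q′ ++ p′)
  noUp p′ b q′ e E = child≢root E (neck-root (position~ρ p′ b q′ e))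

  -- Windows below the root differ from `w⋆` because their necklace is not the root; windows of the
  -- root itself at positions other than the change bit differ from it because the root is
  -- aperiodic.
  rootNode : Node n 6≤n InA≢w⋆ p true []
  rootNode = Inner.node n 6≤n InA≢w⋆ p true [] length-ρ (≢true⇒false (λ e → isPeriodic⁻ {ρ} ρ>0 e ρ-aperiodic))
    (λ { {w} (e , w≢root) → e , λ { refl → w≢root (neck-root (~-swap (true ∷ []) p)) } })
    (λ p′ b q′ e ok → build n 6≤n _ p′ (not b) q′ refl (trans (length-flip p′ (not b) b q′) (trans (cong length (sym e)) length-ρ))
      (childOK⇒Edge n 6≤n p′ b q′ (trans (cong (λ w → childOK n w (suc (length p′))) (sym e)) ok)))
    (λ p′ b q′ e _ → noUp p′ b q′ e)
    (λ p′ b q′ e l≢ → trans (cong (inA n) (neck-root (position~ρ p′ b q′ e))) root∈A , λ w≡ →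
      l≢ (aperiodic-injective ρ-aperiodic (subst (λ w → length p′ < length w) (sym e) (length-position p′ b q′)) (length-position p true [])
        (trans (cong (rotate (length p′)) e) (trans (rotate-position p′ b q′) (trans w≡ (sym (rotate-position p true [])))))))
    noSelf
    where
    ρ>0 : 0 < length ρ
    ρ>0 = subst (0 <_) (sym length-ρ) (n>0 n 6≤n)

module Traversal (n : ℕ) (6≤n : 6 ≤ n) (N : Node n 6≤n (Root.InA≢w⋆ n 6≤n) (Root.p n 6≤n) true []) where
  open Root n 6≤n
  module N = Node N

  s e : Str
  s = N.U
  e = N.E ++ true ∷ []

  V : List Str
  V = N.vs ++ w⋆ ∷ []

  keep⋆ : g n w⋆ ≡ true
  keep⋆ = g-keep n 6≤n length-p (noUp p true [] refl) noSelf true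

  loop : Run n 6≤n ρ e V ρ
  loop = run-++ n 6≤n N.run (move true keep⋆ stop)

  -- The walk starts with the window ρ already read, so its output e runs n bits ahead of the
  -- traversal s.
  ρe≡sρ : ρ ++ e ≡ s ++ ρ
  ρe≡sρ = begin
    (p ++ true ∷ []) ++ N.E ++ true ∷ [] ≡⟨ ++-assoc p (true ∷ []) (N.E ++ true ∷ []) ⟩
    p ++ (true ∷ N.E) ++ true ∷ []       ≡⟨ sym (++-assoc p (true ∷ N.E) (true ∷ [])) ⟩
    (p ++ true ∷ N.E) ++ true ∷ []       ≡⟨ cong (_++ true ∷ []) N.emit ⟩
    (s ++ p) ++ true ∷ []                ≡⟨ ++-assoc s p (true ∷ []) ⟩
    s ++ ρ ∎
    where open ≡-Reasoning

  length-e : length e ≡ length s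
  length-e = +-cancelˡ-≡ (length ρ) _ _ (trans (sym (length-++ ρ)) (trans (cong length ρe≡sρ) (trans (length-++ s) (+-comm (length s) (length ρ)))))

  length-e-suc : length e ≡ suc (length N.E)
  length-e-suc = trans (length-++ N.E) (+-comm (length N.E) 1)

  -- This carries the cyclic windows of s over to the string ρ e e ⋯, in which `run-windows` finds
  -- the states of the walk.
  pow-shift : ∀ k → pow s k ++ ρ ≡ ρ ++ pow e k
  pow-shift zero    = sym (++-identityʳ ρ)
  pow-shift (suc k) = begin
    (s ++ pow s k) ++ ρ ≡⟨ ++-assoc s (pow s k) ρ ⟩
    s ++ pow s k ++ ρ   ≡⟨ cong (s ++_) (pow-shift k) ⟩
    s ++ ρ ++ pow e k   ≡⟨ sym (++-assoc s ρ (pow e k)) ⟩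
    (s ++ ρ) ++ pow e k ≡⟨ cong (_++ pow e k) (sym ρe≡sρ) ⟩
    (ρ ++ e) ++ pow e k ≡⟨ ++-assoc ρ e (pow e k) ⟩
    ρ ++ e ++ pow e k ∎
    where open ≡-Reasoning

  z : Str
  z = ρ ++ e ++ pow e (suc n)

  long-enough : ∀ {i} → i < length s → i + n < length (pow s (suc (suc n)))
  long-enough {i} i<N = subst (i + n <_) (sym (length-pow s (suc (suc n)))) (+-mono-<-≤ i<N
    (≤-trans (subst (_≤ n * length s) (*-identityʳ n) (*-monoʳ-≤ n (≤-trans (s≤s z≤n) i<N))) (m≤n+m (n * length s) (length s))))

  window≡ : ∀ {i} → i < length s → window n s i ≡ take n (drop i z)
  window≡ {i} i<N = trans (sym (take-drop-++ i n (pow s (suc (suc n))) ρ (<⇒≤ (long-enough i<N)))) (cong (λ w → take n (drop i w)) (pow-shift (suc (suc n))))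

  nextBit≡ : ∀ {i} → i < length s → nextBit n s i ≡ just (g n (window n s i))
  nextBit≡ {i} i<N = begin
    headM (drop (i + n) (pow s (suc (suc n))))      ≡⟨ sym (headM-drop-++ (i + n) (pow s (suc (suc n))) ρ (long-enough i<N)) ⟩
    headM (drop (i + n) (pow s (suc (suc n)) ++ ρ)) ≡⟨ cong (λ w → headM (drop (i + n) w)) (pow-shift (suc (suc n))) ⟩
    headM (drop (i + n) z)                          ≡⟨ proj₂ (run-windows loop length-ρ (pow e (suc n))) (subst (i <_) (sym length-e) i<N) ⟩
    just (g n (take n (drop i z)))                  ≡⟨ cong (λ w → just (g n w)) (sym (window≡ i<N)) ⟩
    just (g n (window n s i)) ∎
    where open ≡-Reasoning

  windows≡V : windows n s ≡ V
  windows≡V = begin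
    windows n s ≡⟨ map-upTo (window n s) (length s) ⟩
    applyUpTo (window n s) (length s) ≡⟨ applyUpTo-cong (length s) window≡ ⟩
    applyUpTo (λ i → take n (drop i z)) (length s) ≡⟨ cong (applyUpTo (λ i → take n (drop i z))) (sym length-e) ⟩
    applyUpTo (λ i → take n (drop i z)) (length e) ≡⟨ sym (proj₁ (run-windows loop length-ρ (pow e (suc n)))) ⟩
    V ∎
    where open ≡-Reasoning

  window-iter : ∀ {i} → i < length s → window n s i ≡ iter i ρ
  window-iter = applyUpTo-injective {f = window n s} {h = λ i → iter i ρ} (length s)
    (trans (sym (map-upTo (window n s) (length s))) (trans windows≡V (trans (proj₁ (run-iter loop)) (cong (applyUpTo (λ i → iter i ρ)) length-e))))

  iter-last : iter (length N.E) ρ ≡ w⋆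
  iter-last = proj₂ (run-iter N.run)

  iter≢w⋆ : ∀ {i} → i < length N.E → iter i ρ ≢ w⋆
  iter≢w⋆ i< = proj₂ (All-applyUpTo⁻ (λ i → iter i ρ) (length N.E) (subst (All InA≢w⋆) (proj₁ (run-iter N.run)) N.good) i<)

  -- Two equal windows would make w⋆, the last state before the loop closes, occur earlier.
  iter-distinct : ∀ {i j} → i < j → j < length s → iter i ρ ≢ iter j ρ
  iter-distinct {i} {j} i<j j<N eq with m≤n⇒∃[o]m+o≡n (≤-pred (subst (j <_) (trans (sym length-e) length-e-suc) j<N))
  ... | k , j+k = iter≢w⋆ (subst (i + k <_) j+k (+-monoˡ-< k i<j)) (begin
          iter (i + k) ρ       ≡⟨ iter-+ i k ρ ⟩
          iter k (iter i ρ)    ≡⟨ cong (iter k) eq ⟩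
          iter k (iter j ρ)    ≡⟨ sym (iter-+ j k ρ) ⟩
          iter (j + k) ρ       ≡⟨ cong (λ l → iter l ρ) j+k ⟩
          iter (length N.E) ρ  ≡⟨ iter-last ⟩
          w⋆ ∎)
    where open ≡-Reasoning

  windows-distinct : ∀ {i j} → i < j → j < length s → window n s i ≢ window n s j
  windows-distinct i<j j<N eq = iter-distinct i<j j<N (trans (sym (window-iter (<-trans i<j j<N))) (trans eq (window-iter j<N)))

  windows-unique : Unique (windows n s)
  windows-unique = subst Unique (sym (map-upTo (window n s) (length s))) (Unique-applyUpTo⁺ (window n s) (length s) windows-distinct)

  V-inA : ∀ {w} → w ∈ V → inA n (neck w) ≡ true
  V-inA i with ∈-++⁻ N.vs i
  ... | inj₁ j = proj₁ (All.lookup N.good j)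
  ... | inj₂ (here refl) = trans (cong (inA n) (neck-root (~-swap (true ∷ []) p))) root∈A

  window-inA : ∀ {i} → i < length s → inA n (neck (window n s i)) ≡ true
  window-inA {i} i<N = V-inA (subst (window n s i ∈_) windows≡V (∈-map⁺ (window n s) (∈-upTo⁺ i<N)))

  neck-length : ∀ {w} → inA n (neck w) ≡ true → length (neck w) ≡ n
  neck-length {w} h = proj₁ (inA⁻ {γ = neck w} (n>0 n 6≤n) h)

  successor : SuccessorRule n s
  successor i i<N = any⁺ (λ γ → any (eqS w) (rotations γ)) {neck w} {Alist n} (∈-Alist⁺ {n} {neck w} (neck-length {w} h) h)
      (any⁺ (eqS w) (∈-rotations⁺ (subst (0 <_) (sym (neck-length {w} h)) (n>0 n 6≤n)) (~-sym (neck-~ w))) (eqS-refl w)) , nextBit≡ i<N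
    where
    w = window n s i
    h = window-inA i<N

  Desc-snoc : ∀ {β δ γ} → Desc n 6≤n β δ → inA n γ ≡ true → γ ≢ root n → par n γ ≡ δ → Desc n 6≤n β γ
  Desc-snoc self             a b c = down a b c self
  Desc-snoc (down a′ b′ c′ D) a b c = down a′ b′ c′ (Desc-snoc D a b c)

  -- `k` is the distance from `μ n γ` to an upper bound of `μ`. It shrinks on passing to the parent,
  -- so the climb under `par` ends, and only the root can end it.
  Desc-root : ∀ k {γ} → μ n γ + k ≡ suc n * suc n → inA n γ ≡ true → Desc n 6≤n (root n) γ
  Desc-root = <-rec _ go
    where
    go : ∀ k → (∀ {k′} → k′ < k → ∀ {γ} → μ n γ + k′ ≡ suc n * suc n → inA n γ ≡ true → Desc n 6≤n (root n) γ) →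
      ∀ {γ} → μ n γ + k ≡ suc n * suc n → inA n γ ≡ true → Desc n 6≤n (root n) γ
    go k rec {γ} eq h with bool-cases (eqS γ (root n))
    ... | inj₁ r = subst (Desc n 6≤n (root n)) (sym (eqS⇒≡ γ (root n) r)) self
    ... | inj₂ r = Desc-snoc (rec k′<k β+k′ (inA⁺ length-par (par-IsA γ≢root))) h γ≢root refl
      where
      A = proj₂ (inA⁻ {γ = γ} (n>0 n 6≤n) h)
      len = proj₁ (inA⁻ {γ = γ} (n>0 n 6≤n) h)
      open Parent n A len using (par-IsA; length-par)
      γ≢root : γ ≢ root n
      γ≢root q = true≢false (≡⇒eqS q) r
      β = par n γ
      β≤ : μ n β ≤ suc n * suc n
      β≤ = <⇒≤ (μ-bound n β length-par)
      k′ = suc n * suc n ∸ μ n β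
      β+k′ : μ n β + k′ ≡ suc n * suc n
      β+k′ = m+[n∸m]≡n β≤
      k′<k : k′ < k
      k′<k = +-cancelˡ-< (μ n γ) k′ k (≤-trans (+-monoˡ-< k′ (μ-par n A len)) (≤-reflexive (trans β+k′ (sym eq))))

  length-s : length s ≡ L n
  length-s = begin
    length s ≡⟨ sym length-e ⟩
    length e ≡⟨ sym (trans (cong length (proj₁ (run-iter loop))) (length-applyUpTo (λ i → iter i ρ) (length e))) ⟩
    -- Duplicate-free lists with the same elements have the same length. `from` uses that every
    -- string of A(n) descends from the root and that the walk covers all descendants.
    length V ≡⟨ ↭-length (∼bag⇒↭ (unique∧set⇒bag (subst Unique windows≡V windows-unique) orbits-uniq (mk⇔ to from))) ⟩
    length (orbits (Alist n)) ≡⟨ length-orbits (Alist n) ⟩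
    L n ∎
    where
    open ≡-Reasoning
    orbits-uniq : Unique (orbits (Alist n))
    orbits-uniq = orbits-unique (Alist-unique n) (λ {γ} i → proj₂ (inA⁻ {γ = γ} (n>0 n 6≤n) (∈-Alist⁻ i)) ,
      subst (0 <_) (sym (proj₁ (inA⁻ {γ = γ} (n>0 n 6≤n) (∈-Alist⁻ i)))) (n>0 n 6≤n))
    to : ∀ {w} → w ∈ V → w ∈ orbits (Alist n)
    to {w} i = ∈-concat⁺′ (∈-orbit⁺ (subst (0 <_) (sym (neck-length {w} (V-inA i))) (n>0 n 6≤n)) (~-sym (neck-~ w)))
      (∈-map⁺ orbit (∈-Alist⁺ (neck-length {w} (V-inA i)) (V-inA i)))
    from : ∀ {w} → w ∈ orbits (Alist n) → w ∈ V
    from {w} i with ∈-concat⁻′ (map orbit (Alist n)) i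
    ... | _ , j , k with ∈-map⁻ orbit k
    ...   | γ , l , refl = N.cover (subst (λ β → Desc n 6≤n β γ) (sym (neck-root ~-refl))
              (Desc-root (suc n * suc n ∸ μ n γ) (m+[n∸m]≡n (<⇒≤ (μ-bound n γ (proj₁ (inA⁻ {γ = γ} (n>0 n 6≤n) (∈-Alist⁻ l)))))) (∈-Alist⁻ l)))
              (∈-orbit⁻ j)

  m : ℕ
  m = length N.E

  length-s-suc : length s ≡ suc m
  length-s-suc = trans (sym length-e) length-e-suc

  length-reverse-s : length (reverse s) ≡ suc m
  length-reverse-s = trans (length-reverse s) length-s-suc

  mirror : ℕ → ℕ
  mirror i = (m * (i + n)) % suc m

  mirror< : ∀ i → mirror i < length s
  mirror< i = subst (mirror i <_) (sym length-s-suc) (m%n<n (m * (i + n)) (suc m))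

  window-mirror : ∀ {i} → i < suc m → reverse (window n (reverse s) i) ≡ window n s (mirror i)
  window-mirror = window-reverse n s m length-s-suc

  reverse-windows-distinct : ∀ {i j} → i < j → j < suc m → window n (reverse s) i ≢ window n (reverse s) j
  reverse-windows-distinct {i} {j} i<j j<N eq with <-cmp (mirror i) (mirror j)
  ... | tri≈ _ q _ = reflection-injective m n i<j j<N q
  ... | tri< q _ _ = windows-distinct q (mirror< j) (trans (sym (window-mirror (<-trans i<j j<N))) (trans (cong reverse eq) (window-mirror j<N)))
  ... | tri> _ _ q = windows-distinct q (mirror< i) (trans (sym (window-mirror j<N)) (trans (cong reverse (sym eq)) (window-mirror (<-trans i<j j<N))))

  reverse-windows≡ : windows n (reverse s) ≡ applyUpTo (window n (reverse s)) (suc m)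
  reverse-windows≡ = trans (map-upTo (window n (reverse s)) (length (reverse s))) (cong (applyUpTo (window n (reverse s))) length-reverse-s)

  reverse-windows-unique : Unique (windows n (reverse s))
  reverse-windows-unique = subst Unique (sym reverse-windows≡) (Unique-applyUpTo⁺ (window n (reverse s)) (suc m) reverse-windows-distinct)

  -- If w and its reversal were both windows of s, each of their necklaces would, by `chiral`, be
  -- strictly smaller than the other.
  reversal-disjoint : Disjoint (windows n s) (windows n (reverse s))
  reversal-disjoint {w} (i , j) with ∈-applyUpTo⁻ (window n (reverse s)) (subst (w ∈_) reverse-windows≡ j)
  ... | k , k<N , w≡ = ≺-asym (chiral A (~-trans (~-reverse (~-sym (neck-~ w))) (~-trans (~-reflexive (sym v≡)) (neck-~ v))))
                              (chiral A′ (~-trans (~-reverse (~-sym (neck-~ v))) (~-trans (~-reflexive rev-v) (neck-~ w))))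
    where
    v = window n s (mirror k)
    A = proj₂ (inA⁻ {γ = neck w} (n>0 n 6≤n) (V-inA (subst (w ∈_) windows≡V i)))
    A′ = proj₂ (inA⁻ {γ = neck v} (n>0 n 6≤n) (window-inA (mirror< k)))
    v≡ : v ≡ reverse w
    v≡ = trans (sym (window-mirror k<N)) (cong reverse (sym w≡))
    rev-v : reverse v ≡ w
    rev-v = trans (cong reverse v≡) (reverse-involutive w)

  orientable : Orientable n s
  orientable = Unique-++⁺ windows-unique reverse-windows-unique reversal-disjoint

  tree : RCLTree n s
  tree = subst₂ (λ c α → RCLnode n c α s) length-p ρ≡root N.tree

theorem4 : (n : ℕ) → 6 ≤ n →
    Σ Str (λ s → RCLTree n s × Orientable n s × length s ≡ L n × SuccessorRule n s)
theorem4 n 6≤n = s , tree , orientable , length-s , successor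
  where open Traversal n 6≤n (Root.rootNode n 6≤n)
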